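{- Let $k,s\ge 2$ be integers. Then there exists a constant $C=C_{k,s}>0$ such that the following holds. Let $G$ be a graph on $n$ vertices which does not contain $K_{s,s}$ as a subgraph, and let $V(G)=A\cup B$ be a partition with at least $e(A,B)\ge Cn^{1+1/k}$ edges between $A$ and $B$. Then $G$ contains an induced cycle of length $2k$ with vertices $v_1,v_2,\dots,v_{2k}$ (in cyclic order) such that $v_1,v_3,\dots,v_{2k-1}\in A$ and $v_2,v_4,\dots,v_{2k}\in B$.
   Context: $e(A,B)$ denotes the number of edges of $G$ with one endpoint in $A$ and the other in $B$. -}

module Defs where

open import Data.Nat using (ℕ; zero; suc; _+_; _*_; _^_; _≤_; _%_)
open import Data.Nat.Properties using ()
open import Data.Fin using (Fin; toℕ)
open import Data.Bool using (Bool; true; false; T; not)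
open import Data.List using (List; map)
open import Data.Nat.ListAction using (sum)
open import Data.Sum using (_⊎_)
open import Data.List using (allFin)
open import Data.Product using (Σ; _×_; _,_)
open import Data.Empty using (⊥)
open import Relation.Nullary using (¬_; Dec; yes; no)
open import Relation.Binary.PropositionalEquality using (_≡_)
open import Function.Definitions using (Injective)

record Graph (n : ℕ) : Set₁ where
  field
    Adj   : Fin n → Fin n → Set
    adj?  : (u v : Fin n) → Dec (Adj u v)
    sym   : ∀ {u v} → Adj u v → Adj v u
    irrefl : ∀ {u} → ¬ Adj u u
open Graph public

⌊_⌋₁ : ∀ {P : Set} → Dec P → ℕ
⌊ yes _ ⌋₁ = 1
⌊ no _ ⌋₁ = 0

-- A partition V(G) = A ∪ B is given by its indicator inA : Fin n → Bool
-- (A = {v | inA v ≡ true}, B = {v | inA v ≡ false}).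
-- e(A,B) = number of edges with one endpoint in A and the other in B,
-- i.e. the number of ordered pairs (a , b) with a ∈ A, b ∈ B, a ~ b.
eAB : ∀ {n} → Graph n → (Fin n → Bool) → ℕ
eAB {n} G inA =
  sum (map (λ a → sum (map (λ b → contrib a b) (allFin n))) (allFin n))
  where
  contrib : Fin n → Fin n → ℕ
  contrib a b with inA a | inA b
  ... | true | false = ⌊ adj? G a b ⌋₁
  ... | _    | _     = 0

ContainsKss : ∀ {n} → Graph n → ℕ → Set
ContainsKss {n} G s =
  Σ (Fin s → Fin n) λ f → Σ (Fin s → Fin n) λ g →
    Injective _≡_ _≡_ f × Injective _≡_ _≡_ g ×
    (∀ i j → ¬ (f i ≡ g j)) × (∀ i j → Adj G (f i) (g j))

CycAdj : (m : ℕ) → Fin m → Fin m → Set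
CycAdj m i j =
  (suc (toℕ i) ≡ toℕ j) ⊎ (suc (toℕ j) ≡ toℕ i) ⊎
  ((toℕ i ≡ 0) × (suc (toℕ j) ≡ m)) ⊎ ((toℕ j ≡ 0) × (suc (toℕ i) ≡ m))

-- Even index (0-based): index 0,2,4,... correspond to v₁,v₃,... of the paper.
Even : ℕ → Set
Even i = i % 2 ≡ 0

HasInducedBipartiteC2k : ∀ {n} → Graph n → (Fin n → Bool) → ℕ → Set
HasInducedBipartiteC2k {n} G inA k =
  Σ (Fin (2 * k) → Fin n) λ v →
    Injective _≡_ _≡_ v ×
    (∀ i j → (Adj G (v i) (v j) → CycAdj (2 * k) i j) ×
             (CycAdj (2 * k) i j → Adj G (v i) (v j))) ×
    (∀ i → (Even (toℕ i) → inA (v i) ≡ true) ×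
           (¬ Even (toℕ i) → inA (v i) ≡ false))

{-# OPTIONS --safe #-}

-- Call two vertices conflicting if they are equal or adjacent in G; walks are taken along the edges between A and B.
-- Since G is K_{s,s}-free, conflicting pairs have small density between large sets, so all but a small fraction of the
-- walks of length k are induced paths. A pair x, y is overfull at length i if it is joined by many induced paths of
-- length i with no shorter overfull subpath; then many of these paths are internally disjoint.
-- * Length 2: if some neighbourhood contains many vertices that are pairwise overfull, consecutive ones can be joined
--   through common neighbours to an induced cycle x₁ z₁ … x_k z_k. Otherwise every neighbourhood has few vertices with few
--   non-overfull partners, and a positive proportion of the k-walks has no overfull subwalk of length 2.
-- * Length 2 < i < k: if many walks of length i from x end in overfull partners of x, their last edges form a dense
--   bipartite graph (as in Faudree–Simonovits), which contains an induced path of length 2 (k − i) between two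
--   partners y, y' of x; two of the many disjoint paths from x to y and to y' close it up to an induced 2k-cycle.
-- * Length k: two of the disjoint paths form an induced 2k-cycle.
-- Without such a cycle there remain on the order of n d^k walks of length k, with boundedly many between any two
-- vertices, so d^k = O(n) for the average degree d.
module Submission where

open import Defs hiding (sym)
open import Level using (Level)
open import Data.Nat using (ℕ; zero; suc; _+_; _*_; _^_; _∸_; _≤_; _<_; z≤n; s≤s; _≤?_; _<?_; _≟_; NonZero; >-nonZero; _/_; _%_)
open import Data.Nat.Properties hiding (_≟_)
open import Data.Nat.DivMod using ([m+n]%n≡m%n; m≡m%n+[m/n]*n; m%n<n; m/n*n≤m)
open import Data.Nat.ListAction using (sum)
open import Data.Nat.Tactic.RingSolver using (solve-∀)
open import Data.Bool using (Bool; true; false; not)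
import Data.Bool.Properties as Bool
open import Data.Fin using (Fin; zero; suc; toℕ; cast)
import Data.Fin.Properties as Fin
open import Data.List using (List; []; _∷_; _++_; length; map; allFin; filter; concat; concatMap; take; drop; lookup; reverse; upTo; [_])
open import Data.List.Properties
  using (length-map; length-++; length-take; length-drop; length-tabulate; length-reverse; length-upTo; length-filter;
         ++-assoc; ++-identityʳ; map-++; map-tabulate; take++drop≡id; reverse-++; unfold-reverse; concat-map-[_];
         ∷-injectiveˡ; ∷-injectiveʳ)
open import Data.List.Membership.Propositional using (_∈_)
open import Data.List.Membership.Propositional.Properties
  using (∈-allFin; ∈-filter⁺; ∈-filter⁻; ∈-map⁺; ∈-map⁻; ∈-++⁺ˡ; ∈-++⁺ʳ; ∈-++⁻; ∈-concat⁺′; ∈-concat⁻′; ∈-concatMap⁻;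
         ∈-lookup; ∈-∃++; ∈-upTo⁺; ∈-upTo⁻)
open import Data.List.Relation.Unary.Any using (Any; here; there; any?; satisfied)
open import Data.List.Relation.Unary.Any.Properties using (reverse⁺; reverse⁻)
open import Data.List.Relation.Unary.All using (All; []; _∷_; all?)
import Data.List.Relation.Unary.All as All
import Data.List.Relation.Unary.All.Properties as All
open import Data.List.Relation.Unary.AllPairs using (AllPairs; []; _∷_)
import Data.List.Relation.Unary.AllPairs as AllPairs
import Data.List.Relation.Unary.AllPairs.Properties as AllPairs
open import Data.List.Relation.Unary.Unique.Propositional using (Unique)
import Data.List.Relation.Unary.Unique.Propositional.Properties as Unique
open import Data.List.Relation.Binary.Pointwise using (Pointwise; []; _∷_)
open import Data.Product using (Σ; ∃; ∃₂; _×_; _,_; proj₁; proj₂)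
open import Data.Sum using (_⊎_; inj₁; inj₂)
import Data.Sum as Sum
open import Data.Unit using (⊤; tt)
open import Data.Empty using (⊥; ⊥-elim)
open import Function using (_∘_)
open import Function.Definitions using (Injective)
open import Relation.Nullary using (¬_; Dec; yes; no; ¬?; _×-dec_; _⊎-dec_)
open import Relation.Nullary.Decidable using (decidable-stable; map′)
open import Relation.Unary using (Pred; Decidable)
open import Relation.Binary using (tri<; tri≈; tri>)
open import Relation.Binary.PropositionalEquality
  using (_≡_; _≢_; refl; sym; trans; cong; cong₂; subst; subst₂; module ≡-Reasoning)

-- Internally disjoint paths may still have edges between them. In a K_{s,s}-free graph, however,
-- only boundedly many vertices conflict with a fixed proportion 1/q of a large disjoint family;
-- these are its rich vertices. Paths are chosen one at a time, each avoiding the vertices rich for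
-- families still to be used, so every later family keeps enough members.
--
-- Overfullness counts only walks without shorter overfull subwalks. Fixing one interior vertex then
-- leaves boundedly many of them, which is why disjoint ones can be chosen greedily.
--
-- Length 2 is separate because there the penultimate vertices are neighbours of x, so a path
-- through them would have chords to x.
--
-- The graph need not be regular. Walks are counted in a cover on N vertices with maximum degree d
-- and average degree at least d/2, while their ends are compared in the graph itself. This gives N
-- θ^k ≤ 2 n² c(k), where d is a constant multiple of θ. Since N ≥ 2n, it follows that θ^k ≤ c(k) n,
-- against the assumed number of edges.

private variable
  A A′ : Set
  𝒫 𝒬 ℛ : Set

-- Finite sums and indicators

𝟙 : Dec 𝒫 → ℕ
𝟙 (yes _) = 1
𝟙 (no _) = 0

𝟙-yes : (p? : Dec 𝒫) → 𝒫 → 𝟙 p? ≡ 1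
𝟙-yes (yes _) _ = refl
𝟙-yes (no ¬p) p = ⊥-elim (¬p p)

𝟙-no : (p? : Dec 𝒫) → ¬ 𝒫 → 𝟙 p? ≡ 0
𝟙-no (yes p) ¬p = ⊥-elim (¬p p)
𝟙-no (no _) _ = refl

𝟙≤1 : (p? : Dec 𝒫) → 𝟙 p? ≤ 1
𝟙≤1 (yes _) = ≤-refl
𝟙≤1 (no _) = z≤n

𝟙-≤ : (p? : Dec 𝒫) {m : ℕ} → (𝒫 → 1 ≤ m) → 𝟙 p? ≤ m
𝟙-≤ (yes p) h = h p
𝟙-≤ (no _) _ = z≤n

𝟙-elim : (p? : Dec 𝒫) → 1 ≤ 𝟙 p? → 𝒫
𝟙-elim (yes p) _ = p

𝟙≡1 : (p? : Dec 𝒫) → 𝒫 → 1 ≤ 𝟙 p?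
𝟙≡1 p? p = ≤-reflexive (sym (𝟙-yes p? p))

𝟙-mono : (p? : Dec 𝒫) (q? : Dec 𝒬) → (𝒫 → 𝒬) → 𝟙 p? ≤ 𝟙 q?
𝟙-mono p? q? f = 𝟙-≤ p? (𝟙≡1 q? ∘ f)

𝟙-⊎ : (p? : Dec 𝒫) (q? : Dec 𝒬) (r? : Dec ℛ) → (𝒫 → 𝒬 ⊎ ℛ) → 𝟙 p? ≤ 𝟙 q? + 𝟙 r?
𝟙-⊎ p? q? r? f = 𝟙-≤ p? λ p → case' (f p)
  where
  case' : _ ⊎ _ → 1 ≤ 𝟙 q? + 𝟙 r?
  case' (inj₁ q) = ≤-trans (𝟙≡1 q? q) (m≤m+n _ _)
  case' (inj₂ r) = ≤-trans (𝟙≡1 r? r) (m≤n+m _ _)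

𝟙-× : (p? : Dec 𝒫) (q? : Dec 𝒬) (r? : Dec ℛ) → (𝒫 → 𝒬 × ℛ) → 𝟙 p? ≤ 𝟙 q? * 𝟙 r?
𝟙-× p? q? r? f = 𝟙-≤ p? λ p → *-mono-≤ (𝟙≡1 q? (proj₁ (f p))) (𝟙≡1 r? (proj₂ (f p)))

∑ : List A → (A → ℕ) → ℕ
∑ [] f = 0
∑ (x ∷ xs) f = f x + ∑ xs f

∑-mono∈ : (xs : List A) {f g : A → ℕ} → (∀ x → x ∈ xs → f x ≤ g x) → ∑ xs f ≤ ∑ xs g
∑-mono∈ [] h = z≤n
∑-mono∈ (x ∷ xs) h = +-mono-≤ (h x (here refl)) (∑-mono∈ xs λ y y∈ → h y (there y∈))

∑-mono : (xs : List A) {f g : A → ℕ} → (∀ x → f x ≤ g x) → ∑ xs f ≤ ∑ xs g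
∑-mono xs h = ∑-mono∈ xs λ x _ → h x

∑-cong : (xs : List A) {f g : A → ℕ} → (∀ x → f x ≡ g x) → ∑ xs f ≡ ∑ xs g
∑-cong [] h = refl
∑-cong (x ∷ xs) h = cong₂ _+_ (h x) (∑-cong xs h)

∑-+ : (xs : List A) (f g : A → ℕ) → ∑ xs (λ x → f x + g x) ≡ ∑ xs f + ∑ xs g
∑-+ [] f g = refl
∑-+ (x ∷ xs) f g = trans (cong (f x + g x +_) (∑-+ xs f g)) (swap (f x) (g x) (∑ xs f) (∑ xs g))
  where
  swap : ∀ a b c d → a + b + (c + d) ≡ a + c + (b + d)
  swap = solve-∀

∑-*ˡ : (xs : List A) (c : ℕ) (f : A → ℕ) → ∑ xs (λ x → c * f x) ≡ c * ∑ xs f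
∑-*ˡ [] c f = sym (*-zeroʳ c)
∑-*ˡ (x ∷ xs) c f = trans (cong (c * f x +_) (∑-*ˡ xs c f)) (sym (*-distribˡ-+ c (f x) (∑ xs f)))

∑-*ʳ : (xs : List A) (c : ℕ) (f : A → ℕ) → ∑ xs (λ x → f x * c) ≡ ∑ xs f * c
∑-*ʳ [] c f = refl
∑-*ʳ (x ∷ xs) c f = trans (cong (f x * c +_) (∑-*ʳ xs c f)) (sym (*-distribʳ-+ c (f x) (∑ xs f)))

∑-const : (xs : List A) (c : ℕ) → ∑ xs (λ _ → c) ≡ length xs * c
∑-const [] c = refl
∑-const (x ∷ xs) c = cong (c +_) (∑-const xs c)

∑-≤-const : (xs : List A) (c : ℕ) {f : A → ℕ} → (∀ x → x ∈ xs → f x ≤ c) → ∑ xs f ≤ length xs * c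
∑-≤-const xs c h = ≤-trans (∑-mono∈ xs h) (≤-reflexive (∑-const xs c))

∑-zero : (xs : List A) → ∑ xs (λ _ → 0) ≡ 0
∑-zero xs = trans (∑-const xs 0) (*-zeroʳ (length xs))

∑-swap : (xs : List A) (ys : List A′) (f : A → A′ → ℕ) →
         ∑ xs (λ x → ∑ ys (f x)) ≡ ∑ ys (λ y → ∑ xs (λ x → f x y))
∑-swap [] ys f = sym (∑-zero ys)
∑-swap (x ∷ xs) ys f =
  trans (cong (∑ ys (f x) +_) (∑-swap xs ys f)) (sym (∑-+ ys (f x) (λ y → ∑ xs (λ x → f x y))))

∑-++ : (xs ys : List A) (f : A → ℕ) → ∑ (xs ++ ys) f ≡ ∑ xs f + ∑ ys f
∑-++ [] ys f = refl
∑-++ (x ∷ xs) ys f = trans (cong (f x +_) (∑-++ xs ys f)) (sym (+-assoc (f x) _ _))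

∑-map : (g : A → A′) (xs : List A) (f : A′ → ℕ) → ∑ (map g xs) f ≡ ∑ xs (f ∘ g)
∑-map g [] f = refl
∑-map g (x ∷ xs) f = cong (f (g x) +_) (∑-map g xs f)

∑-concat : (xss : List (List A)) (f : A → ℕ) → ∑ (concat xss) f ≡ ∑ xss (λ xs → ∑ xs f)
∑-concat [] f = refl
∑-concat (xs ∷ xss) f = trans (∑-++ xs (concat xss) f) (cong (∑ xs f +_) (∑-concat xss f))

∑-∈ : (xs : List A) (f : A → ℕ) {x : A} → x ∈ xs → f x ≤ ∑ xs f
∑-∈ (x ∷ xs) f (here refl) = m≤m+n (f x) _
∑-∈ (x ∷ xs) f (there x∈) = ≤-trans (∑-∈ xs f x∈) (m≤n+m _ (f x))

∑-<⇒∃ : (xs : List A) (f g : A → ℕ) → ∑ xs f < ∑ xs g → ∃ λ x → x ∈ xs × f x < g x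
∑-<⇒∃ (x ∷ xs) f g lt with f x <? g x
... | yes p = x , here refl , p
... | no ¬p with ∑-<⇒∃ xs f g (+-cancelˡ-< (f x) _ _ (<-≤-trans lt (+-monoˡ-≤ _ (≮⇒≥ ¬p))))
... | y , y∈ , q = y , there y∈ , q

count-filter : {P : Pred A Level.zero} (P? : Decidable P) (xs : List A) → length (filter P? xs) ≡ ∑ xs (λ x → 𝟙 (P? x))
count-filter P? [] = refl
count-filter P? (x ∷ xs) with P? x
... | yes _ = cong suc (count-filter P? xs)
... | no _ = count-filter P? xs

∑-filter-≤ : {P : Pred A Level.zero} (P? : Decidable P) (xs : List A) (f : A → ℕ) → ∑ (filter P? xs) f ≤ ∑ xs f
∑-filter-≤ P? [] f = z≤n
∑-filter-≤ P? (x ∷ xs) f with P? x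
... | yes _ = +-monoʳ-≤ (f x) (∑-filter-≤ P? xs f)
... | no _ = ≤-trans (∑-filter-≤ P? xs f) (m≤n+m _ (f x))

∑ᶠ : ∀ {N} → (Fin N → ℕ) → ℕ
∑ᶠ {N} = ∑ (allFin N)

∑ᶠ-∈ : ∀ {N} (f : Fin N → ℕ) (i : Fin N) → f i ≤ ∑ᶠ f
∑ᶠ-∈ f i = ∑-∈ _ f (∈-allFin i)

∑-𝟙≡ : (_≟_ : (x y : A) → Dec (x ≡ y)) (xs : List A) (y : A) → Unique xs → ∑ xs (λ x → 𝟙 (x ≟ y)) ≤ 1
∑-𝟙≡ _≟_ [] y _ = z≤n
∑-𝟙≡ _≟_ (x ∷ xs) y (x∉ ∷ u) with x ≟ y
... | no _ = ∑-𝟙≡ _≟_ xs y u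
... | yes refl = ≤-reflexive (cong suc (trans (vanish xs x∉) refl))
  where
  vanish : ∀ xs → All (x ≢_) xs → ∑ xs (λ z → 𝟙 (z ≟ x)) ≡ 0
  vanish [] [] = refl
  vanish (z ∷ zs) (x≢z ∷ ps) = cong₂ _+_ (𝟙-no (z ≟ x) (x≢z ∘ sym)) (vanish zs ps)

∑-unique-≤ : ∀ {N} (xs : List (Fin N)) → Unique xs → (f : Fin N → ℕ) → ∑ xs f ≤ ∑ᶠ f
∑-unique-≤ {N} xs u f = begin
  ∑ xs f
    ≤⟨ ∑-mono xs (λ x → ≤-trans (≤-reflexive (sym (trans (cong (_* f x) (𝟙-yes (x Fin.≟ x) refl)) (*-identityˡ _)))) (∑ᶠ-∈ (λ v → 𝟙 (x Fin.≟ v) * f v) x)) ⟩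
  ∑ xs (λ x → ∑ᶠ λ v → 𝟙 (x Fin.≟ v) * f v) ≡⟨ ∑-swap xs (allFin N) _ ⟩
  ∑ᶠ (λ v → ∑ xs λ x → 𝟙 (x Fin.≟ v) * f v) ≡⟨ ∑-cong (allFin N) (λ v → ∑-*ʳ xs (f v) _) ⟩
  ∑ᶠ (λ v → ∑ xs (λ x → 𝟙 (x Fin.≟ v)) * f v)
    ≤⟨ ∑-mono (allFin N) (λ v → ≤-trans (*-monoˡ-≤ (f v) (∑-𝟙≡ Fin._≟_ xs v u)) (≤-reflexive (*-identityˡ _))) ⟩
  ∑ᶠ f ∎
  where open ≤-Reasoning

-- Walks are counted as arbitrary tuples of vertices weighted by an indicator. Cutting a walk at a
-- vertex is then a regrouping of an iterated sum (`∑ᴸ-++`, `∑ᴸ-snoc`).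
∑ᴸ : List A → ℕ → (List A → ℕ) → ℕ
∑ᴸ U zero f = f []
∑ᴸ U (suc m) f = ∑ U λ v → ∑ᴸ U m (f ∘ (v ∷_))

module _ (U : List A) where

  ∑ᴸ-mono : ∀ m {f g : List A → ℕ} → (∀ l → length l ≡ m → f l ≤ g l) → ∑ᴸ U m f ≤ ∑ᴸ U m g
  ∑ᴸ-mono zero h = h [] refl
  ∑ᴸ-mono (suc m) h = ∑-mono U λ v → ∑ᴸ-mono m λ l e → h (v ∷ l) (cong suc e)

  ∑ᴸ-cong : ∀ m {f g : List A → ℕ} → (∀ l → f l ≡ g l) → ∑ᴸ U m f ≡ ∑ᴸ U m g
  ∑ᴸ-cong zero h = h []
  ∑ᴸ-cong (suc m) h = ∑-cong U λ v → ∑ᴸ-cong m λ l → h (v ∷ l)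

  ∑ᴸ-+ : ∀ m (f g : List A → ℕ) → ∑ᴸ U m (λ l → f l + g l) ≡ ∑ᴸ U m f + ∑ᴸ U m g
  ∑ᴸ-+ zero f g = refl
  ∑ᴸ-+ (suc m) f g = trans (∑-cong U λ v → ∑ᴸ-+ m _ _) (∑-+ U _ _)

  ∑ᴸ-*ʳ : ∀ m (c : ℕ) (f : List A → ℕ) → ∑ᴸ U m (λ l → f l * c) ≡ ∑ᴸ U m f * c
  ∑ᴸ-*ʳ zero c f = refl
  ∑ᴸ-*ʳ (suc m) c f = trans (∑-cong U λ v → ∑ᴸ-*ʳ m c _) (∑-*ʳ U c _)

  ∑ᴸ-*ˡ : ∀ m (c : ℕ) (f : List A → ℕ) → ∑ᴸ U m (λ l → c * f l) ≡ c * ∑ᴸ U m f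
  ∑ᴸ-*ˡ zero c f = refl
  ∑ᴸ-*ˡ (suc m) c f = trans (∑-cong U λ v → ∑ᴸ-*ˡ m c _) (∑-*ˡ U c _)

  ∑ᴸ-const : ∀ m (c : ℕ) → ∑ᴸ U m (λ _ → c) ≡ length U ^ m * c
  ∑ᴸ-const zero c = sym (+-identityʳ c)
  ∑ᴸ-const (suc m) c = trans (∑-cong U λ v → ∑ᴸ-const m c)
    (trans (∑-const U _) (sym (*-assoc (length U) _ c)))

  ∑ᴸ-∑ : ∀ m (xs : List A′) (f : List A → A′ → ℕ) →
         ∑ᴸ U m (λ l → ∑ xs (f l)) ≡ ∑ xs (λ x → ∑ᴸ U m (λ l → f l x))
  ∑ᴸ-∑ zero xs f = refl
  ∑ᴸ-∑ (suc m) xs f = trans (∑-cong U λ v → ∑ᴸ-∑ m xs _) (∑-swap U xs _)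

  ∑ᴸ-++ : ∀ a b (f : List A → ℕ) → ∑ᴸ U (a + b) f ≡ ∑ᴸ U a (λ p → ∑ᴸ U b (λ q → f (p ++ q)))
  ∑ᴸ-++ zero b f = refl
  ∑ᴸ-++ (suc a) b f = ∑-cong U λ v → ∑ᴸ-++ a b _

  ∑ᴸ-snoc : ∀ a (f : List A → ℕ) → ∑ᴸ U (suc a) f ≡ ∑ᴸ U a (λ p → ∑ U (λ v → f (p ++ v ∷ [])))
  ∑ᴸ-snoc a f = trans (cong (λ m → ∑ᴸ U m f) (+-comm 1 a)) (∑ᴸ-++ a 1 f)

  ∑ᴸ-<⇒∃ : ∀ m (f g : List A → ℕ) → ∑ᴸ U m f < ∑ᴸ U m g → ∃ λ l → length l ≡ m × f l < g l
  ∑ᴸ-<⇒∃ zero f g lt = [] , refl , lt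
  ∑ᴸ-<⇒∃ (suc m) f g lt with ∑-<⇒∃ U _ _ lt
  ... | v , _ , lt' with ∑ᴸ-<⇒∃ m _ _ lt'
  ... | l , e , lt'' = v ∷ l , cong suc e , lt''

-- Conflicts in K_{S,S}-free relations

-- `X` and `Y` may overlap, as the relation is going to be reflexive; `Kss-free⇒KFree` pays for the
-- overlap by taking `S` twice as large as the parts of the forbidden subgraph.
KFree : ℕ → (A → A → Set) → Set
KFree S R = ∀ X Y → Unique X → Unique Y → length X ≡ S → S ≤ length Y →
            (∀ {x y} → x ∈ X → y ∈ Y → R x y) → ⊥

take-⊆ : ∀ k {xs : List A} {x} → x ∈ take k xs → x ∈ xs
take-⊆ (suc k) {_ ∷ _} (here e) = here e
take-⊆ (suc k) {_ ∷ _} (there x∈) = there (take-⊆ k x∈)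

length-take-≤ : ∀ k {xs : List A} → k ≤ length xs → length (take k xs) ≡ k
length-take-≤ k {xs} h = trans (length-take k xs) (m≤n⇒m⊓n≡m h)

filter-split : {P : Pred A Level.zero} (P? : Decidable P) (xs : List A) →
               length (filter P? xs) + length (filter (¬? ∘ P?) xs) ≡ length xs
filter-split P? [] = refl
filter-split P? (x ∷ xs) with P? x
... | yes _ = cong suc (filter-split P? xs)
... | no _ = trans (+-suc _ _) (cong suc (filter-split P? xs))

-- With g = `q * w * S` + 1, this is `q` times the error term g 2^g S of `conflicts-≤` for a set of
-- g vertices.
richThreshold : (S q w : ℕ) → ℕ
richThreshold S q w = q * (suc (q * w * S) * (2 ^ suc (q * w * S) * S))

-- The summands serve the two cases of `pairs-≤`: a large `Y`, where at most `q * 1 * S` vertices of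
-- `X` conflict with a proportion 1/q of it, and a `Y` below the threshold.
pairConst : (S q : ℕ) → ℕ
pairConst S q = q * 1 * S + richThreshold S q 1

module Conflict (R : A → A → Set) (R? : ∀ u v → Dec (R u v)) where

  deg : List A → A → ℕ
  deg X y = ∑ X λ x → 𝟙 (R? x y)

  deg-∷-no : ∀ {x X y} → ¬ R x y → deg (x ∷ X) y ≡ deg X y
  deg-∷-no {x} {X} {y} h = cong (_+ deg X y) (𝟙-no (R? x y) h)

  record CompletePair (X Y : List A) (a b : ℕ) : Set where
    constructor pair
    field
      X' Y' : List A
      uniqueX : Unique X'
      uniqueY : Unique Y'
      lengthX : length X' ≡ a
      lengthY : b ≤ length Y'
      ⊆X : ∀ {x} → x ∈ X' → x ∈ X
      ⊆Y : ∀ {y} → y ∈ Y' → y ∈ Y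
      complete : ∀ {x y} → x ∈ X' → y ∈ Y' → R x y

  -- Scan `X`, and at each vertex restrict `Y` either to the part in conflict with it or to the
  -- rest, whichever stays large enough; this costs a factor 2 per vertex. In the first case the
  -- vertex joins `X'` and uses up one conflict of every remaining `y`; in the second the remaining
  -- `y` lose no conflict. So `a` vertices are collected in the end.
  pigeonhole : ∀ X Y a b → Unique X → Unique Y → (∀ {y} → y ∈ Y → a ≤ deg X y) →
               2 ^ length X * b ≤ length Y → 1 ≤ b → CompletePair X Y a b
  pigeonhole X Y zero b uX uY _ h _ =
    pair [] Y [] uY refl (≤-trans (m≤n*m b (2 ^ length X) {{m^n≢0 2 (length X)}}) h) (λ ()) (λ y → y) (λ ())
  pigeonhole [] (y ∷ Y) (suc a) b uX uY d _ _ with d (here refl)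
  ... | ()
  pigeonhole [] [] (suc a) (suc b) uX uY d () _
  pigeonhole (x ∷ X) Y (suc a) b (x∉ ∷ uX) uY d h 1≤b
    with 2 ^ length X * b ≤? length (filter (R? x) Y)
  ... | yes big = pair (x ∷ C.X') C.Y' (All.tabulate (λ z∈ → All.lookup x∉ (C.⊆X z∈)) ∷ C.uniqueX) C.uniqueY
          (cong suc C.lengthX) C.lengthY sub (proj₁ ∘ ∈-filter⁻ (R? x) ∘ C.⊆Y) comp
    where
    module C = CompletePair (pigeonhole X (filter (R? x) Y) a b uX (Unique.filter⁺ (R? x) uY)
      (λ y∈ → ≤-pred (≤-trans (d (proj₁ (∈-filter⁻ (R? x) y∈))) (+-monoˡ-≤ _ (𝟙≤1 (R? x _))))) big 1≤b)
    sub : ∀ {z} → z ∈ x ∷ C.X' → z ∈ x ∷ X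
    sub (here e) = here e
    sub (there z∈) = there (C.⊆X z∈)
    comp : ∀ {z y} → z ∈ x ∷ C.X' → y ∈ C.Y' → R z y
    comp (here refl) y∈ = proj₂ (∈-filter⁻ (R? x) {xs = Y} (C.⊆Y y∈))
    comp (there z∈) y∈ = C.complete z∈ y∈
  ... | no small = pair C.X' C.Y' C.uniqueX C.uniqueY C.lengthX C.lengthY (there ∘ C.⊆X)
          (proj₁ ∘ ∈-filter⁻ (¬? ∘ R? x) ∘ C.⊆Y) C.complete
    where
    big : 2 ^ length X * b ≤ length (filter (¬? ∘ R? x) Y)
    big = +-cancelˡ-≤ (2 ^ length X * b) _ _ (begin
      2 ^ length X * b + 2 ^ length X * b ≡⟨ double (2 ^ length X) b ⟩
      2 ^ suc (length X) * b ≤⟨ h ⟩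
      length Y ≡⟨ sym (filter-split (R? x) Y) ⟩
      length (filter (R? x) Y) + _ ≤⟨ +-monoˡ-≤ _ (<⇒≤ (≰⇒> small)) ⟩
      2 ^ length X * b + _ ∎)
      where
      open ≤-Reasoning
      double : ∀ p b → p * b + p * b ≡ 2 * p * b
      double = solve-∀
    d' : ∀ {y} → y ∈ filter (¬? ∘ R? x) Y → suc a ≤ deg X y
    d' y∈ = ≤-trans (d (proj₁ (∈-filter⁻ (¬? ∘ R? x) y∈)))
      (≤-reflexive (deg-∷-no {X = X} (proj₂ (∈-filter⁻ (¬? ∘ R? x) {xs = Y} y∈))))
    module C = CompletePair (pigeonhole X (filter (¬? ∘ R? x) Y) (suc a) b uX (Unique.filter⁺ (¬? ∘ R? x) uY) d' big 1≤b)

  module _ {S : ℕ} (1≤S : 1 ≤ S) (kfree : KFree S R) where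

    -- A vertex of `Y` with fewer than `S` conflicts contributes at most `S`. Any other contributes
    -- at most `length X`, and there are at most 2^|X| S of these, since more would yield a
    -- forbidden complete pair by `pigeonhole`.
    conflicts-≤ : ∀ X Y → Unique X → Unique Y →
                  ∑ Y (deg X) ≤ length Y * S + length X * (2 ^ length X * S)
    conflicts-≤ X Y uX uY = begin
      ∑ Y (deg X) ≤⟨ ∑-mono Y bound ⟩
      ∑ Y (λ y → S + length X * 𝟙 (S ≤? deg X y)) ≡⟨ ∑-+ Y _ _ ⟩
      ∑ Y (λ _ → S) + ∑ Y (λ y → length X * 𝟙 (S ≤? deg X y))
                                                       ≡⟨ cong₂ _+_ (∑-const Y S) (∑-*ˡ Y (length X) _) ⟩
      length Y * S + length X * ∑ Y (λ y → 𝟙 (S ≤? deg X y))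
                                                       ≡⟨ cong (λ z → length Y * S + length X * z) (sym (count-filter heavy? Y)) ⟩
      length Y * S + length X * length (filter heavy? Y)
                                                       ≤⟨ +-monoʳ-≤ (length Y * S) (*-monoʳ-≤ (length X) few) ⟩
      length Y * S + length X * (2 ^ length X * S) ∎
      where
      open ≤-Reasoning
      heavy? : Decidable (λ y → S ≤ deg X y)
      heavy? y = S ≤? deg X y
      deg≤ : ∀ y → deg X y ≤ length X
      deg≤ y = ≤-trans (∑-≤-const X 1 (λ x _ → 𝟙≤1 (R? x y))) (≤-reflexive (*-identityʳ _))
      bound : ∀ y → deg X y ≤ S + length X * 𝟙 (S ≤? deg X y)
      bound y with S ≤? deg X y
      ... | yes _ = ≤-trans (deg≤ y) (≤-trans (≤-reflexive (sym (*-identityʳ _))) (m≤n+m _ S))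
      ... | no ¬h = ≤-trans (<⇒≤ (≰⇒> ¬h)) (m≤m+n S _)
      few : length (filter heavy? Y) ≤ 2 ^ length X * S
      few with 2 ^ length X * S ≤? length (filter heavy? Y)
      ... | no ¬h = <⇒≤ (≰⇒> ¬h)
      ... | yes h = ⊥-elim (kfree C.X' C.Y' C.uniqueX C.uniqueY C.lengthX C.lengthY C.complete)
        where
        module C = CompletePair (pigeonhole X (filter heavy? Y) S S uX (Unique.filter⁺ heavy? uY)
                    (λ y∈ → proj₂ (∈-filter⁻ heavy? {xs = Y} y∈)) h 1≤S)

  hits : A → List (List A) → ℕ
  hits v 𝓕 = ∑ 𝓕 λ P → 𝟙 (any? (R? v) P)

  hits-≤ : ∀ v 𝓕 → hits v 𝓕 ≤ ∑ (concat 𝓕) (λ y → 𝟙 (R? v y))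
  hits-≤ v 𝓕 = ≤-trans (∑-mono 𝓕 λ P → 𝟙-≤ (any? (R? v) P) (one P)) (≤-reflexive (sym (∑-concat 𝓕 _)))
    where
    one : ∀ P → Any (R v) P → 1 ≤ ∑ P (λ y → 𝟙 (R? v y))
    one (y ∷ P) (here r) = ≤-trans (𝟙≡1 (R? v y) r) (m≤m+n _ _)
    one (y ∷ P) (there a) = ≤-trans (one P a) (m≤n+m _ _)

  module _ {S : ℕ} (1≤S : 1 ≤ S) (kfree : KFree S R) where

    -- Double counting with exactly g = `q * w * S` + 1 rich vertices: they have at least g T / q
    -- conflicts with vertices of the family, while `conflicts-≤` permits only w T S plus an error
    -- term, and `T` exceeds `q` times that error.
    rich-few : ∀ q w T 𝓕 X → Unique (concat 𝓕) → length (concat 𝓕) ≤ w * T → richThreshold S q w < T →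
               Unique X → (∀ {x} → x ∈ X → T ≤ q * hits x 𝓕) → length X ≤ q * w * S
    rich-few q w T 𝓕 X u𝓕 len T> uX rich with length X ≤? q * w * S
    ... | yes h = h
    ... | no ¬h = ⊥-elim (<-irrefl refl (begin-strict
      g * T ≡⟨ trans (cong (_* T) (sym lenX)) (sym (∑-const Z T)) ⟩
      ∑ Z (λ _ → T) ≤⟨ ∑-mono∈ Z (λ x x∈ → ≤-trans (rich (take-⊆ g x∈)) (*-monoʳ-≤ q (hits-≤ x 𝓕))) ⟩
      ∑ Z (λ x → q * ∑ C (λ y → 𝟙 (R? x y))) ≡⟨ trans (∑-*ˡ Z q _) (cong (q *_) (∑-swap Z C _)) ⟩
      q * ∑ C (deg Z) ≤⟨ *-monoʳ-≤ q (conflicts-≤ 1≤S kfree Z C (Unique.take⁺ g uX) u𝓕) ⟩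
      q * (length C * S + length Z * (2 ^ length Z * S))
                                                      ≡⟨ cong (λ z → q * (length C * S + z * (2 ^ z * S))) lenX ⟩
      q * (length C * S + g * (2 ^ g * S)) ≡⟨ *-distribˡ-+ q _ _ ⟩
      q * (length C * S) + richThreshold S q w ≤⟨ +-monoˡ-≤ _ (*-monoʳ-≤ q (*-monoˡ-≤ S len)) ⟩
      q * (w * T * S) + richThreshold S q w <⟨ +-monoʳ-< (q * (w * T * S)) T> ⟩
      q * (w * T * S) + T ≡⟨ ident q w T S ⟩
      g * T ∎))
      where
      open ≤-Reasoning
      g : ℕ
      g = suc (q * w * S)
      Z C : List A
      Z = take g X
      C = concat 𝓕
      lenX : length Z ≡ g
      lenX = length-take-≤ g {X} (≰⇒> ¬h)
      ident : ∀ q w T S → q * (w * T * S) + T ≡ suc (q * w * S) * T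
      ident = solve-∀

    -- A Kővári–Sós–Turán bound in which the density 1/q is arbitrary but fixed.
    pairs-≤ : ∀ q d X Y → Unique X → Unique Y → length X ≤ d → length Y ≤ d →
              q * ∑ X (λ x → ∑ Y λ y → 𝟙 (R? x y)) ≤ d * d + q * (pairConst S q * d)
    pairs-≤ q d X Y uX uY lX lY with length Y ≤? richThreshold S q 1
    ... | yes small = begin
      q * ∑ X (λ x → ∑ Y λ y → 𝟙 (R? x y)) ≤⟨ *-monoʳ-≤ q (∑-≤-const X (length Y) (λ x _ → rowY x)) ⟩
      q * (length X * length Y) ≤⟨ *-monoʳ-≤ q (*-mono-≤ lX (≤-trans small (m≤n+m _ (q * 1 * S)))) ⟩
      q * (d * pairConst S q) ≡⟨ cong (q *_) (*-comm d _) ⟩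
      q * (pairConst S q * d) ≤⟨ m≤n+m _ (d * d) ⟩
      d * d + q * (pairConst S q * d) ∎
      where
      open ≤-Reasoning
      rowY : ∀ x → ∑ Y (λ y → 𝟙 (R? x y)) ≤ length Y
      rowY x = ≤-trans (∑-≤-const Y 1 (λ y _ → 𝟙≤1 (R? x y))) (≤-reflexive (*-identityʳ _))
    ... | no large = begin
      q * ∑ X row ≡⟨ sym (∑-*ˡ X q row) ⟩
      ∑ X (λ x → q * row x) ≤⟨ ∑-mono X bound ⟩
      ∑ X (λ x → length Y + 𝟙 (rich? x) * (q * length Y))
                                                     ≡⟨ trans (∑-+ X _ _) (cong₂ _+_ (∑-const X _) (∑-*ʳ X _ _)) ⟩
      length X * length Y + ∑ X (λ x → 𝟙 (rich? x)) * (q * length Y)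
                                                     ≤⟨ +-mono-≤ (*-mono-≤ lX lY) (*-mono-≤ few (*-monoʳ-≤ q lY)) ⟩
      d * d + q * 1 * S * (q * d)
        ≤⟨ +-monoʳ-≤ (d * d) (≤-trans (≤-reflexive (ident q d S)) (*-monoʳ-≤ q (*-monoˡ-≤ d (m≤m+n (q * 1 * S) _)))) ⟩
      d * d + q * (pairConst S q * d) ∎
      where
      open ≤-Reasoning
      row : A → ℕ
      row x = ∑ Y λ y → 𝟙 (R? x y)
      rowY : ∀ x → row x ≤ length Y
      rowY x = ≤-trans (∑-≤-const Y 1 (λ y _ → 𝟙≤1 (R? x y))) (≤-reflexive (*-identityʳ _))
      rich? : Decidable (λ x → length Y ≤ q * row x)
      rich? x = length Y ≤? q * row x
      bound : ∀ x → q * row x ≤ length Y + 𝟙 (rich? x) * (q * length Y)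
      bound x with rich? x
      ... | yes _ = ≤-trans (*-monoʳ-≤ q (rowY x)) (≤-trans (≤-reflexive (sym (*-identityˡ _))) (m≤n+m _ (length Y)))
      ... | no ¬h = ≤-trans (<⇒≤ (≰⇒> ¬h)) (m≤m+n _ _)
      hits-singletons : ∀ x → row x ≤ hits x (map [_] Y)
      hits-singletons x = ≤-trans (∑-mono Y (λ y → 𝟙-mono (R? x y) (any? (R? x) [ y ]) here)) (≤-reflexive (sym (∑-map [_] Y _)))
      few : ∑ X (λ x → 𝟙 (rich? x)) ≤ q * 1 * S
      few = ≤-trans (≤-reflexive (sym (count-filter rich? X)))
        -- Each vertex of `Y` serves as a path with one vertex, so `w` is 1 and `T` is `length Y`.
        (rich-few q 1 (length Y) (map [_] Y) (filter rich? X)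
          (subst Unique (sym (concat-map-[ Y ])) uY)
          (≤-reflexive (trans (cong length (concat-map-[ Y ])) (sym (*-identityˡ _))))
          (≰⇒> large) (Unique.filter⁺ rich? uX)
          (λ {x} x∈ → ≤-trans (proj₂ (∈-filter⁻ rich? {xs = X} x∈)) (*-monoʳ-≤ q (hits-singletons x))))
      ident : ∀ q d S → q * 1 * S * (q * d) ≡ q * ((q * 1 * S) * d)
      ident = solve-∀

-- Induced paths and cycles

module Paths (E R : A → A → Set) (E-sym : ∀ {u v} → E u v → E v u) (R-sym : ∀ {u v} → R u v → R v u) where

  -- `E` will be the edges between the two sides, while `R` contains equality and all edges of the
  -- graph. Excluding `R` between non-consecutive vertices thus rules out repetitions and chords,
  -- including those inside one side.
  IndPath : List A → Set
  IndPath [] = ⊤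
  IndPath (a ∷ []) = ⊤
  IndPath (a ∷ b ∷ l) = E a b × All (λ v → ¬ R a v) l × IndPath (b ∷ l)

  IndPath-tail : ∀ a l → IndPath (a ∷ l) → IndPath l
  IndPath-tail a [] _ = tt
  IndPath-tail a (b ∷ l) (_ , _ , p) = p

  glue : ∀ p a q → IndPath (p ++ a ∷ []) → IndPath (a ∷ q) → (∀ {u v} → u ∈ p → v ∈ q → ¬ R u v) →
         IndPath (p ++ a ∷ q)
  glue [] a q _ iq _ = iq
  glue (x ∷ []) a q (e , _ , _) iq h = e , All.tabulate (h (here refl)) , iq
  glue (x ∷ y ∷ p) a q (e , n , ip) iq h =
    e , All.++⁺ (All.++⁻ˡ p n) (All.head (All.++⁻ʳ p n) ∷ All.tabulate (h (here refl))) ,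
    glue (y ∷ p) a q ip iq (h ∘ there)

  IndPath-reverse : ∀ l → IndPath l → IndPath (reverse l)
  IndPath-reverse [] _ = tt
  IndPath-reverse (a ∷ []) _ = tt
  IndPath-reverse (a ∷ b ∷ l) (e , n , ip) = subst IndPath (sym eq)
    (glue (reverse l) b (a ∷ []) (subst IndPath (unfold-reverse b l) (IndPath-reverse (b ∷ l) ip)) (E-sym e , [] , tt) far)
    where
    eq : reverse (a ∷ b ∷ l) ≡ reverse l ++ b ∷ a ∷ []
    eq = trans (unfold-reverse a (b ∷ l)) (trans (cong (_++ [ a ]) (unfold-reverse b l)) (++-assoc (reverse l) _ _))
    far : ∀ {u v} → u ∈ reverse l → v ∈ a ∷ [] → ¬ R u v
    far u∈ (here refl) r = All.lookup n (reverse⁻ u∈) (R-sym r)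

  Cycle : A → A → List A → A → Set
  Cycle x a mid b = E x a × E x b × All (λ v → ¬ R x v) mid × IndPath (a ∷ mid ++ b ∷ [])

  rotate : ∀ x a c mid b → Cycle x a (c ∷ mid) b → Cycle a c (mid ++ b ∷ []) x
  rotate x a c mid b (xa , xb , n , ac , an , ip) =
    ac , E-sym xa , an , subst IndPath (cong (c ∷_) (sym (++-assoc mid _ _)))
      (glue (c ∷ mid) b (x ∷ []) ip (E-sym xb , [] , tt) λ where u∈ (here refl) r → All.lookup n u∈ (R-sym r))

  -- The middle path is decomposed in two ways because the connecting paths touch it at opposite
  -- ends: `p` is attached to `y` and must avoid what follows, `p'` is attached to `y'` and must
  -- avoid what precedes. The middle path may be a single vertex.
  IndPath-close : ∀ p p' y ys ms y' → y ∷ ys ≡ ms ++ y' ∷ [] →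
    IndPath (p ++ y ∷ []) → IndPath (y ∷ ys) → IndPath (p' ++ y' ∷ []) →
    (∀ {u v} → u ∈ p → v ∈ ys → ¬ R u v) → (∀ {u v} → u ∈ p' → v ∈ ms → ¬ R u v) →
    (∀ {u v} → u ∈ p → v ∈ p' → ¬ R u v) →
    IndPath (p ++ (y ∷ ys) ++ reverse p')
  IndPath-close p p' y ys ms y' eq ip imid ip' pys p'ms pp' =
    glue p y (ys ++ reverse p') ip right λ u∈ v∈ → far u∈ (∈-++⁻ ys v∈)
    where
    far : ∀ {u v} → u ∈ p → v ∈ ys ⊎ v ∈ reverse p' → ¬ R u v
    far u∈ (inj₁ v∈) = pys u∈ v∈
    far u∈ (inj₂ v∈) = pp' u∈ (reverse⁻ v∈)
    revp' : IndPath (y' ∷ reverse p')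
    revp' = subst IndPath (lemma p') (IndPath-reverse _ ip')
      where
      lemma : ∀ l → reverse (l ++ y' ∷ []) ≡ y' ∷ reverse l
      lemma l = reverse-++ l (y' ∷ [])
    right : IndPath (y ∷ ys ++ reverse p')
    right = subst IndPath (trans (sym (++-assoc ms (y' ∷ []) (reverse p'))) (cong (_++ reverse p') (sym eq)))
      (glue ms y' (reverse p') (subst IndPath eq imid) revp' λ u∈ v∈ r → p'ms (reverse⁻ v∈) u∈ (R-sym r))

  module _ (E? : ∀ u v → Dec (E u v)) (R? : ∀ u v → Dec (R u v)) where

    indPath? : ∀ l → Dec (IndPath l)
    indPath? [] = yes tt
    indPath? (a ∷ []) = yes tt
    indPath? (a ∷ b ∷ l) = E? a b ×-dec all? (λ v → ¬? (R? a v)) l ×-dec indPath? (b ∷ l)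

    cycle? : ∀ x a mid b → Dec (Cycle x a mid b)
    cycle? x a mid b = E? x a ×-dec E? x b ×-dec all? (λ v → ¬? (R? x v)) mid ×-dec indPath? (a ∷ mid ++ b ∷ [])

-- Positions on a cycle and the alternation of sides

data At {A : Set} : List A → ℕ → A → Set where
  here : ∀ {x l} → At (x ∷ l) 0 x
  there : ∀ {x l i v} → At l i v → At (x ∷ l) (suc i) v

At-lookup : (l : List A) (i : Fin (length l)) → At l (toℕ i) (lookup l i)
At-lookup (x ∷ l) zero = here
At-lookup (x ∷ l) (suc i) = there (At-lookup l i)

At-∈ : ∀ {l : List A} {i v} → At l i v → v ∈ l
At-∈ here = here refl
At-∈ (there p) = there (At-∈ p)

At-last : ∀ (l : List A) {b i v} → At (l ++ b ∷ []) i v → (i < length l × v ∈ l) ⊎ (i ≡ length l × v ≡ b)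
At-last [] here = inj₂ (refl , refl)
At-last (x ∷ l) here = inj₁ (s≤s z≤n , here refl)
At-last (x ∷ l) (there p) with At-last l p
... | inj₁ (i< , v∈) = inj₁ (s≤s i< , there v∈)
... | inj₂ (i≡ , v≡) = inj₂ (cong suc i≡ , v≡)

even : ℕ → Bool
even zero = true
even (suc n) = not (even n)

even-% : ∀ n → (even n ≡ true → n % 2 ≡ 0) × (n % 2 ≡ 0 → even n ≡ true)
even-% 0 = (λ _ → refl) , (λ _ → refl)
even-% 1 = (λ ()) , (λ ())
even-% (suc (suc n)) with even-% n
... | f , g = (λ e → trans shift (f (trans (sym (Bool.not-involutive _)) e))) ,
              (λ e → trans (Bool.not-involutive _) (g (trans (sym shift) e)))
  where
  shift : suc (suc n) % 2 ≡ n % 2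
  shift = trans (cong (_% 2) (+-comm 2 n)) ([m+n]%n≡m%n n 2)

module _ {n : ℕ} (G : Graph n) (inA : Fin n → Bool) where

  Edge : Fin n → Fin n → Set
  Edge u v = Adj G u v × inA u ≡ not (inA v)

  Conf : Fin n → Fin n → Set
  Conf u v = u ≡ v ⊎ Adj G u v

  edge? : ∀ u v → Dec (Edge u v)
  edge? u v = adj? G u v ×-dec (inA u Bool.≟ not (inA v))

  conf? : ∀ u v → Dec (Conf u v)
  conf? u v = (u Fin.≟ v) ⊎-dec adj? G u v

  Edge-sym : ∀ {u v} → Edge u v → Edge v u
  Edge-sym {u} {v} (a , e) = Graph.sym G a , trans (sym (Bool.not-involutive _)) (cong not (sym e))

  Conf-sym : ∀ {u v} → Conf u v → Conf v u
  Conf-sym (inj₁ e) = inj₁ (sym e)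
  Conf-sym (inj₂ a) = inj₂ (Graph.sym G a)

  open Paths Edge Conf Edge-sym Conf-sym

  IndPath-At : ∀ l {i j u v} → IndPath l → At l i u → At l j v → i < j →
               (j ≡ suc i × Edge u v) ⊎ (suc i < j × ¬ Conf u v)
  IndPath-At (a ∷ b ∷ l) (e , n , ip) here (there here) _ = inj₁ (refl , e)
  IndPath-At (a ∷ b ∷ l) (e , n , ip) here (there (there p)) _ = inj₂ (s≤s (s≤s z≤n) , All.lookup n (At-∈ p))
  IndPath-At (a ∷ l) ip (there p) (there q) (s≤s lt) with IndPath-At l (IndPath-tail a l ip) p q lt
  ... | inj₁ (refl , e) = inj₁ (refl , e)
  ... | inj₂ (h , ¬c) = inj₂ (s≤s h , ¬c)

  IndPath-side : ∀ a l {i u} → IndPath (a ∷ l) → At (a ∷ l) i u → inA a ≡ false → inA u ≡ not (even i)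
  IndPath-side' : ∀ a l {i u} → IndPath (a ∷ l) → At (a ∷ l) i u → inA a ≡ true → inA u ≡ even i
  IndPath-side a l ip here f = f
  IndPath-side a (b ∷ l) (e , _ , ip) (there p) f =
    trans (IndPath-side' b l ip p (trans (proj₂ (Edge-sym e)) (cong not f))) (sym (Bool.not-involutive _))
  IndPath-side' a l ip here f = f
  IndPath-side' a (b ∷ l) (e , _ , ip) (there p) f =
    IndPath-side b l ip p (trans (proj₂ (Edge-sym e)) (cong not f))

  module FromCycle (x a : Fin n) (mid : List (Fin n)) (b : Fin n) (C : Cycle x a mid b) where

    L : List (Fin n)
    L = x ∷ a ∷ mid ++ b ∷ []

    lengthL : length L ≡ 3 + length mid
    lengthL = cong (2 +_) (trans (length-++ mid {b ∷ []}) (+-comm (length mid) 1))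

    CycAdjℕ : ℕ → ℕ → Set
    CycAdjℕ i j = j ≡ suc i ⊎ (i ≡ 0 × j ≡ suc (suc (length mid)))

    pairs : ∀ {i j u v} → At L i u → At L j v → i < j →
            (CycAdjℕ i j × Edge u v) ⊎ (¬ CycAdjℕ i j × ¬ Conf u v)
    pairs here (there here) _ = inj₁ (inj₁ refl , proj₁ C)
    pairs here (there (there p)) _ with At-last mid p
    ... | inj₁ (lt , v∈) = inj₂ ((λ { (inj₁ ()) ; (inj₂ (_ , refl)) → <-irrefl refl lt }) , All.lookup (proj₁ (proj₂ (proj₂ C))) v∈)
    ... | inj₂ (refl , refl) = inj₁ (inj₂ (refl , refl) , proj₁ (proj₂ C))
    pairs (there p) (there q) (s≤s lt) with IndPath-At _ (proj₂ (proj₂ (proj₂ C))) p q lt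
    ... | inj₁ (refl , e) = inj₁ (inj₁ refl , e)
    ... | inj₂ (h , ¬c) = inj₂ ((λ { (inj₁ refl) → <-irrefl refl h ; (inj₂ (() , _)) }) , ¬c)

    side : inA x ≡ true → ∀ {i u} → At L i u → inA u ≡ even i
    side t here = t
    side t (there p) = IndPath-side _ _ (proj₂ (proj₂ (proj₂ C))) p (trans (proj₂ (Edge-sym (proj₁ C))) (cong not t))

    module _ (k : ℕ) (eq : 2 * k ≡ length L) (t : inA x ≡ true) where

      vertex : Fin (2 * k) → Fin n
      vertex i = lookup L (cast eq i)

      at : ∀ i → At L (toℕ i) (vertex i)
      at i = subst (λ m → At L m (vertex i)) (Fin.toℕ-cast eq i) (At-lookup L (cast eq i))

      total : 2 * k ≡ 3 + length mid
      total = trans eq lengthL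

      Good : Fin (2 * k) → Fin (2 * k) → Set
      Good i j = ¬ (vertex i ≡ vertex j) × (Adj G (vertex i) (vertex j) → CycAdj (2 * k) i j) ×
                 (CycAdj (2 * k) i j → Adj G (vertex i) (vertex j))

      good-< : ∀ i j → toℕ i < toℕ j → Good i j
      good-< i j lt with pairs (at i) (at j) lt
      ... | inj₁ (c , e) = (λ v≡ → irrefl G (subst (Adj G (vertex i)) (sym v≡) (proj₁ e))) , (λ _ → adj c) , (λ _ → proj₁ e)
        where
        adj : _ ⊎ _ → CycAdj (2 * k) i j
        adj (inj₁ e) = inj₁ (sym e)
        adj (inj₂ (z , l)) = inj₂ (inj₂ (inj₁ (z , trans (cong suc l) (sym total))))
      ... | inj₂ (¬c , ¬r) = (λ v≡ → ¬r (inj₁ v≡)) , (λ a → ⊥-elim (¬r (inj₂ a))) , (λ c → ⊥-elim (¬c (conv c)))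
        where
        conv : CycAdj (2 * k) i j → _ ⊎ _
        conv (inj₁ e) = inj₁ (sym e)
        conv (inj₂ (inj₁ e)) = ⊥-elim (<-asym lt (≤-reflexive e))
        conv (inj₂ (inj₂ (inj₁ (z , l)))) = inj₂ (z , suc-injective (trans l total))
        conv (inj₂ (inj₂ (inj₂ (z , l)))) = ⊥-elim (n≮0 (subst (toℕ i <_) z lt))

      flip : ∀ {i j} → CycAdj (2 * k) i j → CycAdj (2 * k) j i
      flip (inj₁ e) = inj₂ (inj₁ e)
      flip (inj₂ (inj₁ e)) = inj₁ e
      flip (inj₂ (inj₂ (inj₁ e))) = inj₂ (inj₂ (inj₂ e))
      flip (inj₂ (inj₂ (inj₂ e))) = inj₂ (inj₂ (inj₁ e))

      flip-good : ∀ {i j} → Good i j → Good j i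
      flip-good (d , f , g) = d ∘ sym , flip ∘ f ∘ Graph.sym G , Graph.sym G ∘ g ∘ flip

      no-loop : ∀ i → ¬ CycAdj (2 * k) i i
      no-loop i (inj₁ e) = 1+n≢n e
      no-loop i (inj₂ (inj₁ e)) = 1+n≢n e
      no-loop i (inj₂ (inj₂ (inj₁ (z , l)))) = one (trans (sym l) (trans (cong suc z) refl)) total
        where
        one : ∀ {m r} → m ≡ 1 → m ≡ 3 + r → ⊥
        one refl ()
      no-loop i (inj₂ (inj₂ (inj₂ (z , l)))) = no-loop i (inj₂ (inj₂ (inj₁ (z , l))))

      injective : Injective _≡_ _≡_ vertex
      injective {i} {j} v≡ with <-cmp (toℕ i) (toℕ j)
      ... | tri< lt _ _ = ⊥-elim (proj₁ (good-< i j lt) v≡)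
      ... | tri≈ _ e _ = Fin.toℕ-injective e
      ... | tri> _ _ gt = ⊥-elim (proj₁ (good-< j i gt) (sym v≡))

      adjacency : ∀ i j → (Adj G (vertex i) (vertex j) → CycAdj (2 * k) i j) × (CycAdj (2 * k) i j → Adj G (vertex i) (vertex j))
      adjacency i j with <-cmp (toℕ i) (toℕ j)
      ... | tri< lt _ _ = proj₂ (good-< i j lt)
      ... | tri> _ _ gt = proj₂ (flip-good {j} {i} (good-< j i gt))
      ... | tri≈ _ e _ with Fin.toℕ-injective e
      ... | refl = (λ a → ⊥-elim (irrefl G a)) , (λ c → ⊥-elim (no-loop i c))

      sides : ∀ i → (Even (toℕ i) → inA (vertex i) ≡ true) × (¬ Even (toℕ i) → inA (vertex i) ≡ false)
      sides i = (λ ev → trans s (proj₂ (even-% (toℕ i)) ev)) ,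
                (λ ¬ev → trans s (Bool.¬-not (λ e → ¬ev (proj₁ (even-% (toℕ i)) e))))
        where
        s : inA (vertex i) ≡ even (toℕ i)
        s = side t (at i)

      hasCycle : HasInducedBipartiteC2k G inA k
      hasCycle = vertex , injective , adjacency , sides

  -- The numbering has to start in A. If `x` lies in B, rotating by one position puts its neighbour
  -- `a`, which lies in A, first.
  cycle⇒induced : ∀ k x a c mid b → 2 * k ≡ 4 + length mid → Cycle x a (c ∷ mid) b → HasInducedBipartiteC2k G inA k
  cycle⇒induced k x a c mid b len C = bySide (inA x) refl
    where
    C' : Cycle a c (mid ++ b ∷ []) x
    C' = rotate x a c mid b C
    len' : length (mid ++ b ∷ []) ≡ suc (length mid)
    len' = trans (length-++ mid) (+-comm (length mid) 1)
    bySide : ∀ s → inA x ≡ s → HasInducedBipartiteC2k G inA k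
    bySide true eq = FromCycle.hasCycle x a (c ∷ mid) b C k (trans len (sym (FromCycle.lengthL x a (c ∷ mid) b C))) eq
    bySide false eq = FromCycle.hasCycle a c (mid ++ b ∷ []) x C' k
      (trans len (sym (trans (FromCycle.lengthL a c (mid ++ b ∷ []) x C') (cong (3 +_) len'))))
      (trans (proj₂ (Edge-sym (proj₁ C))) (cong not eq))

-- Counting walks

last : A → List A → A
last a [] = a
last a (b ∷ l) = last b l

last-++ : ∀ (a : A) p v → last a (p ++ v ∷ []) ≡ v
last-++ a [] v = refl
last-++ a (b ∷ p) v = last-++ b p v

𝟙-×-dec : ∀ {P Q : Set} (p? : Dec P) (q? : Dec Q) → 𝟙 (p? ×-dec q?) ≡ 𝟙 p? * 𝟙 q?
𝟙-×-dec (yes _) (yes _) = refl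
𝟙-×-dec (yes _) (no _) = refl
𝟙-×-dec (no _) _ = refl

-- Forbidden segments of walks

data Prefix (B : List A → Set) : List A → Set where
  stop : ∀ {l} → B [] → Prefix B l
  step : ∀ {x l} → Prefix (λ q → B (x ∷ q)) l → Prefix B (x ∷ l)

prefix? : ∀ {B : List A → Set} → (∀ l → Dec (B l)) → ∀ l → Dec (Prefix B l)
prefix? B? [] with B? []
... | yes b = yes (stop b)
... | no ¬b = no λ { (stop b) → ¬b b }
prefix? B? (x ∷ l) with B? [] | prefix? (B? ∘ (x ∷_)) l
... | yes b | _ = yes (stop b)
... | no ¬b | yes p = yes (step p)
... | no ¬b | no ¬p = no λ { (stop b) → ¬b b ; (step p) → ¬p p }

Prefix-snoc : ∀ {B : List A → Set} l v → Prefix B (l ++ v ∷ []) → Prefix B l ⊎ B (l ++ v ∷ [])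
Prefix-snoc [] v (stop b) = inj₁ (stop b)
Prefix-snoc [] v (step (stop b)) = inj₂ b
Prefix-snoc (x ∷ l) v (stop b) = inj₁ (stop b)
Prefix-snoc (x ∷ l) v (step p) = Sum.map₁ step (Prefix-snoc l v p)

Prefix-++ : ∀ {B : List A → Set} q r → B q → Prefix B (q ++ r)
Prefix-++ [] r b = stop b
Prefix-++ (x ∷ q) r b = step (Prefix-++ q r b)

data Infix (B : List A → Set) : List A → Set where
  now : ∀ {l} → Prefix B l → Infix B l
  later : ∀ {x l} → Infix B l → Infix B (x ∷ l)

infix? : ∀ {B : List A → Set} → (∀ l → Dec (B l)) → ∀ l → Dec (Infix B l)
infix? B? [] with prefix? B? []
... | yes p = yes (now p)
... | no ¬p = no λ { (now p) → ¬p p }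
infix? B? (x ∷ l) with prefix? B? (x ∷ l) | infix? B? l
... | yes p | _ = yes (now p)
... | no ¬p | yes i = yes (later i)
... | no ¬p | no ¬i = no λ { (now p) → ¬p p ; (later i) → ¬i i }

Infix-++ : ∀ {B : List A → Set} p q r → B q → Infix B (p ++ q ++ r)
Infix-++ [] q r b = now (Prefix-++ q r b)
Infix-++ (x ∷ p) q r b = later (Infix-++ p q r b)

module Walks {N : ℕ} (E : Fin N → Fin N → Set) (E? : ∀ u v → Dec (E u v)) (E-sym : ∀ {u v} → E u v → E v u)
             (d : ℕ) (deg≤ : ∀ v → ∑ᶠ (λ w → 𝟙 (E? v w)) ≤ d) where

  U : List (Fin N)
  U = allFin N

  lengthU : length U ≡ N
  lengthU = length-tabulate (λ z → z)

  Walk : List (Fin N) → Set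
  Walk [] = ⊤
  Walk (_ ∷ []) = ⊤
  Walk (a ∷ b ∷ l) = E a b × Walk (b ∷ l)

  walk? : ∀ l → Dec (Walk l)
  walk? [] = yes tt
  walk? (_ ∷ []) = yes tt
  walk? (a ∷ b ∷ l) = E? a b ×-dec walk? (b ∷ l)

  Walk-tail : ∀ x l → Walk (x ∷ l) → Walk l
  Walk-tail x [] _ = tt
  Walk-tail x (y ∷ l) (_ , w) = w

  degˡ≤ : ∀ v → ∑ᶠ (λ w → 𝟙 (E? w v)) ≤ d
  degˡ≤ v = ≤-trans (∑-mono U λ w → 𝟙-mono (E? w v) (E? v w) E-sym) (deg≤ v)

  extend-right : ∀ a q → ∑ᶠ (λ v → 𝟙 (walk? (a ∷ q ++ v ∷ []))) ≤ 𝟙 (walk? (a ∷ q)) * d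
  extend-right a [] = ≤-trans (∑-mono U λ v → 𝟙-mono (walk? (a ∷ v ∷ [])) (E? a v) proj₁)
    (≤-trans (deg≤ a) (≤-reflexive (sym (*-identityˡ d))))
  extend-right a (b ∷ q) = begin
    ∑ᶠ (λ v → 𝟙 (walk? (a ∷ b ∷ q ++ v ∷ []))) ≡⟨ ∑-cong U (λ v → 𝟙-×-dec (E? a b) _) ⟩
    ∑ᶠ (λ v → 𝟙 (E? a b) * 𝟙 (walk? (b ∷ q ++ v ∷ []))) ≡⟨ ∑-*ˡ U (𝟙 (E? a b)) (λ v → 𝟙 (walk? (b ∷ q ++ v ∷ []))) ⟩
    𝟙 (E? a b) * ∑ᶠ (λ v → 𝟙 (walk? (b ∷ q ++ v ∷ []))) ≤⟨ *-monoʳ-≤ (𝟙 (E? a b)) (extend-right b q) ⟩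
    𝟙 (E? a b) * (𝟙 (walk? (b ∷ q)) * d) ≡⟨ sym (*-assoc (𝟙 (E? a b)) _ d) ⟩
    𝟙 (E? a b) * 𝟙 (walk? (b ∷ q)) * d ≡⟨ cong (_* d) (sym (𝟙-×-dec (E? a b) _)) ⟩
    𝟙 (walk? (a ∷ b ∷ q)) * d ∎
    where open ≤-Reasoning

  extend-left : ∀ b q → ∑ᶠ (λ v → 𝟙 (walk? (v ∷ b ∷ q))) ≤ d * 𝟙 (walk? (b ∷ q))
  extend-left b q = begin
    ∑ᶠ (λ v → 𝟙 (walk? (v ∷ b ∷ q))) ≡⟨ ∑-cong U (λ v → 𝟙-×-dec (E? v b) _) ⟩
    ∑ᶠ (λ v → 𝟙 (E? v b) * 𝟙 (walk? (b ∷ q))) ≡⟨ ∑-*ʳ U (𝟙 (walk? (b ∷ q))) (λ v → 𝟙 (E? v b)) ⟩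
    ∑ᶠ (λ v → 𝟙 (E? v b)) * 𝟙 (walk? (b ∷ q)) ≤⟨ *-monoˡ-≤ (𝟙 (walk? (b ∷ q))) (degˡ≤ b) ⟩
    d * 𝟙 (walk? (b ∷ q)) ∎
    where open ≤-Reasoning

  walks-from : ∀ r v → ∑ᴸ U r (λ s → 𝟙 (walk? (v ∷ s))) ≤ d ^ r
  walks-from zero v = ≤-refl
  walks-from (suc r) v = begin
    ∑ᴸ U (suc r) (λ s → 𝟙 (walk? (v ∷ s))) ≡⟨ ∑ᴸ-snoc U r (λ s → 𝟙 (walk? (v ∷ s))) ⟩
    ∑ᴸ U r (λ s → ∑ᶠ λ w → 𝟙 (walk? (v ∷ s ++ w ∷ []))) ≤⟨ ∑ᴸ-mono U r (λ s _ → extend-right v s) ⟩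
    ∑ᴸ U r (λ s → 𝟙 (walk? (v ∷ s)) * d) ≡⟨ ∑ᴸ-*ʳ U r d (λ s → 𝟙 (walk? (v ∷ s))) ⟩
    ∑ᴸ U r (λ s → 𝟙 (walk? (v ∷ s))) * d ≤⟨ *-monoˡ-≤ d (walks-from r v) ⟩
    d ^ r * d ≡⟨ *-comm (d ^ r) d ⟩
    d ^ suc r ∎
    where open ≤-Reasoning

  walks-total : ∀ r → ∑ᴸ U (suc r) (λ s → 𝟙 (walk? s)) ≤ N * d ^ r
  walks-total r = ≤-trans (∑-≤-const U (d ^ r) (λ v _ → walks-from r v)) (≤-reflexive (cong (_* d ^ r) lengthU))

  module Avoid (B : List (Fin N) → Set) (B? : ∀ l → Dec (B l)) (¬B[] : ¬ B []) (c X : ℕ) where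

    #B #prefix #infix : ℕ → ℕ
    #B m = ∑ᴸ U m λ q → 𝟙 (walk? q ×-dec B? q)
    #prefix m = ∑ᴸ U m λ q → 𝟙 (walk? q ×-dec prefix? B? q)
    #infix m = ∑ᴸ U m λ q → 𝟙 (walk? q ×-dec infix? B? q)

    prefix-step : ∀ m → #prefix (suc m) ≤ #prefix m * d + #B (suc m)
    prefix-step m = begin
      #prefix (suc m) ≡⟨ ∑ᴸ-snoc U m (λ l → 𝟙 (walk? l ×-dec prefix? B? l)) ⟩
      ∑ᴸ U m (λ l → ∑ᶠ λ v → 𝟙 (walk? (l ++ v ∷ []) ×-dec prefix? B? (l ++ v ∷ [])))
                                                          ≤⟨ ∑ᴸ-mono U m (λ l _ → perList l) ⟩
      ∑ᴸ U m (λ l → 𝟙 (walk? l ×-dec prefix? B? l) * d + ∑ᶠ λ v → 𝟙 (walk? (l ++ v ∷ []) ×-dec B? (l ++ v ∷ [])))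
                                                          ≡⟨ ∑ᴸ-+ U m _ _ ⟩
      ∑ᴸ U m (λ l → 𝟙 (walk? l ×-dec prefix? B? l) * d) + _
                                                          ≡⟨ cong₂ _+_ (∑ᴸ-*ʳ U m d (λ l → 𝟙 (walk? l ×-dec prefix? B? l))) (sym (∑ᴸ-snoc U m (λ l → 𝟙 (walk? l ×-dec B? l)))) ⟩
      #prefix m * d + #B (suc m) ∎
      where
      open ≤-Reasoning
      old : ∀ l → ∑ᶠ (λ v → 𝟙 (walk? (l ++ v ∷ [])) * 𝟙 (prefix? B? l)) ≤ 𝟙 (walk? l ×-dec prefix? B? l) * d
      old [] with prefix? B? []
      ... | yes (stop b) = ⊥-elim (¬B[] b)
      ... | no _ = ≤-reflexive (trans (∑-cong U (λ v → *-zeroʳ (𝟙 (walk? (v ∷ []))))) (∑-zero U))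
      old (a ∷ l) = ≤-trans (≤-reflexive (∑-*ʳ U (𝟙 (prefix? B? (a ∷ l))) (λ v → 𝟙 (walk? (a ∷ l ++ v ∷ []))))) (≤-trans (*-monoˡ-≤ (𝟙 (prefix? B? (a ∷ l))) (extend-right a l))
        (≤-reflexive (trans (ring (𝟙 (walk? (a ∷ l))) d (𝟙 (prefix? B? (a ∷ l)))) (cong (_* d) (sym (𝟙-×-dec (walk? (a ∷ l)) (prefix? B? (a ∷ l))))))))
        where
        ring : ∀ w d p → w * d * p ≡ w * p * d
        ring = solve-∀
      perList : ∀ l → ∑ᶠ (λ v → 𝟙 (walk? (l ++ v ∷ []) ×-dec prefix? B? (l ++ v ∷ []))) ≤
                𝟙 (walk? l ×-dec prefix? B? l) * d + ∑ᶠ λ v → 𝟙 (walk? (l ++ v ∷ []) ×-dec B? (l ++ v ∷ []))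
      perList l = ≤-trans (∑-mono U λ v → ≤-trans
          (𝟙-⊎ _ (walk? (l ++ v ∷ []) ×-dec prefix? B? l) (walk? (l ++ v ∷ []) ×-dec B? (l ++ v ∷ []))
            λ { (w , p) → Sum.map (w ,_) (w ,_) (Prefix-snoc l v p) })
          (+-monoˡ-≤ _ (≤-reflexive (𝟙-×-dec (walk? (l ++ v ∷ [])) (prefix? B? l)))))
        (≤-trans (≤-reflexive (∑-+ U _ _)) (+-monoˡ-≤ _ (old l)))

    infix-step : ∀ m → #infix (suc m) ≤ d * #infix m + #prefix (suc m)
    infix-step m = begin
      #infix (suc m) ≡⟨ sym (∑ᴸ-∑ U m U (λ l v → 𝟙 (walk? (v ∷ l) ×-dec infix? B? (v ∷ l)))) ⟩
      ∑ᴸ U m (λ l → ∑ᶠ λ v → 𝟙 (walk? (v ∷ l) ×-dec infix? B? (v ∷ l)))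
                                                           ≤⟨ ∑ᴸ-mono U m (λ l _ → perList l) ⟩
      ∑ᴸ U m (λ l → d * 𝟙 (walk? l ×-dec infix? B? l) + ∑ᶠ λ v → 𝟙 (walk? (v ∷ l) ×-dec prefix? B? (v ∷ l)))
                                                           ≡⟨ ∑ᴸ-+ U m _ _ ⟩
      ∑ᴸ U m (λ l → d * 𝟙 (walk? l ×-dec infix? B? l)) + _
        ≡⟨ cong₂ _+_ (∑ᴸ-*ˡ U m d (λ l → 𝟙 (walk? l ×-dec infix? B? l))) (∑ᴸ-∑ U m U (λ l v → 𝟙 (walk? (v ∷ l) ×-dec prefix? B? (v ∷ l)))) ⟩
      d * #infix m + #prefix (suc m) ∎
      where
      open ≤-Reasoning
      old : ∀ l → ∑ᶠ (λ v → 𝟙 (walk? (v ∷ l)) * 𝟙 (infix? B? l)) ≤ d * 𝟙 (walk? l ×-dec infix? B? l)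
      old [] with infix? B? []
      ... | yes (now (stop b)) = ⊥-elim (¬B[] b)
      ... | no _ = ≤-trans (≤-reflexive (∑-zero U)) z≤n
      old (a ∷ l) = ≤-trans (≤-reflexive (∑-*ʳ U (𝟙 (infix? B? (a ∷ l))) (λ v → 𝟙 (walk? (v ∷ a ∷ l))))) (≤-trans (*-monoˡ-≤ (𝟙 (infix? B? (a ∷ l))) (extend-left a l))
        (≤-reflexive (trans (*-assoc d (𝟙 (walk? (a ∷ l))) (𝟙 (infix? B? (a ∷ l)))) (cong (d *_) (sym (𝟙-×-dec (walk? (a ∷ l)) (infix? B? (a ∷ l))))))))
      unwrap : ∀ {v l} → Infix B (v ∷ l) → Infix B l ⊎ Prefix B (v ∷ l)
      unwrap (now p) = inj₂ p
      unwrap (later i) = inj₁ i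
      perList : ∀ l → ∑ᶠ (λ v → 𝟙 (walk? (v ∷ l) ×-dec infix? B? (v ∷ l))) ≤
                d * 𝟙 (walk? l ×-dec infix? B? l) + ∑ᶠ λ v → 𝟙 (walk? (v ∷ l) ×-dec prefix? B? (v ∷ l))
      perList l = ≤-trans (∑-mono U λ v → ≤-trans
          (𝟙-⊎ _ (walk? (v ∷ l) ×-dec infix? B? l) (walk? (v ∷ l) ×-dec prefix? B? (v ∷ l))
            λ { (w , p) → Sum.map (w ,_) (w ,_) (unwrap p) })
          (+-monoˡ-≤ _ (≤-reflexive (𝟙-×-dec (walk? (v ∷ l)) (infix? B? l)))))
        (≤-trans (≤-reflexive (∑-+ U _ _)) (+-monoˡ-≤ _ (old l)))

    module _ (k : ℕ) (few : ∀ m → m ≤ k → c * #B m ≤ X * d ^ m) where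

      -- The factor `m` comes from the possible lengths of the forbidden initial segment; every
      -- vertex after it can be chosen in at most `d` ways.
      prefix-few : ∀ m → m ≤ k → c * #prefix m ≤ m * (X * d ^ m)
      prefix-few zero _ with prefix? B? []
      ... | yes (stop b) = ⊥-elim (¬B[] b)
      ... | no _ = ≤-reflexive (*-zeroʳ c)
      prefix-few (suc m) h = begin
        c * #prefix (suc m) ≤⟨ *-monoʳ-≤ c (prefix-step m) ⟩
        c * (#prefix m * d + #B (suc m)) ≡⟨ ring₁ c (#prefix m) d (#B (suc m)) ⟩
        c * #prefix m * d + c * #B (suc m) ≤⟨ +-mono-≤ (*-monoˡ-≤ d (prefix-few m (≤-trans (n≤1+n m) h))) (few (suc m) h) ⟩
        m * (X * d ^ m) * d + X * d ^ suc m ≡⟨ ring₂ m X (d ^ m) d ⟩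
        suc m * (X * d ^ suc m) ∎
        where
        open ≤-Reasoning
        ring₁ : ∀ c p d b → c * (p * d + b) ≡ c * p * d + c * b
        ring₁ = solve-∀
        ring₂ : ∀ m X e d → m * (X * e) * d + X * (d * e) ≡ X * (d * e) + m * (X * (d * e))
        ring₂ = solve-∀

      -- The second factor `m` comes from the place where the forbidden segment starts; the vertices
      -- before it are added one at a time, again in at most `d` ways each.
      infix-few : ∀ m → m ≤ k → c * #infix m ≤ m * m * (X * d ^ m)
      infix-few zero _ with infix? B? []
      ... | yes (now (stop b)) = ⊥-elim (¬B[] b)
      ... | no _ = ≤-reflexive (*-zeroʳ c)
      infix-few (suc m) h = begin
        c * #infix (suc m) ≤⟨ *-monoʳ-≤ c (infix-step m) ⟩
        c * (d * #infix m + #prefix (suc m)) ≡⟨ ring₁ c d (#infix m) (#prefix (suc m)) ⟩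
        d * (c * #infix m) + c * #prefix (suc m)
          ≤⟨ +-mono-≤ (*-monoʳ-≤ d (infix-few m (≤-trans (n≤1+n m) h))) (prefix-few (suc m) h) ⟩
        d * (m * m * (X * d ^ m)) + suc m * (X * d ^ suc m) ≤⟨ m≤m+n _ (m * (X * d ^ suc m)) ⟩
        d * (m * m * (X * d ^ m)) + suc m * (X * d ^ suc m) + m * (X * d ^ suc m)
                                                                 ≡⟨ ring₂ m X (d ^ m) d ⟩
        suc m * suc m * (X * d ^ suc m) ∎
        where
        open ≤-Reasoning
        ring₁ : ∀ c d p b → c * (d * p + b) ≡ d * (c * p) + c * b
        ring₁ = solve-∀
        ring₂ : ∀ m X e d → d * (m * m * (X * e)) + (X * (d * e) + m * (X * (d * e))) + m * (X * (d * e)) ≡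
                (1 + m) * (1 + m) * (X * (d * e))
        ring₂ = solve-∀

  Chord : (Fin N → Fin N → Set) → List (Fin N) → Set
  Chord R (a ∷ b ∷ c ∷ l) = R a (last c l)
  Chord R _ = ⊥

  module _ (R : Fin N → Fin N → Set) (R? : ∀ u v → Dec (R u v)) where

    chord? : ∀ l → Dec (Chord R l)
    chord? [] = no λ ()
    chord? (_ ∷ []) = no λ ()
    chord? (_ ∷ _ ∷ []) = no λ ()
    chord? (a ∷ b ∷ c ∷ l) = R? a (last c l)

    Chord-snoc : ∀ a b p v → Chord R (a ∷ b ∷ p ++ v ∷ []) → R a v
    Chord-snoc a b [] v r = r
    Chord-snoc a b (c ∷ p) v r = subst (R a) (last-++ c p v) r

    Chord-snoc⁺ : ∀ a b p v → R a v → Chord R (a ∷ b ∷ p ++ v ∷ [])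
    Chord-snoc⁺ a b [] v r = r
    Chord-snoc⁺ a b (c ∷ p) v r = subst (R a) (sym (last-++ c p v)) r

    module _ (c κ : ℕ)
             (κ-bound : ∀ v v' → c * ∑ᶠ (λ u → ∑ᶠ λ w → 𝟙 (E? v u) * (𝟙 (E? v' w) * 𝟙 (R? u w))) ≤ κ) where

      -- Fix the walk without its two ends, in at most N d^p ways. The ends then form a conflicting
      -- pair between two neighbourhoods, and `κ-bound` limits those.
      chords-few : ∀ p → c * ∑ᴸ U (3 + p) (λ q → 𝟙 (walk? q ×-dec chord? q)) ≤ N * d ^ p * κ
      chords-few p = begin
        c * ∑ᴸ U (3 + p) (λ q → 𝟙 (walk? q ×-dec chord? q))
          ≡⟨ cong (c *_) (∑-cong U (λ u → ∑ᴸ-snoc U (suc p) (λ l → 𝟙 (walk? (u ∷ l) ×-dec chord? (u ∷ l))))) ⟩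
        c * ∑ᶠ (λ u → ∑ᴸ U (suc p) λ mid → ∑ᶠ λ w → 𝟙 (walk? (u ∷ mid ++ w ∷ []) ×-dec chord? (u ∷ mid ++ w ∷ [])))
          ≡⟨ cong (c *_) (sym (∑ᴸ-∑ U (suc p) U (λ mid u → ∑ᶠ λ w → 𝟙 (walk? (u ∷ mid ++ w ∷ []) ×-dec chord? (u ∷ mid ++ w ∷ []))))) ⟩
        c * ∑ᴸ U (suc p) around
          ≡⟨ sym (∑ᴸ-*ˡ U (suc p) c around) ⟩
        ∑ᴸ U (suc p) (λ mid → c * around mid)
          ≤⟨ ∑ᴸ-mono U (suc p) perMid ⟩
        ∑ᴸ U (suc p) (λ mid → 𝟙 (walk? mid) * κ)
          ≡⟨ ∑ᴸ-*ʳ U (suc p) κ (λ mid → 𝟙 (walk? mid)) ⟩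
        ∑ᴸ U (suc p) (λ mid → 𝟙 (walk? mid)) * κ
          ≤⟨ *-monoˡ-≤ κ (walks-total p) ⟩
        N * d ^ p * κ ∎
        where
        open ≤-Reasoning
        around : List (Fin N) → ℕ
        around mid = ∑ᶠ λ u → ∑ᶠ λ w → 𝟙 (walk? (u ∷ mid ++ w ∷ []) ×-dec chord? (u ∷ mid ++ w ∷ []))
        ends : ∀ u a p w → Walk (u ∷ a ∷ p ++ w ∷ []) → E a u × E (last a p) w × Walk (a ∷ p)
        ends u a [] w (e , f , _) = E-sym e , f , tt
        ends u a (b ∷ p) w (e , f , wk) with ends a b p w (f , wk)
        ... | _ , g , wk' = E-sym e , g , f , wk'
        perMid : ∀ mid → length mid ≡ suc p → c * around mid ≤ 𝟙 (walk? mid) * κ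
        perMid (a ∷ l) _ = begin
          c * around (a ∷ l)
            ≤⟨ *-monoʳ-≤ c (∑-mono U (λ u → ∑-mono U λ w → term u w)) ⟩
          c * ∑ᶠ (λ u → ∑ᶠ λ w → 𝟙 (walk? (a ∷ l)) * (𝟙 (E? a u) * (𝟙 (E? (last a l) w) * 𝟙 (R? u w))))
            ≡⟨ cong (c *_) (∑-cong U (λ u → ∑-*ˡ U (𝟙 (walk? (a ∷ l))) (λ w → 𝟙 (E? a u) * (𝟙 (E? (last a l) w) * 𝟙 (R? u w))))) ⟩
          c * ∑ᶠ (λ u → 𝟙 (walk? (a ∷ l)) * ∑ᶠ λ w → 𝟙 (E? a u) * (𝟙 (E? (last a l) w) * 𝟙 (R? u w)))
            ≡⟨ cong (c *_) (∑-*ˡ U (𝟙 (walk? (a ∷ l))) (λ u → ∑ᶠ λ w → 𝟙 (E? a u) * (𝟙 (E? (last a l) w) * 𝟙 (R? u w)))) ⟩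
          c * (𝟙 (walk? (a ∷ l)) * ∑ᶠ (λ u → ∑ᶠ λ w → 𝟙 (E? a u) * (𝟙 (E? (last a l) w) * 𝟙 (R? u w))))
            ≡⟨ ring c (𝟙 (walk? (a ∷ l))) _ ⟩
          𝟙 (walk? (a ∷ l)) * (c * ∑ᶠ (λ u → ∑ᶠ λ w → 𝟙 (E? a u) * (𝟙 (E? (last a l) w) * 𝟙 (R? u w))))
            ≤⟨ *-monoʳ-≤ (𝟙 (walk? (a ∷ l))) (κ-bound a (last a l)) ⟩
          𝟙 (walk? (a ∷ l)) * κ ∎
          where
          ring : ∀ c w s → c * (w * s) ≡ w * (c * s)
          ring = solve-∀
          term : ∀ u w → 𝟙 (walk? (u ∷ a ∷ l ++ w ∷ []) ×-dec chord? (u ∷ a ∷ l ++ w ∷ [])) ≤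
                 𝟙 (walk? (a ∷ l)) * (𝟙 (E? a u) * (𝟙 (E? (last a l) w) * 𝟙 (R? u w)))
          term u w = 𝟙-≤ (walk? (u ∷ a ∷ l ++ w ∷ []) ×-dec chord? (u ∷ a ∷ l ++ w ∷ [])) λ { (wk , ch) →
            let ea , el , wk' = ends u a l w wk in
            *-mono-≤ (𝟙≡1 (walk? (a ∷ l)) wk') (*-mono-≤ (𝟙≡1 (E? a u) ea)
              (*-mono-≤ (𝟙≡1 (E? (last a l) w) el) (𝟙≡1 (R? u w) (Chord-snoc u a l w ch)))) }

  module Many (Allowed : Fin N → Fin N → Fin N → Set) (allowed? : ∀ u v w → Dec (Allowed u v w)) (m θ : ℕ)
              (noLargeForbidden : ∀ v S → length S ≡ m → Unique S → (∀ {u} → u ∈ S → E v u) →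
                                  ¬ AllPairs (λ u w → ¬ Allowed u v w) S) where

    AWalk : List (Fin N) → Set
    AWalk [] = ⊤
    AWalk (_ ∷ []) = ⊤
    AWalk (a ∷ b ∷ []) = E a b
    AWalk (a ∷ b ∷ c ∷ l) = E a b × Allowed a b c × AWalk (b ∷ c ∷ l)

    aWalk? : ∀ l → Dec (AWalk l)
    aWalk? [] = yes tt
    aWalk? (_ ∷ []) = yes tt
    aWalk? (a ∷ b ∷ []) = E? a b
    aWalk? (a ∷ b ∷ c ∷ l) = E? a b ×-dec allowed? a b c ×-dec aWalk? (b ∷ c ∷ l)

    AWalk⇒Walk : ∀ l → AWalk l → Walk l
    AWalk⇒Walk [] _ = tt
    AWalk⇒Walk (_ ∷ []) _ = tt
    AWalk⇒Walk (a ∷ b ∷ []) e = e , tt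
    AWalk⇒Walk (a ∷ b ∷ c ∷ l) (e , _ , w) = e , AWalk⇒Walk (b ∷ c ∷ l) w

    AWalk-tail : ∀ x l → AWalk (x ∷ l) → AWalk l
    AWalk-tail x [] _ = tt
    AWalk-tail x (a ∷ []) _ = tt
    AWalk-tail x (a ∷ b ∷ l) (_ , _ , w) = w

    AWalk-allowed : ∀ p a b c q → AWalk (p ++ a ∷ b ∷ c ∷ q) → Allowed a b c
    AWalk-allowed [] a b c q (_ , al , _) = al
    AWalk-allowed (x ∷ p) a b c q w = AWalk-allowed p a b c q (AWalk-tail x (p ++ a ∷ b ∷ c ∷ q) w)

    ext : ℕ → Fin N → Fin N → ℕ
    ext j u v = ∑ᴸ U j λ s → 𝟙 (aWalk? (u ∷ v ∷ s))

    Dense : ℕ → Fin N → Fin N → Set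
    Dense j u v = E u v × θ ^ j ≤ ext j u v

    dense? : ∀ j u v → Dec (Dense j u v)
    dense? j u v = E? u v ×-dec (θ ^ j ≤? ext j u v)

    -- Take the first vertex and discard the fewer than `θ` vertices allowed after it; all that
    -- remain are forbidden with it. Each of the `k` rounds uses up at most `θ` vertices, the chosen
    -- one included.
    greedy : 1 ≤ θ → ∀ v k B → Unique B → (∀ {u} → u ∈ B → ∑ B (λ w → 𝟙 (allowed? u v w)) < θ) → k * θ ≤ length B →
             ∃ λ S → length S ≡ k × Unique S × (∀ {u} → u ∈ S → u ∈ B) × AllPairs (λ u w → ¬ Allowed u v w) S
    greedy 1≤θ v zero B uB few _ = [] , refl , [] , (λ ()) , []
    greedy 1≤θ v (suc k) [] uB few h = ⊥-elim (<⇒≱ (≤-trans 1≤θ (m≤m+n θ (k * θ))) h)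
    greedy 1≤θ v (suc k) (x ∷ B) (x∉ ∷ uB) few h = x ∷ S , cong suc lenS ,
      All.tabulate (λ u∈ → All.lookup x∉ (proj₁ (∈-filter⁻ no? {xs = B} (S⊆ u∈)))) ∷ uS ,
      (λ { (here e) → here e ; (there u∈) → there (proj₁ (∈-filter⁻ no? (S⊆ u∈))) }) ,
      All.tabulate (λ u∈ → proj₂ (∈-filter⁻ no? {xs = B} (S⊆ u∈))) ∷ indep
      where
      no? : Decidable (λ w → ¬ Allowed x v w)
      no? w = ¬? (allowed? x v w)
      B' : List (Fin N)
      B' = filter no? B
      fewer : ∀ u → ∑ B' (λ w → 𝟙 (allowed? u v w)) ≤ ∑ (x ∷ B) (λ w → 𝟙 (allowed? u v w))
      fewer u = ≤-trans (∑-filter-≤ no? B _) (m≤n+m _ _)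
      long : k * θ ≤ length B'
      long = +-cancelˡ-≤ θ _ _ (begin
        θ + k * θ ≤⟨ h ⟩
        suc (length B) ≡⟨ cong suc (sym (filter-split (allowed? x v) B)) ⟩
        suc (length (filter (allowed? x v) B) + length B') ≡⟨ cong (λ z → suc (z + length B')) (count-filter (allowed? x v) B) ⟩
        suc (∑ B (λ w → 𝟙 (allowed? x v w))) + length B' ≤⟨ +-monoˡ-≤ (length B') (≤-<-trans (m≤n+m _ _) (few (here refl))) ⟩
        θ + length B' ∎)
        where open ≤-Reasoning
      rec : ∃ λ S → length S ≡ k × Unique S × (∀ {u} → u ∈ S → u ∈ B') × AllPairs (λ u w → ¬ Allowed u v w) S
      rec = greedy 1≤θ v k B' (Unique.filter⁺ no? uB)
              (λ {u} u∈ → ≤-<-trans (fewer u) (few (there (proj₁ (∈-filter⁻ no? u∈))))) long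
      S : List (Fin N)
      S = proj₁ rec
      lenS : length S ≡ k
      lenS = proj₁ (proj₂ rec)
      uS : Unique S
      uS = proj₁ (proj₂ (proj₂ rec))
      S⊆ : ∀ {u} → u ∈ S → u ∈ B'
      S⊆ = proj₁ (proj₂ (proj₂ (proj₂ rec)))
      indep : AllPairs (λ u w → ¬ Allowed u v w) S
      indep = proj₂ (proj₂ (proj₂ (proj₂ rec)))

    #dense : ℕ → ℕ
    #dense j = ∑ᶠ λ u → ∑ᶠ λ v → 𝟙 (dense? j u v)

    module _ (1≤θ : 1 ≤ θ) where

      -- Reversing an edge that is dense at level j gives one dense at level j+1, with few exceptions at each vertex:
      -- the exceptions at v span few allowed pairs, so many of them would contain a large forbidden set.
      dense-step : ∀ j v → ∑ᶠ (λ u → 𝟙 (dense? j v u)) ≤ ∑ᶠ (λ u → 𝟙 (dense? (suc j) u v)) + m * θ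
      dense-step j v = begin
        ∑ᶠ (λ u → 𝟙 (dense? j v u))
          ≤⟨ ∑-mono U (λ u → 𝟙-⊎ (dense? j v u) (dense? (suc j) u v) (bad? u) (split u)) ⟩
        ∑ᶠ (λ u → 𝟙 (dense? (suc j) u v) + 𝟙 (bad? u))
          ≡⟨ trans (∑-+ U (λ u → 𝟙 (dense? (suc j) u v)) (λ u → 𝟙 (bad? u))) (cong (∑ᶠ (λ u → 𝟙 (dense? (suc j) u v)) +_) (sym (count-filter bad? U))) ⟩
        ∑ᶠ (λ u → 𝟙 (dense? (suc j) u v)) + length B
          ≤⟨ +-monoʳ-≤ _ small ⟩
        ∑ᶠ (λ u → 𝟙 (dense? (suc j) u v)) + m * θ ∎
        where
        open ≤-Reasoning
        bad? : Decidable (λ u → Dense j v u × ¬ Dense (suc j) u v)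
        bad? u = dense? j v u ×-dec ¬? (dense? (suc j) u v)
        split : ∀ u → Dense j v u → Dense (suc j) u v ⊎ (Dense j v u × ¬ Dense (suc j) u v)
        split u h with dense? (suc j) u v
        ... | yes p = inj₁ p
        ... | no ¬p = inj₂ (h , ¬p)
        B : List (Fin N)
        B = filter bad? U
        few : ∀ {u} → u ∈ B → ∑ B (λ w → 𝟙 (allowed? u v w)) < θ
        few {u} u∈ with ∑ B (λ w → 𝟙 (allowed? u v w)) <? θ
        ... | yes p = p
        ... | no ¬p = ⊥-elim (proj₂ (proj₂ uBad) (euv , (begin
          θ * θ ^ j
            ≤⟨ *-monoˡ-≤ (θ ^ j) (≮⇒≥ ¬p) ⟩
          ∑ B (λ w → 𝟙 (allowed? u v w)) * θ ^ j
            ≡⟨ sym (∑-*ʳ B (θ ^ j) (λ w → 𝟙 (allowed? u v w))) ⟩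
          ∑ B (λ w → 𝟙 (allowed? u v w) * θ ^ j)
            ≤⟨ ∑-mono∈ B (λ w w∈ → *-monoʳ-≤ (𝟙 (allowed? u v w)) (proj₂ (proj₁ (proj₂ (∈-filter⁻ bad? {xs = U} w∈))))) ⟩
          ∑ B (λ w → 𝟙 (allowed? u v w) * ext j v w)
            ≤⟨ ∑-unique-≤ B (Unique.filter⁺ bad? (Unique.allFin⁺ N)) (λ w → 𝟙 (allowed? u v w) * ext j v w) ⟩
          ∑ᶠ (λ w → 𝟙 (allowed? u v w) * ext j v w)
            ≡⟨ ∑-cong U (λ w → sym (∑ᴸ-*ˡ U j (𝟙 (allowed? u v w)) (λ s → 𝟙 (aWalk? (v ∷ w ∷ s))))) ⟩
          ∑ᶠ (λ w → ∑ᴸ U j λ s → 𝟙 (allowed? u v w) * 𝟙 (aWalk? (v ∷ w ∷ s)))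
            ≤⟨ ∑-mono U (λ w → ∑ᴸ-mono U j λ s _ → prepend w s) ⟩
          ext (suc j) u v ∎)))
          where
          uBad : u ∈ U × Dense j v u × ¬ Dense (suc j) u v
          uBad = ∈-filter⁻ bad? {xs = U} u∈
          euv : E u v
          euv = E-sym (proj₁ (proj₁ (proj₂ uBad)))
          prepend : ∀ w s → 𝟙 (allowed? u v w) * 𝟙 (aWalk? (v ∷ w ∷ s)) ≤ 𝟙 (aWalk? (u ∷ v ∷ w ∷ s))
          prepend w s = ≤-trans (≤-reflexive (sym (𝟙-×-dec (allowed? u v w) (aWalk? (v ∷ w ∷ s)))))
            (𝟙-mono _ _ λ { (al , wk) → euv , al , wk })
        small : length B ≤ m * θ
        small with m * θ ≤? length B
        ... | no ¬p = <⇒≤ (≰⇒> ¬p)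
        ... | yes p with greedy 1≤θ v m B (Unique.filter⁺ bad? (Unique.allFin⁺ N)) few p
        ... | S , len , uS , S⊆ , indep = ⊥-elim (noLargeForbidden v S len uS
                (λ u∈ → proj₁ (proj₁ (proj₂ (∈-filter⁻ bad? {xs = U} (S⊆ u∈))))) indep)

      dense-many : ∀ j → #dense 0 ≤ #dense j + j * (N * (m * θ))
      dense-many zero = m≤m+n _ 0
      dense-many (suc j) = begin
        #dense 0 ≤⟨ dense-many j ⟩
        #dense j + j * (N * (m * θ)) ≤⟨ +-monoˡ-≤ _ (∑-mono U (dense-step j)) ⟩
        ∑ᶠ (λ v → ∑ᶠ (λ u → 𝟙 (dense? (suc j) u v)) + m * θ) + j * (N * (m * θ))
                                                             ≡⟨ cong (_+ j * (N * (m * θ))) (∑-+ U (λ v → ∑ᶠ (λ u → 𝟙 (dense? (suc j) u v))) (λ _ → m * θ)) ⟩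
        ∑ᶠ (λ v → ∑ᶠ (λ u → 𝟙 (dense? (suc j) u v))) + ∑ᶠ {N} (λ _ → m * θ) + j * (N * (m * θ))
                                                             ≡⟨ cong₂ (λ x y → x + y + j * (N * (m * θ))) (∑-swap U U (λ v u → 𝟙 (dense? (suc j) u v))) (trans (∑-const U (m * θ)) (cong (_* (m * θ)) lengthU)) ⟩
        #dense (suc j) + N * (m * θ) + j * (N * (m * θ)) ≡⟨ +-assoc (#dense (suc j)) (N * (m * θ)) (j * (N * (m * θ))) ⟩
        #dense (suc j) + suc j * (N * (m * θ)) ∎
        where open ≤-Reasoning

      -- There are at least N d / 2 = 2 (j + 1) N m θ ordered edges. Each of the `j` steps from
      -- `#dense 0` to `#dense j` loses at most N m θ, so at least N θ dense edges remain, and each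
      -- begins θ^j allowed walks.
      aWalks-many : ∀ j → 1 ≤ m → d ≡ 4 * (suc j * (m * θ)) → N * d ≤ 2 * ∑ᶠ (λ u → ∑ᶠ λ v → 𝟙 (E? u v)) →
                    N * θ ^ suc j ≤ ∑ᴸ U (suc (suc j)) (λ l → 𝟙 (aWalk? l))
      aWalks-many j 1≤m d≡ edges = begin
        N * θ ^ suc j ≡⟨ sym (*-assoc N θ (θ ^ j)) ⟩
        N * θ * θ ^ j ≤⟨ *-monoˡ-≤ (θ ^ j) denseEnough ⟩
        #dense j * θ ^ j
          ≡⟨ trans (sym (∑-*ʳ U (θ ^ j) (λ u → ∑ᶠ λ v → 𝟙 (dense? j u v)))) (∑-cong U λ u → sym (∑-*ʳ U (θ ^ j) (λ v → 𝟙 (dense? j u v)))) ⟩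
        ∑ᶠ (λ u → ∑ᶠ λ v → 𝟙 (dense? j u v) * θ ^ j) ≤⟨ ∑-mono U (λ u → ∑-mono U λ v → perEdge u v) ⟩
        ∑ᴸ U (suc (suc j)) (λ l → 𝟙 (aWalk? l)) ∎
        where
        open ≤-Reasoning
        perEdge : ∀ u v → 𝟙 (dense? j u v) * θ ^ j ≤ ext j u v
        perEdge u v with dense? j u v
        ... | yes (_ , h) = ≤-trans (≤-reflexive (*-identityˡ _)) h
        ... | no _ = z≤n
        base : ∑ᶠ (λ u → ∑ᶠ λ v → 𝟙 (E? u v)) ≤ #dense 0
        base = ∑-mono U λ u → ∑-mono U λ v → 𝟙-mono (E? u v) (dense? 0 u v) λ e → e , 𝟙≡1 (E? u v) e
        ring : ∀ N j m θ → N * (4 * ((1 + j) * (m * θ))) ≡ 2 * (N * (m * θ) + j * (N * (m * θ))) + 2 * ((1 + j) * (N * (m * θ)))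
        ring = solve-∀
        denseEnough : N * θ ≤ #dense j
        denseEnough = ≤-trans (*-monoʳ-≤ N (m≤n*m θ m {{>-nonZero 1≤m}})) (+-cancelʳ-≤ (j * (N * (m * θ))) _ _ (*-cancelˡ-≤ 2 (begin
          2 * (N * (m * θ) + j * (N * (m * θ))) ≤⟨ m≤m+n _ _ ⟩
          2 * (N * (m * θ) + j * (N * (m * θ))) + 2 * (suc j * (N * (m * θ)))
                                                              ≡⟨ trans (sym (ring N j m θ)) (cong (N *_) (sym d≡)) ⟩
          N * d ≤⟨ edges ⟩
          2 * ∑ᶠ (λ u → ∑ᶠ λ v → 𝟙 (E? u v)) ≤⟨ *-monoʳ-≤ 2 (≤-trans base (dense-many j)) ⟩
          2 * (#dense j + j * (N * (m * θ))) ∎)))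

-- Covers of bounded degree

∑ᶠ-suc : ∀ {N} (f : Fin (suc N) → ℕ) → ∑ᶠ f ≡ f zero + ∑ᶠ (f ∘ suc)
∑ᶠ-suc f = cong (f zero +_) (trans (cong (λ l → ∑ l f) (sym (map-tabulate (λ z → z) suc))) (∑-map suc (allFin _) f))

∑ᶠ-lookup : (xs : List A) (g : A → ℕ) → ∑ᶠ (λ i → g (lookup xs i)) ≡ ∑ xs g
∑ᶠ-lookup [] g = refl
∑ᶠ-lookup (x ∷ xs) g = trans (∑ᶠ-suc (λ i → g (lookup (x ∷ xs) i))) (cong (g x +_) (∑ᶠ-lookup xs g))

_∈?_ : ∀ {n} (v : Fin n) (xs : List (Fin n)) → Dec (v ∈ xs)
v ∈? xs = any? (v Fin.≟_) xs

∑ᶠ-∈?-≤ : ∀ {n} (xs : List (Fin n)) → ∑ᶠ (λ v → 𝟙 (v ∈? xs)) ≤ length xs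
∑ᶠ-∈?-≤ {n} xs = begin
  ∑ᶠ (λ v → 𝟙 (v ∈? xs))
    ≤⟨ ∑-mono (allFin n) (λ v → 𝟙-≤ (v ∈? xs) (λ v∈ → ≤-trans (𝟙≡1 (v Fin.≟ v) refl) (∑-∈ xs (λ x → 𝟙 (v Fin.≟ x)) v∈))) ⟩
  ∑ᶠ (λ v → ∑ xs λ x → 𝟙 (v Fin.≟ x)) ≡⟨ ∑-swap (allFin n) xs _ ⟩
  ∑ xs (λ x → ∑ᶠ λ v → 𝟙 (v Fin.≟ x)) ≤⟨ ∑-≤-const xs 1 (λ x _ → ∑-𝟙≡ Fin._≟_ (allFin n) x (Unique.allFin⁺ n)) ⟩
  length xs * 1 ≡⟨ *-identityʳ _ ⟩
  length xs ∎
  where open ≤-Reasoning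

∑ᶠ-∈?-≥ : ∀ {n} (xs : List (Fin n)) → Unique xs → length xs ≤ ∑ᶠ (λ v → 𝟙 (v ∈? xs))
∑ᶠ-∈?-≥ xs u = begin
  length xs ≡⟨ sym (*-identityʳ _) ⟩
  length xs * 1 ≡⟨ sym (∑-const xs 1) ⟩
  ∑ xs (λ _ → 1) ≤⟨ ∑-mono∈ xs (λ x x∈ → 𝟙≡1 (x ∈? xs) x∈) ⟩
  ∑ xs (λ x → 𝟙 (x ∈? xs)) ≤⟨ ∑-unique-≤ xs u (λ x → 𝟙 (x ∈? xs)) ⟩
  ∑ᶠ (λ v → 𝟙 (v ∈? xs)) ∎
  where open ≤-Reasoning

∑ᶠ≤1⇒≡ : ∀ {n} (f : Fin n → ℕ) → ∑ᶠ f ≤ 1 → ∀ {i j} → 1 ≤ f i → 1 ≤ f j → i ≡ j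
∑ᶠ≤1⇒≡ f h {i} {j} fi fj with i Fin.≟ j
... | yes e = e
... | no ne = ⊥-elim (<-irrefl refl (≤-trans (+-mono-≤ fi (≤-trans fj (m≤m+n (f j) 0)))
      (≤-trans (∑-unique-≤ (i ∷ j ∷ []) ((ne ∷ []) ∷ [] ∷ []) f) h)))

Unique-++ˡ : (xs : List A) {ys : List A} → Unique (xs ++ ys) → Unique xs
Unique-++ˡ [] u = []
Unique-++ˡ (x ∷ xs) (x∉ ∷ u) = All.++⁻ˡ xs x∉ ∷ Unique-++ˡ xs u

record Blocks (d : ℕ) (xs : List A) : Set where
  constructor blocks
  field
    full : List (List A)
    rest : List A
    joined : concat full ++ rest ≡ xs
    sizes : All (λ c → length c ≡ d) full
    short : length rest < d

cut : ∀ {d} → 1 ≤ d → ∀ fuel (xs : List A) → length xs ≤ fuel → Blocks d xs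
cut {d = d} 1≤d zero [] h = blocks [] [] refl [] 1≤d
cut {d = d} 1≤d (suc f) xs h with d ≤? length xs
... | no ¬p = blocks [] xs refl [] (≰⇒> ¬p)
... | yes p = blocks (take d xs ∷ B.full) B.rest
        (trans (++-assoc (take d xs) _ _) (trans (cong (take d xs ++_) B.joined) (take++drop≡id d xs)))
        (length-take-≤ d p ∷ B.sizes) B.short
  where
  shorter : length (drop d xs) ≤ f
  shorter = ≤-trans (≤-reflexive (length-drop d xs)) (≤-pred (≤-trans
    (≤-trans (s≤s (∸-monoʳ-≤ (length xs) 1≤d)) (≤-reflexive (suc-pred (length xs) {{>-nonZero (≤-trans 1≤d p)}}))) h))
  module B = Blocks (cut 1≤d f (drop d xs) shorter)

-- Splitting vertices of large degree takes the place of passing to an almost regular subgraph.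
record Cover {n : ℕ} (E : Fin n → Fin n → Set) (E? : ∀ u v → Dec (E u v)) (d : ℕ) : Set₁ where
  field
    N : ℕ
    Ê : Fin N → Fin N → Set
    Ê? : ∀ a b → Dec (Ê a b)
    Ê-sym : ∀ {a b} → Ê a b → Ê b a
    π : Fin N → Fin n
    edge : ∀ {a b} → Ê a b → E (π a) (π b)
    injective : ∀ {a b a' b'} → Ê a b → Ê a' b' → π a ≡ π a' → π b ≡ π b' → a ≡ a' × b ≡ b'
    degree : ∀ a → ∑ᶠ (λ b → 𝟙 (Ê? a b)) ≤ d
    average : N * d ≤ 2 * ∑ᶠ (λ a → ∑ᶠ λ b → 𝟙 (Ê? a b))
    dense : ∑ᶠ (λ u → ∑ᶠ λ v → 𝟙 (E? u v)) ≤ 2 * ∑ᶠ (λ a → ∑ᶠ λ b → 𝟙 (Ê? a b))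

-- Each neighbourhood is cut into blocks of size d, discarding a remainder of size less than d;
-- the vertices of the cover are the blocks.
module Build {n : ℕ} (E : Fin n → Fin n → Set) (E? : ∀ u v → Dec (E u v)) (E-sym : ∀ {u v} → E u v → E v u)
             (Active : Fin n → Set) (active? : ∀ u → Dec (Active u)) (E⇒active : ∀ {u v} → E u v → Active u)
             (d : ℕ) (1≤d : 1 ≤ d)
             (many : 4 * (d * ∑ᶠ (λ u → 𝟙 (active? u))) ≤ ∑ᶠ (λ u → ∑ᶠ λ v → 𝟙 (E? u v))) where

  V : List (Fin n)
  V = allFin n

  nbrs : Fin n → List (Fin n)
  nbrs u = filter (E? u) V

  nbrs-unique : ∀ u → Unique (nbrs u)
  nbrs-unique u = Unique.filter⁺ (E? u) (Unique.allFin⁺ n)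

  cutting : ∀ u → Blocks d (nbrs u)
  cutting u = cut 1≤d (length (nbrs u)) (nbrs u) ≤-refl

  cs : Fin n → List (List (Fin n))
  cs u = Blocks.full (cutting u)

  cs-unique : ∀ u → Unique (concat (cs u))
  cs-unique u = Unique-++ˡ (concat (cs u)) (subst Unique (sym (Blocks.joined (cutting u))) (nbrs-unique u))

  cs-edge : ∀ {u v} → v ∈ concat (cs u) → E u v
  cs-edge {u} {v} v∈ = proj₂ (∈-filter⁻ (E? u) {xs = V} (subst (v ∈_) (Blocks.joined (cutting u)) (∈-++⁺ˡ v∈)))

  inBlock : Fin n → Fin n → ℕ
  inBlock u v = ∑ (cs u) λ c → 𝟙 (v ∈? c)

  inBlock-≤1 : ∀ u v → inBlock u v ≤ 1
  inBlock-≤1 u v = begin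
    ∑ (cs u) (λ c → 𝟙 (v ∈? c))
      ≤⟨ ∑-mono (cs u) (λ c → 𝟙-≤ (v ∈? c) (λ v∈ → ≤-trans (𝟙≡1 (v Fin.≟ v) refl) (∑-∈ c (λ x → 𝟙 (x Fin.≟ v)) v∈))) ⟩
    ∑ (cs u) (λ c → ∑ c λ x → 𝟙 (x Fin.≟ v)) ≡⟨ sym (∑-concat (cs u) _) ⟩
    ∑ (concat (cs u)) (λ x → 𝟙 (x Fin.≟ v)) ≤⟨ ∑-𝟙≡ Fin._≟_ (concat (cs u)) v (cs-unique u) ⟩
    1 ∎
    where open ≤-Reasoning

  inBlock-edge : ∀ {u v} → 1 ≤ inBlock u v → E u v
  inBlock-edge {u} {v} h with ∑-<⇒∃ (cs u) (λ _ → 0) (λ c → 𝟙 (v ∈? c)) (≤-trans (s≤s (≤-reflexive (∑-zero (cs u)))) h)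
  ... | c , c∈ , lt = cs-edge (∈-concat⁺′ (𝟙-elim (v ∈? c) lt) c∈)

  -- Fewer than `d` neighbours are discarded at `u`, and none if `u` has no neighbour. Charging the
  -- loss to active vertices makes the cover available for a graph that lives on a small part of the
  -- vertex set.
  inBlock-total : ∀ u → ∑ᶠ (λ v → 𝟙 (E? u v)) ≤ ∑ᶠ (inBlock u) + d * 𝟙 (active? u)
  inBlock-total u = begin
    ∑ᶠ (λ v → 𝟙 (E? u v)) ≡⟨ sym (count-filter (E? u) V) ⟩
    length (nbrs u) ≡⟨ trans (cong length (sym (Blocks.joined (cutting u)))) (length-++ (concat (cs u))) ⟩
    length (concat (cs u)) + length (Blocks.rest (cutting u))
                                                        ≤⟨ +-mono-≤ covered remainder ⟩
    ∑ᶠ (inBlock u) + d * 𝟙 (active? u) ∎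
    where
    open ≤-Reasoning
    covered : length (concat (cs u)) ≤ ∑ᶠ (inBlock u)
    covered = ≤-trans (∑ᶠ-∈?-≥ (concat (cs u)) (cs-unique u)) (∑-mono V λ v → 𝟙-≤ (v ∈? concat (cs u)) λ v∈ →
      let c , v∈c , c∈ = ∈-concat⁻′ (cs u) v∈ in ≤-trans (𝟙≡1 (v ∈? c) v∈c) (∑-∈ (cs u) (λ c → 𝟙 (v ∈? c)) c∈))
    remainder : length (Blocks.rest (cutting u)) ≤ d * 𝟙 (active? u)
    remainder with Blocks.rest (cutting u) | Blocks.joined (cutting u) | Blocks.short (cutting u)
    ... | [] | _ | _ = z≤n
    ... | x ∷ r | j | s = ≤-trans (<⇒≤ s) (≤-trans (≤-reflexive (sym (*-identityʳ d))) (*-monoʳ-≤ d (𝟙≡1 (active? u)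
            (E⇒active (proj₂ (∈-filter⁻ (E? u) {xs = V} (subst (x ∈_) j (∈-++⁺ʳ (concat (cs u)) (here refl)))))))))

  bs : List (Fin n × List (Fin n))
  bs = concatMap (λ v → map (v ,_) (cs v)) V

  ∑-bs : (g : Fin n → List (Fin n) → ℕ) → ∑ bs (λ b → g (proj₁ b) (proj₂ b)) ≡ ∑ᶠ λ v → ∑ (cs v) (g v)
  ∑-bs g = trans (∑-concat (map (λ v → map (v ,_) (cs v)) V) (λ b → g (proj₁ b) (proj₂ b)))
    (trans (∑-map (λ v → map (v ,_) (cs v)) V (λ l → ∑ l (λ b → g (proj₁ b) (proj₂ b))))
      (∑-cong V λ v → ∑-map (v ,_) (cs v) (λ b → g (proj₁ b) (proj₂ b))))

  N : ℕ
  N = length bs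

  π : Fin N → Fin n
  π a = proj₁ (lookup bs a)

  block : Fin N → List (Fin n)
  block a = proj₂ (lookup bs a)

  ∑-N : (g : Fin n → List (Fin n) → ℕ) → ∑ᶠ (λ a → g (π a) (block a)) ≡ ∑ᶠ λ v → ∑ (cs v) (g v)
  ∑-N g = trans (∑ᶠ-lookup bs (λ b → g (proj₁ b) (proj₂ b))) (∑-bs g)

  block∈ : ∀ a → block a ∈ cs (π a)
  block∈ a with ∈-concatMap⁻ (λ v → map (v ,_) (cs v)) {xs = V} (∈-lookup {xs = bs} a)
  ... | p = go V p
    where
    go : ∀ vs → Any (λ v → lookup bs a ∈ map (v ,_) (cs v)) vs → block a ∈ cs (π a)
    go (v ∷ vs) (here q) with ∈-map⁻ (v ,_) q
    ... | c , c∈ , eq = subst₂ (λ c v → c ∈ cs v) (sym (cong proj₂ eq)) (sym (cong proj₁ eq)) c∈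
    go (v ∷ vs) (there q) = go vs q

  -- An edge is kept when neither end discards the other, and it then joins exactly one pair of
  -- blocks. So the cover has at most one edge over each ordered pair of vertices, although a vertex
  -- may have several copies.
  Ê : Fin N → Fin N → Set
  Ê a b = π b ∈ block a × π a ∈ block b

  Ê? : ∀ a b → Dec (Ê a b)
  Ê? a b = (π b ∈? block a) ×-dec (π a ∈? block b)

  edge : ∀ {a b} → Ê a b → E (π a) (π b)
  edge {a} (v∈ , _) = cs-edge (∈-concat⁺′ v∈ (block∈ a))

  block-unique : ∀ {w a a'} → w ∈ block a → w ∈ block a' → π a ≡ π a' → a ≡ a'
  block-unique {w} {a} {a'} w∈ w∈' eq = ∑ᶠ≤1⇒≡ f total
    (*-mono-≤ (𝟙≡1 (π a Fin.≟ π a) refl) (𝟙≡1 (w ∈? block a) w∈))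
    (*-mono-≤ (𝟙≡1 (π a' Fin.≟ π a) (sym eq)) (𝟙≡1 (w ∈? block a') w∈'))
    where
    f : Fin N → ℕ
    f b = 𝟙 (π b Fin.≟ π a) * 𝟙 (w ∈? block b)
    total : ∑ᶠ f ≤ 1
    total = begin
      ∑ᶠ f ≡⟨ ∑-N (λ v c → 𝟙 (v Fin.≟ π a) * 𝟙 (w ∈? c)) ⟩
      ∑ᶠ (λ v → ∑ (cs v) λ c → 𝟙 (v Fin.≟ π a) * 𝟙 (w ∈? c))
        ≡⟨ ∑-cong V (λ v → ∑-*ˡ (cs v) (𝟙 (v Fin.≟ π a)) (λ c → 𝟙 (w ∈? c))) ⟩
      ∑ᶠ (λ v → 𝟙 (v Fin.≟ π a) * inBlock v w) ≤⟨ ∑-mono V (λ v → *-monoʳ-≤ (𝟙 (v Fin.≟ π a)) (inBlock-≤1 v w)) ⟩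
      ∑ᶠ (λ v → 𝟙 (v Fin.≟ π a) * 1) ≡⟨ ∑-cong V (λ v → *-identityʳ _) ⟩
      ∑ᶠ (λ v → 𝟙 (v Fin.≟ π a)) ≤⟨ ∑-𝟙≡ Fin._≟_ V (π a) (Unique.allFin⁺ n) ⟩
      1 ∎
      where open ≤-Reasoning

  injective : ∀ {a b a' b'} → Ê a b → Ê a' b' → π a ≡ π a' → π b ≡ π b' → a ≡ a' × b ≡ b'
  injective {a} {b} {a'} {b'} (p , q) (p' , q') ea eb =
    block-unique p (subst (_∈ block a') (sym eb) p') ea , block-unique q (subst (_∈ block b') (sym ea) q') eb

  degree : ∀ a → ∑ᶠ (λ b → 𝟙 (Ê? a b)) ≤ d
  degree a = begin
    ∑ᶠ (λ b → 𝟙 (Ê? a b)) ≡⟨ ∑-cong (allFin N) (λ b → 𝟙-×-dec (π b ∈? block a) (π a ∈? block b)) ⟩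
    ∑ᶠ (λ b → 𝟙 (π b ∈? block a) * 𝟙 (π a ∈? block b)) ≡⟨ ∑-N (λ v c → 𝟙 (v ∈? block a) * 𝟙 (π a ∈? c)) ⟩
    ∑ᶠ (λ v → ∑ (cs v) λ c → 𝟙 (v ∈? block a) * 𝟙 (π a ∈? c))
      ≡⟨ ∑-cong V (λ v → ∑-*ˡ (cs v) (𝟙 (v ∈? block a)) (λ c → 𝟙 (π a ∈? c))) ⟩
    ∑ᶠ (λ v → 𝟙 (v ∈? block a) * inBlock v (π a)) ≤⟨ ∑-mono V (λ v → *-monoʳ-≤ (𝟙 (v ∈? block a)) (inBlock-≤1 v (π a))) ⟩
    ∑ᶠ (λ v → 𝟙 (v ∈? block a) * 1) ≡⟨ ∑-cong V (λ v → *-identityʳ _) ⟩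
    ∑ᶠ (λ v → 𝟙 (v ∈? block a)) ≤⟨ ∑ᶠ-∈?-≤ (block a) ⟩
    length (block a) ≡⟨ All.lookup (Blocks.sizes (cutting (π a))) (block∈ a) ⟩
    d ∎
    where open ≤-Reasoning

  e cov #A : ℕ
  e = ∑ᶠ (λ u → ∑ᶠ λ v → 𝟙 (E? u v))
  cov = ∑ᶠ (λ a → ∑ᶠ λ b → 𝟙 (Ê? a b))
  #A = ∑ᶠ (λ u → 𝟙 (active? u))

  N*d≤e : N * d ≤ e
  N*d≤e = begin
    N * d ≡⟨ trans (cong (_* d) (sym (length-tabulate {n = N} (λ z → z)))) (sym (∑-const (allFin N) d)) ⟩
    ∑ᶠ {N} (λ a → d) ≡⟨ ∑-cong (allFin N) (λ a → sym (All.lookup (Blocks.sizes (cutting (π a))) (block∈ a))) ⟩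
    ∑ᶠ (λ a → length (block a)) ≡⟨ ∑-N (λ v c → length c) ⟩
    ∑ᶠ (λ v → ∑ (cs v) length) ≡⟨ ∑-cong V (λ v → trans (∑-cong (cs v) (λ c → sym (one c))) (sym (∑-concat (cs v) (λ _ → 1)))) ⟩
    ∑ᶠ (λ v → ∑ (concat (cs v)) (λ _ → 1)) ≡⟨ ∑-cong V (λ v → one (concat (cs v))) ⟩
    ∑ᶠ (λ v → length (concat (cs v)))
      ≤⟨ ∑-mono V (λ v → ≤-trans (m≤m+n _ _) (≤-reflexive (trans (sym (length-++ (concat (cs v)))) (cong length (Blocks.joined (cutting v)))))) ⟩
    ∑ᶠ (λ v → length (nbrs v)) ≡⟨ ∑-cong V (λ v → count-filter (E? v) V) ⟩
    e ∎
    where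
    open ≤-Reasoning
    one : (c : List (Fin n)) → ∑ c (λ _ → 1) ≡ length c
    one c = trans (∑-const c 1) (*-identityʳ _)

  cov≡ : cov ≡ ∑ᶠ λ u → ∑ᶠ λ v → inBlock u v * inBlock v u
  cov≡ = begin
    cov
      ≡⟨ ∑-cong (allFin N) (λ a → trans (∑-cong (allFin N) λ b → 𝟙-×-dec (π b ∈? block a) (π a ∈? block b))
                            (∑-N λ v c' → 𝟙 (v ∈? block a) * 𝟙 (π a ∈? c'))) ⟩
    ∑ᶠ (λ a → ∑ᶠ λ v → ∑ (cs v) λ c' → 𝟙 (v ∈? block a) * 𝟙 (π a ∈? c'))
      ≡⟨ ∑-cong (allFin N) (λ a → ∑-cong V λ v → ∑-*ˡ (cs v) (𝟙 (v ∈? block a)) (λ c' → 𝟙 (π a ∈? c'))) ⟩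
    ∑ᶠ (λ a → ∑ᶠ λ v → 𝟙 (v ∈? block a) * inBlock v (π a))
      ≡⟨ ∑-N (λ u c → ∑ᶠ λ v → 𝟙 (v ∈? c) * inBlock v u) ⟩
    ∑ᶠ (λ u → ∑ (cs u) λ c → ∑ᶠ λ v → 𝟙 (v ∈? c) * inBlock v u)
      ≡⟨ ∑-cong V (λ u → ∑-swap (cs u) V (λ c v → 𝟙 (v ∈? c) * inBlock v u)) ⟩
    ∑ᶠ (λ u → ∑ᶠ λ v → ∑ (cs u) λ c → 𝟙 (v ∈? c) * inBlock v u)
      ≡⟨ ∑-cong V (λ u → ∑-cong V λ v → ∑-*ʳ (cs u) (inBlock v u) (λ c → 𝟙 (v ∈? c))) ⟩
    ∑ᶠ (λ u → ∑ᶠ λ v → inBlock u v * inBlock v u) ∎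
    where open ≡-Reasoning

  perPair : ∀ u v → inBlock u v + inBlock v u ≤ inBlock u v * inBlock v u + 𝟙 (E? u v)
  perPair u v with E? u v | inBlock u v | inBlock v u | inBlock-≤1 u v | inBlock-≤1 v u | inBlock-edge {u} {v} | inBlock-edge {v} {u}
  ... | yes _ | zero | y | _ | hy | _ | _ = hy
  ... | yes _ | suc zero | y | _ | hy | _ | _ = ≤-reflexive (trans (+-comm 1 y) (cong (_+ 1) (sym (*-identityˡ y))))
  ... | yes _ | suc (suc _) | y | s≤s () | _ | _ | _
  ... | no ¬e | zero | zero | _ | _ | _ | _ = z≤n
  ... | no ¬e | zero | suc y | _ | _ | _ | h = ⊥-elim (¬e (E-sym (h (s≤s z≤n))))
  ... | no ¬e | suc x | y | _ | _ | h | _ = ⊥-elim (¬e (h (s≤s z≤n)))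

  -- By `many`, at most e/4 of the ordered edges are discarded at their first vertex and at most as
  -- many at their second, so at least half survive.
  e≤2cov : e ≤ 2 * cov
  e≤2cov = +-cancelʳ-≤ (3 * e) e (2 * cov) (begin
    e + 3 * e ≡⟨ ring₁ e ⟩
    2 * (e + e) ≤⟨ *-monoʳ-≤ 2 (+-mono-≤ outer outer) ⟩
    2 * (I + d * #A + (I + d * #A)) ≡⟨ ring₂ I (d * #A) ⟩
    2 * (I + I) + 4 * (d * #A) ≤⟨ +-mono-≤ (*-monoʳ-≤ 2 both) many ⟩
    2 * (cov + e) + e ≡⟨ ring₃ cov e ⟩
    2 * cov + 3 * e ∎)
    where
    open ≤-Reasoning
    I : ℕ
    I = ∑ᶠ λ u → ∑ᶠ (inBlock u)
    outer : e ≤ I + d * #A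
    outer = ≤-trans (∑-mono V inBlock-total) (≤-reflexive (trans (∑-+ V (λ u → ∑ᶠ (inBlock u)) (λ u → d * 𝟙 (active? u)))
      (cong (I +_) (∑-*ˡ V d (λ u → 𝟙 (active? u))))))
    both : I + I ≤ cov + e
    both = begin
      I + I ≡⟨ cong (I +_) (∑-swap V V inBlock) ⟩
      I + ∑ᶠ (λ u → ∑ᶠ λ v → inBlock v u) ≡⟨ sym (∑-+ V _ _) ⟩
      ∑ᶠ (λ u → ∑ᶠ (inBlock u) + ∑ᶠ λ v → inBlock v u) ≡⟨ ∑-cong V (λ u → sym (∑-+ V (inBlock u) (λ v → inBlock v u))) ⟩
      ∑ᶠ (λ u → ∑ᶠ λ v → inBlock u v + inBlock v u) ≤⟨ ∑-mono V (λ u → ∑-mono V (perPair u)) ⟩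
      ∑ᶠ (λ u → ∑ᶠ λ v → inBlock u v * inBlock v u + 𝟙 (E? u v))
        ≡⟨ ∑-cong V (λ u → ∑-+ V (λ v → inBlock u v * inBlock v u) (λ v → 𝟙 (E? u v))) ⟩
      ∑ᶠ (λ u → ∑ᶠ (λ v → inBlock u v * inBlock v u) + ∑ᶠ λ v → 𝟙 (E? u v))
                                                                       ≡⟨ ∑-+ V (λ u → ∑ᶠ (λ v → inBlock u v * inBlock v u)) (λ u → ∑ᶠ λ v → 𝟙 (E? u v)) ⟩
      ∑ᶠ (λ u → ∑ᶠ (λ v → inBlock u v * inBlock v u)) + e ≡⟨ cong (_+ e) (sym cov≡) ⟩
      cov + e ∎
    ring₁ : ∀ e → e + 3 * e ≡ 2 * (e + e)
    ring₁ = solve-∀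
    ring₂ : ∀ I a → 2 * (I + a + (I + a)) ≡ 2 * (I + I) + 4 * a
    ring₂ = solve-∀
    ring₃ : ∀ c e → 2 * (c + e) + e ≡ 2 * c + 3 * e
    ring₃ = solve-∀

  cover : Cover E E? d
  cover = record
    { N = N ; Ê = Ê ; Ê? = Ê? ; Ê-sym = λ (p , q) → q , p ; π = π ; edge = edge ; injective = injective
    ; degree = degree ; average = ≤-trans N*d≤e e≤2cov ; dense = e≤2cov }

-- Selecting conflict-free paths

𝟙-any : {P : A → Set} (P? : ∀ x → Dec (P x)) (xs : List A) → 𝟙 (any? P? xs) ≤ ∑ xs λ x → 𝟙 (P? x)
𝟙-any P? xs = 𝟙-≤ (any? P? xs) (go xs)
  where
  go : ∀ xs → Any _ xs → 1 ≤ ∑ xs λ x → 𝟙 (P? x)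
  go (x ∷ xs) (here p) = ≤-trans (𝟙≡1 (P? x) p) (m≤m+n _ _)
  go (x ∷ xs) (there a) = ≤-trans (go xs a) (m≤n+m _ _)

any-∈ : {P : A → Set} {xs : List A} {x : A} → x ∈ xs → P x → Any P xs
any-∈ (here refl) p = here p
any-∈ (there x∈) p = there (any-∈ x∈ p)

SomeSplit : (List A → A → List A → Set) → List A → Set
SomeSplit B [] = ⊥
SomeSplit B (x ∷ l) = B [] x l ⊎ SomeSplit (λ p → B (x ∷ p)) l

someSplit? : {B : List A → A → List A → Set} → (∀ p v r → Dec (B p v r)) → ∀ l → Dec (SomeSplit B l)
someSplit? B? [] = no λ ()
someSplit? B? (x ∷ l) = B? [] x l ⊎-dec someSplit? (λ p → B? (x ∷ p)) l

SomeSplit-++ : {B : List A → A → List A → Set} → ∀ p v r → B p v r → SomeSplit B (p ++ v ∷ r)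
SomeSplit-++ [] v r b = inj₁ b
SomeSplit-++ (x ∷ p) v r b = inj₂ (SomeSplit-++ p v r b)

-- Union bound over the `k` positions: with all other entries fixed, at most `c` of the `length U`
-- values are bad there.
someSplit-few : (U : List A) {B : List A → A → List A → Set} (B? : ∀ p v r → Dec (B p v r)) (c k : ℕ) →
                (∀ p r → length p + length r < k → ∑ U (λ v → 𝟙 (B? p v r)) ≤ c) →
                length U * ∑ᴸ U k (λ l → 𝟙 (someSplit? B? l)) ≤ k * (length U ^ k * c)
someSplit-few U B? c zero _ = ≤-reflexive (*-zeroʳ (length U))
someSplit-few U B? c (suc k) few = begin
  m * ∑ U (λ x → ∑ᴸ U k λ l → 𝟙 (someSplit? B? (x ∷ l)))
    ≤⟨ *-monoʳ-≤ m (∑-mono U λ x → ≤-trans (∑ᴸ-mono U k λ l _ → 𝟙-⊎ (someSplit? B? (x ∷ l)) (B? [] x l) (tail? x l) (λ z → z)) (≤-reflexive (∑ᴸ-+ U k (λ l → 𝟙 (B? [] x l)) (λ l → 𝟙 (tail? x l))))) ⟩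
  m * ∑ U (λ x → ∑ᴸ U k (λ l → 𝟙 (B? [] x l)) + ∑ᴸ U k λ l → 𝟙 (tail? x l))
    ≡⟨ trans (cong (m *_) (∑-+ U (λ x → ∑ᴸ U k (λ l → 𝟙 (B? [] x l))) (λ x → ∑ᴸ U k λ l → 𝟙 (tail? x l)))) (*-distribˡ-+ m _ _) ⟩
  m * ∑ U (λ x → ∑ᴸ U k (λ l → 𝟙 (B? [] x l))) + m * ∑ U (λ x → ∑ᴸ U k λ l → 𝟙 (tail? x l))
    ≤⟨ +-mono-≤ (*-monoʳ-≤ m headFew) tailFew ⟩
  m * (m ^ k * c) + m * (k * (m ^ k * c))
    ≡⟨ ring m (m ^ k) c k ⟩
  suc k * (m ^ suc k * c) ∎
  where
  open ≤-Reasoning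
  m : ℕ
  m = length U
  tail? : ∀ x l → Dec (SomeSplit (λ p → _) l)
  tail? x l = someSplit? (λ p → B? (x ∷ p)) l
  headFew : ∑ U (λ x → ∑ᴸ U k (λ l → 𝟙 (B? [] x l))) ≤ m ^ k * c
  headFew = ≤-trans (≤-reflexive (sym (∑ᴸ-∑ U k U (λ l x → 𝟙 (B? [] x l)))))
    (≤-trans (∑ᴸ-mono U k λ l e → few [] l (s≤s (≤-reflexive e))) (≤-reflexive (∑ᴸ-const U k c)))
  tailFew : m * ∑ U (λ x → ∑ᴸ U k λ l → 𝟙 (tail? x l)) ≤ m * (k * (m ^ k * c))
  tailFew = ≤-trans (≤-reflexive (sym (∑-*ˡ U m (λ x → ∑ᴸ U k λ l → 𝟙 (tail? x l)))))
    (∑-≤-const U _ λ x _ → someSplit-few U (λ p → B? (x ∷ p)) c k (λ p r h → few (x ∷ p) r (s≤s h)))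
  ring : ∀ m e c k → m * (e * c) + m * (k * (e * c)) ≡ m * e * c + k * (m * e * c)
  ring = solve-∀

module Selection {n : ℕ} (R : Fin n → Fin n → Set) (R? : ∀ u v → Dec (R u v)) {S : ℕ} (1≤S : 1 ≤ S) (kfree : KFree S R)
                 (q w T : ℕ) (1≤q : 1 ≤ q) (T-rich : richThreshold S q w < T) where

  open Conflict R R?

  M : ℕ
  M = q * w * S

  record Family (𝓕 : List (List (Fin n))) : Set where
    field
      size : length 𝓕 ≡ T
      disjoint : Unique (concat 𝓕)
      short : ∀ {P} → P ∈ 𝓕 → length P ≤ w

    vertices : length (concat 𝓕) ≤ w * T
    vertices = ≤-trans (go 𝓕 short) (≤-reflexive (trans (cong (_* w) size) (*-comm T w)))
      where
      go : ∀ 𝓖 → (∀ {P} → P ∈ 𝓖 → length P ≤ w) → length (concat 𝓖) ≤ length 𝓖 * w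
      go [] h = z≤n
      go (P ∷ 𝓖) h = ≤-trans (≤-reflexive (length-++ P)) (+-mono-≤ (h (here refl)) (go 𝓖 (h ∘ there)))

  -- A vertex that is not rich spoils less than a proportion 1/q of the family, so q/2 such vertices
  -- together leave at least half of it untouched. By `rich-few`, at most `M` vertices are rich.
  Rich : List (List (Fin n)) → Fin n → Set
  Rich 𝓕 v = T ≤ q * hits v 𝓕

  rich? : ∀ 𝓕 v → Dec (Rich 𝓕 v)
  rich? 𝓕 v = T ≤? q * hits v 𝓕

  rich-bounded : ∀ {𝓕} → Family 𝓕 → ∀ X → Unique X → ∑ X (λ v → 𝟙 (rich? 𝓕 v)) ≤ M
  rich-bounded {𝓕} F X uX = ≤-trans (≤-reflexive (sym (count-filter (rich? 𝓕) X)))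
    (rich-few 1≤S kfree q w T 𝓕 (filter (rich? 𝓕) X) (Family.disjoint F) (Family.vertices F) T-rich
      (Unique.filter⁺ (rich? 𝓕) uX) (λ x∈ → proj₂ (∈-filter⁻ (rich? 𝓕) {xs = X} x∈)))

  -- At most half of the family conflicts with `Φ`. Since its members are disjoint, a vertex rich
  -- for some family in `𝓖s` lies in at most one of them, so fewer than T/2 members contain such a
  -- vertex. Some member is bad in neither way.
  pick : ∀ {𝓕} → Family 𝓕 → ∀ Φ → (∀ {φ} → φ ∈ Φ → ¬ Rich 𝓕 φ) → 2 * length Φ ≤ q →
         ∀ 𝓖s → (∀ {𝓖} → 𝓖 ∈ 𝓖s → Family 𝓖) → 2 * (length 𝓖s * M) < T →
         ∃ λ P → P ∈ 𝓕 × (∀ {φ v} → φ ∈ Φ → v ∈ P → ¬ R φ v) × (∀ {𝓖 v} → 𝓖 ∈ 𝓖s → v ∈ P → ¬ Rich 𝓖 v)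
  pick {𝓕} F Φ poor Φ≤ 𝓖s famG few = P , P∈ , (λ φ∈ v∈ r → notBad (inj₁ (any-∈ φ∈ (any-∈ v∈ r)))) ,
      (λ 𝓖∈ v∈ r → notBad (inj₂ (any-∈ v∈ (any-∈ 𝓖∈ r))))
    where
    open ≤-Reasoning
    Bad : List (Fin n) → Set
    Bad P = Any (λ φ → Any (R φ) P) Φ ⊎ Any (λ v → Any (λ 𝓖 → Rich 𝓖 v) 𝓖s) P
    bad₁? : ∀ P → Dec (Any (λ φ → Any (R φ) P) Φ)
    bad₁? P = any? (λ φ → any? (R? φ) P) Φ
    bad₂? : ∀ P → Dec (Any (λ v → Any (λ 𝓖 → Rich 𝓖 v) 𝓖s) P)
    bad₂? P = any? (λ v → any? (λ 𝓖 → rich? 𝓖 v) 𝓖s) P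
    first : 2 * ∑ 𝓕 (λ P → 𝟙 (bad₁? P)) ≤ T
    first = *-cancelˡ-≤ q {{>-nonZero 1≤q}} (begin
      q * (2 * ∑ 𝓕 (λ P → 𝟙 (bad₁? P))) ≤⟨ *-monoʳ-≤ q (*-monoʳ-≤ 2 (∑-mono 𝓕 λ P → 𝟙-any (λ φ → any? (R? φ) P) Φ)) ⟩
      q * (2 * ∑ 𝓕 (λ P → ∑ Φ λ φ → 𝟙 (any? (R? φ) P)))
                                                     ≡⟨ cong (λ z → q * (2 * z)) (∑-swap 𝓕 Φ (λ P φ → 𝟙 (any? (R? φ) P))) ⟩
      q * (2 * ∑ Φ (λ φ → hits φ 𝓕)) ≡⟨ ring₁ q _ ⟩
      2 * (q * ∑ Φ (λ φ → hits φ 𝓕)) ≡⟨ cong (2 *_) (sym (∑-*ˡ Φ q (λ φ → hits φ 𝓕))) ⟩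
      2 * ∑ Φ (λ φ → q * hits φ 𝓕) ≤⟨ *-monoʳ-≤ 2 (∑-≤-const Φ T λ φ φ∈ → <⇒≤ (≰⇒> (poor φ∈))) ⟩
      2 * (length Φ * T) ≡⟨ sym (*-assoc 2 (length Φ) T) ⟩
      2 * length Φ * T ≤⟨ *-monoˡ-≤ T Φ≤ ⟩
      q * T ∎)
      where
      ring₁ : ∀ q z → q * (2 * z) ≡ 2 * (q * z)
      ring₁ = solve-∀
    second : ∑ 𝓕 (λ P → 𝟙 (bad₂? P)) ≤ length 𝓖s * M
    second = begin
      ∑ 𝓕 (λ P → 𝟙 (bad₂? P))
        ≤⟨ ∑-mono 𝓕 (λ P → ≤-trans (𝟙-any (λ v → any? (λ 𝓖 → rich? 𝓖 v) 𝓖s) P) (∑-mono P λ v → 𝟙-any (λ 𝓖 → rich? 𝓖 v) 𝓖s)) ⟩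
      ∑ 𝓕 (λ P → ∑ P λ v → ∑ 𝓖s λ 𝓖 → 𝟙 (rich? 𝓖 v))
        ≡⟨ sym (∑-concat 𝓕 (λ v → ∑ 𝓖s λ 𝓖 → 𝟙 (rich? 𝓖 v))) ⟩
      ∑ (concat 𝓕) (λ v → ∑ 𝓖s λ 𝓖 → 𝟙 (rich? 𝓖 v))
        ≡⟨ ∑-swap (concat 𝓕) 𝓖s (λ v 𝓖 → 𝟙 (rich? 𝓖 v)) ⟩
      ∑ 𝓖s (λ 𝓖 → ∑ (concat 𝓕) λ v → 𝟙 (rich? 𝓖 v))
        ≤⟨ ∑-≤-const 𝓖s M (λ 𝓖 𝓖∈ → rich-bounded (famG 𝓖∈) (concat 𝓕) (Family.disjoint F)) ⟩
      length 𝓖s * M ∎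
    someGood : ∑ 𝓕 (λ P → 𝟙 (bad₁? P) + 𝟙 (bad₂? P)) < ∑ 𝓕 (λ _ → 1)
    someGood = *-cancelˡ-< 2 _ _ (begin-strict
      2 * ∑ 𝓕 (λ P → 𝟙 (bad₁? P) + 𝟙 (bad₂? P))
        ≡⟨ trans (cong (2 *_) (∑-+ 𝓕 (λ P → 𝟙 (bad₁? P)) (λ P → 𝟙 (bad₂? P)))) (*-distribˡ-+ 2 (∑ 𝓕 (λ P → 𝟙 (bad₁? P))) _) ⟩
      2 * ∑ 𝓕 (λ P → 𝟙 (bad₁? P)) + 2 * ∑ 𝓕 (λ P → 𝟙 (bad₂? P))
                                                     ≤⟨ +-mono-≤ first (*-monoʳ-≤ 2 second) ⟩
      T + 2 * (length 𝓖s * M) <⟨ +-monoʳ-< T few ⟩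
      T + T ≡⟨ trans (ring₂ T) (cong (2 *_) (trans (cong (_* 1) (sym (Family.size F))) (sym (∑-const 𝓕 1)))) ⟩
      2 * ∑ 𝓕 (λ _ → 1) ∎)
      where
      ring₂ : ∀ t → t + t ≡ 2 * (t * 1)
      ring₂ = solve-∀
    found : ∃ λ P → P ∈ 𝓕 × 𝟙 (bad₁? P) + 𝟙 (bad₂? P) < 1
    found = ∑-<⇒∃ 𝓕 _ _ someGood
    P : List (Fin n)
    P = proj₁ found
    P∈ : P ∈ 𝓕
    P∈ = proj₁ (proj₂ found)
    notBad : ¬ Bad P
    notBad (inj₁ b) = <⇒≱ (proj₂ (proj₂ found)) (≤-trans (𝟙≡1 (bad₁? P) b) (m≤m+n _ _))
    notBad (inj₂ b) = <⇒≱ (proj₂ (proj₂ found)) (≤-trans (𝟙≡1 (bad₂? P) b) (m≤n+m _ _))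

  Request : Set
  Request = List (Fin n) × List (List (Fin n))

  NoConflict : List (Fin n) → List (Fin n) → Set
  NoConflict P Q = ∀ u v → u ∈ P → v ∈ Q → ¬ R u v

  Answers : Request → List (Fin n) → Set
  Answers (Φ , 𝓕) P = P ∈ 𝓕 × NoConflict Φ P

  -- The paths are chosen in turn, and `done` collects the vertices used so far. The invariant is
  -- that `done` contains no vertex rich for a family still to come; `pick` preserves it by keeping
  -- the new path clear of such vertices.
  select : ∀ c (reqs : List Request) (done : List (Fin n)) →
           (∀ {r} → r ∈ reqs → Family (proj₂ r) × length (proj₁ r) ≤ c × (∀ {φ} → φ ∈ proj₁ r ++ done → ¬ Rich (proj₂ r) φ)) →
           2 * (c + length done + w * length reqs) ≤ q → 2 * (length reqs * M) < T →
           ∃ λ Ps → Pointwise Answers reqs Ps × All (NoConflict done) Ps × AllPairs NoConflict Ps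
  select c [] done _ _ _ = [] , [] , [] , []
  select c ((Φ , 𝓕) ∷ reqs) done ok q≥ T> = P ∷ Ps ,
      (P∈ , (λ _ _ φ∈ v∈ → ΦP (∈-++⁺ˡ φ∈) v∈)) ∷ answers ,
      (λ _ _ φ∈ v∈ → ΦP (∈-++⁺ʳ Φ φ∈) v∈) ∷ All.map (λ h u v d∈ → h u v (∈-++⁺ʳ P d∈)) free ,
      All.map (λ h u v p∈ → h u v (∈-++⁺ˡ p∈)) free ∷ pairwise
    where
    fam : Family 𝓕
    fam = proj₁ (ok (here refl))
    small : 2 * (length reqs * M) < T
    small = ≤-<-trans (*-monoʳ-≤ 2 (*-monoˡ-≤ M (n≤1+n (length reqs)))) T>
    picked : ∃ λ P → P ∈ 𝓕 × (∀ {φ v} → φ ∈ Φ ++ done → v ∈ P → ¬ R φ v) ×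
                     (∀ {𝓖 v} → 𝓖 ∈ map proj₂ reqs → v ∈ P → ¬ Rich 𝓖 v)
    picked = pick fam (Φ ++ done) (proj₂ (proj₂ (ok (here refl))))
      (≤-trans (*-monoʳ-≤ 2 (≤-trans (≤-reflexive (length-++ Φ)) (≤-trans (+-monoˡ-≤ (length done) (proj₁ (proj₂ (ok (here refl))))) (m≤m+n _ _)))) q≥)
      (map proj₂ reqs)
      (λ 𝓖∈ → let r , r∈ , eq = ∈-map⁻ proj₂ 𝓖∈ in subst Family (sym eq) (proj₁ (ok (there r∈))))
      (subst (λ z → 2 * (z * M) < T) (sym (length-map proj₂ reqs)) small)
    P : List (Fin n)
    P = proj₁ picked
    P∈ : P ∈ 𝓕
    P∈ = proj₁ (proj₂ picked)
    ΦP : ∀ {φ v} → φ ∈ Φ ++ done → v ∈ P → ¬ R φ v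
    ΦP = proj₁ (proj₂ (proj₂ picked))
    poor : ∀ {𝓖 v} → 𝓖 ∈ map proj₂ reqs → v ∈ P → ¬ Rich 𝓖 v
    poor = proj₂ (proj₂ (proj₂ picked))
    ok' : ∀ {r} → r ∈ reqs → Family (proj₂ r) × length (proj₁ r) ≤ c × (∀ {φ} → φ ∈ proj₁ r ++ P ++ done → ¬ Rich (proj₂ r) φ)
    ok' {r} r∈ = proj₁ (ok (there r∈)) , proj₁ (proj₂ (ok (there r∈))) , λ φ∈ → split (∈-++⁻ (proj₁ r) φ∈)
      where
      split : ∀ {φ} → φ ∈ proj₁ r ⊎ φ ∈ P ++ done → ¬ Rich (proj₂ r) φ
      split (inj₁ φ∈) = proj₂ (proj₂ (ok (there r∈))) (∈-++⁺ˡ φ∈)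
      split (inj₂ φ∈) = new (∈-++⁻ P φ∈)
        where
        new : ∀ {φ} → φ ∈ P ⊎ φ ∈ done → ¬ Rich (proj₂ r) φ
        new (inj₁ φ∈P) = poor (∈-map⁺ proj₂ r∈) φ∈P
        new (inj₂ φ∈d) = proj₂ (proj₂ (ok (there r∈))) (∈-++⁺ʳ (proj₁ r) φ∈d)
    budget : 2 * (c + length (P ++ done) + w * length reqs) ≤ q
    budget = ≤-trans (*-monoʳ-≤ 2 (begin
      c + length (P ++ done) + w * length reqs ≡⟨ cong (λ z → c + z + w * length reqs) (length-++ P) ⟩
      c + (length P + length done) + w * length reqs ≤⟨ +-monoˡ-≤ _ (+-monoʳ-≤ c (+-monoˡ-≤ _ (Family.short fam P∈))) ⟩
      c + (w + length done) + w * length reqs ≡⟨ ring c w (length done) (length reqs) ⟩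
      c + length done + w * suc (length reqs) ∎)) q≥
      where
      open ≤-Reasoning
      ring : ∀ c w d r → c + (w + d) + w * r ≡ c + d + w * (1 + r)
      ring = solve-∀
    rec : ∃ λ Ps → Pointwise Answers reqs Ps × All (NoConflict (P ++ done)) Ps × AllPairs NoConflict Ps
    rec = select c reqs (P ++ done) ok' budget small
    Ps : List (List (Fin n))
    Ps = proj₁ rec
    answers : Pointwise Answers reqs Ps
    answers = proj₁ (proj₂ rec)
    free : All (NoConflict (P ++ done)) Ps
    free = proj₁ (proj₂ (proj₂ rec))
    pairwise : AllPairs NoConflict Ps
    pairwise = proj₂ (proj₂ (proj₂ rec))

-- Closing up cycles

splits⇒Unique : (l : List A) → (∀ p v r → l ≡ p ++ v ∷ r → ¬ v ∈ p ++ r) → Unique l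
splits⇒Unique [] h = []
splits⇒Unique (x ∷ l) h = All.tabulate (λ { y∈ refl → h [] x l refl y∈ }) ∷
  splits⇒Unique l (λ p v r eq v∈ → h (x ∷ p) v r (cong (x ∷_) eq) (there v∈))

cyclicPairs : A → List A → List (A × A)
cyclicPairs f [] = []
cyclicPairs f (i ∷ []) = (i , f) ∷ []
cyclicPairs f (i ∷ j ∷ l) = (i , j) ∷ cyclicPairs f (j ∷ l)

length-cyclicPairs : (f : A) (l : List A) → length (cyclicPairs f l) ≡ length l
length-cyclicPairs f [] = refl
length-cyclicPairs f (i ∷ []) = refl
length-cyclicPairs f (i ∷ j ∷ l) = cong suc (length-cyclicPairs f (j ∷ l))

cyclicPairs-∈ : (f : A) (l : List A) → Unique l → ¬ f ∈ l → ∀ {i j} → (i , j) ∈ cyclicPairs f l →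
                i ∈ l × (j ∈ l ⊎ j ≡ f) × i ≢ j
cyclicPairs-∈ f (i ∷ []) u f∉ (here refl) = here refl , inj₂ refl , λ { refl → f∉ (here refl) }
cyclicPairs-∈ f (i ∷ j ∷ l) ((i≢ ∷ _) ∷ u) f∉ (here refl) = here refl , inj₁ (there (here refl)) , i≢
cyclicPairs-∈ f (i ∷ j ∷ l) (_ ∷ u) f∉ (there p) with cyclicPairs-∈ f (j ∷ l) u (f∉ ∘ there) p
... | i∈ , inj₁ j∈ , ne = there i∈ , inj₁ (there j∈) , ne
... | i∈ , inj₂ e , ne = there i∈ , inj₂ e , ne

module Closing {n : ℕ} (E R : Fin n → Fin n → Set) (E? : ∀ u v → Dec (E u v)) (R? : ∀ u v → Dec (R u v))
               (E-sym : ∀ {u v} → E u v → E v u) (R-sym : ∀ {u v} → R u v → R v u) (R-refl : ∀ {v} → R v v)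
               {S : ℕ} (1≤S : 1 ≤ S) (kfree : KFree S R)
               (q w T : ℕ) (1≤q : 1 ≤ q) (1≤w : 1 ≤ w) (T-rich : richThreshold S q w < T) (k : ℕ)
               (noCycle : ∀ x a mid b → 2 * k ≡ 3 + length mid → ¬ Paths.Cycle E R E-sym R-sym x a mid b) where

  open Paths E R E-sym R-sym
  open Selection R R? 1≤S kfree q w T 1≤q T-rich
  open Conflict R R?

  record PathFamily (i : ℕ) (x y : Fin n) (𝓕 : List (List (Fin n))) : Set where
    field
      family : Family 𝓕
      interior : ∀ {P} → P ∈ 𝓕 → length P ≡ i
      induced : ∀ {P} → P ∈ 𝓕 → IndPath (x ∷ P ++ y ∷ [])

  -- `select` supplies the two connecting paths, each avoiding the other and the middle path apart
  -- from its own end. Chords to `x` and to that end are excluded because the paths are induced. The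
  -- last equation counts `x`, the two interiors and the middle path.
  close : ∀ c i x y ys ms y' 𝓕 𝓕' → y ∷ ys ≡ ms ++ y' ∷ [] → IndPath (y ∷ ys) → (∀ {u} → u ∈ y ∷ ys → ¬ R x u) →
          PathFamily (suc i) x y 𝓕 → PathFamily (suc i) x y' 𝓕' →
          (∀ {u} → u ∈ ys → ¬ Rich 𝓕 u) → (∀ {u} → u ∈ ms → ¬ Rich 𝓕' u) →
          length ys ≤ c → 2 * (c + 0 + w * 2) ≤ q → 2 * (2 * M) < T →
          2 * k ≡ 1 + (suc i + (suc (length ys) + suc i)) → ⊥
  close c i x y ys ms y' 𝓕 𝓕' eq imid xmid F F' poor poor' len≤ q≥ T> total = finish selected
    where
    len-ms : length ms ≡ length ys
    len-ms = suc-injective (trans (+-comm 1 (length ms)) (trans (sym (length-++ ms)) (cong length (sym eq))))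
    selected : ∃ λ Ps → Pointwise Answers ((ys , 𝓕) ∷ (ms , 𝓕') ∷ []) Ps × All (NoConflict []) Ps × AllPairs NoConflict Ps
    selected = select c ((ys , 𝓕) ∷ (ms , 𝓕') ∷ []) []
      (λ { (here refl) → PathFamily.family F , len≤ , (λ φ∈ → poor (nil φ∈))
         ; (there (here refl)) → PathFamily.family F' , ≤-trans (≤-reflexive len-ms) len≤ , (λ φ∈ → poor' (nil φ∈)) })
      q≥ T>
      where
      nil : ∀ {φ : Fin n} {xs} → φ ∈ xs ++ [] → φ ∈ xs
      nil {xs = xs} φ∈ with ∈-++⁻ xs φ∈
      ... | inj₁ p = p
    finish : (∃ λ Ps → Pointwise Answers ((ys , 𝓕) ∷ (ms , 𝓕') ∷ []) Ps × All (NoConflict []) Ps × AllPairs NoConflict Ps) → ⊥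
    finish ([] ∷ _ , (p∈ , _) ∷ _ , _) with PathFamily.interior F p∈
    ... | ()
    finish (_ ∷ [] ∷ _ , _ ∷ (p∈ , _) ∷ _ , _) with PathFamily.interior F' p∈
    ... | ()
    finish ((a ∷ p) ∷ (b ∷ p') ∷ [] , (p∈ , yp) ∷ (p'∈ , mp') ∷ [] , _ , (pp' ∷ []) ∷ _) =
      noCycle x a mid b total' (proj₁ ip , proj₁ ip' , All.tabulate xmid' , subst IndPath shape ind)
      where
      mid : List (Fin n)
      mid = p ++ (y ∷ ys) ++ reverse p'
      ip : IndPath (x ∷ a ∷ p ++ y ∷ [])
      ip = PathFamily.induced F p∈
      ip' : IndPath (x ∷ b ∷ p' ++ y' ∷ [])
      ip' = PathFamily.induced F' p'∈
      ind : IndPath ((a ∷ p) ++ (y ∷ ys) ++ reverse (b ∷ p'))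
      ind = IndPath-close (a ∷ p) (b ∷ p') y ys ms y' eq (proj₂ (proj₂ ip)) imid (proj₂ (proj₂ ip'))
        (λ u∈ v∈ r → yp _ _ v∈ u∈ (R-sym r)) (λ u∈ v∈ r → mp' _ _ v∈ u∈ (R-sym r))
        (λ u∈ v∈ → pp' _ _ u∈ v∈)
      shape : (a ∷ p) ++ (y ∷ ys) ++ reverse (b ∷ p') ≡ a ∷ mid ++ b ∷ []
      shape = cong (a ∷_) (trans (cong (λ z → p ++ y ∷ ys ++ z) (unfold-reverse b p'))
        (trans (cong (p ++_) (sym (++-assoc (y ∷ ys) (reverse p') (b ∷ [])))) (sym (++-assoc p _ (b ∷ [])))))
      xmid' : ∀ {u} → u ∈ mid → ¬ R x u
      xmid' u∈ with ∈-++⁻ p u∈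
      ... | inj₁ v∈ = All.lookup (proj₁ (proj₂ ip)) (∈-++⁺ˡ v∈)
      ... | inj₂ v∈ with ∈-++⁻ (y ∷ ys) v∈
      ... | inj₁ z∈ = xmid z∈
      ... | inj₂ z∈ = All.lookup (proj₁ (proj₂ ip')) (∈-++⁺ˡ (reverse⁻ {xs = p'} z∈))
      len : length mid ≡ length p + (suc (length ys) + length p')
      len = trans (length-++ p) (cong (length p +_) (trans (length-++ (y ∷ ys)) (cong (suc (length ys) +_) (length-reverse p'))))
      lp : length p ≡ i
      lp = suc-injective (PathFamily.interior F p∈)
      lp' : length p' ≡ i
      lp' = suc-injective (PathFamily.interior F' p'∈)
      total' : 2 * k ≡ 3 + length mid
      total' = trans total (trans (ring i (length ys)) (cong (3 +_) (trans (cong₂ (λ α β → α + (suc (length ys) + β)) (sym lp) (sym lp')) (sym len))))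
        where
        ring : ∀ i y → 1 + ((1 + i) + ((1 + y) + (1 + i))) ≡ 3 + (i + ((1 + y) + i))
        ring = solve-∀

  common : Fin n → Fin n → List (Fin n)
  common x y = filter (λ z → E? x z ×-dec E? z y) (allFin n)

  singles : Fin n → Fin n → List (List (Fin n))
  singles x y = map [_] (take T (common x y))

  singles-family : ∀ {x y} → T ≤ length (common x y) → Family (singles x y)
  singles-family {x} {y} h = record
    { size = trans (length-map [_] (take T (common x y))) (length-take-≤ T {common x y} h)
    ; disjoint = subst Unique (sym (concat-map-[ take T (common x y) ])) (Unique.take⁺ T (Unique.filter⁺ _ (Unique.allFin⁺ n)))
    ; short = λ P∈ → let z , _ , eq = ∈-map⁻ [_] P∈ in ≤-trans (≤-reflexive (cong length eq)) 1≤w }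

  singles-∈ : ∀ {x y P} → P ∈ singles x y → ∃ λ z → P ≡ z ∷ [] × E x z × E z y
  singles-∈ {x} {y} P∈ with ∈-map⁻ [_] P∈
  ... | z , z∈ , eq = z , eq , proj₂ (∈-filter⁻ (λ z → E? x z ×-dec E? z y) {xs = allFin n} (take-⊆ T z∈))

  -- The cycle is x₁ z₁ x₂ z₂ … x_k z_k. By counting, most choices of x₁, …, x_k contain no x_l that conflicts with
  -- a large part of the common neighbourhood of two others; then the z_i can be chosen one by one.
  module Star {m : ℕ} (c : Fin m → Fin n) (apart : ∀ {i j} → i ≢ j → ¬ R (c i) (c j))
              (popular : ∀ {i j} → i ≢ j → T ≤ length (common (c i) (c j)))
              (m> : k * (k + k * (k * M)) < m) (q≥ : 2 * (k + 0 + w * k) ≤ q) (T> : 2 * (k * M) < T) where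

    c-injective : ∀ {i j} → c i ≡ c j → i ≡ j
    c-injective {i} {j} e with i Fin.≟ j
    ... | yes p = p
    ... | no ne = ⊥-elim (apart ne (subst (R (c i)) e R-refl))

    Bad : List (Fin m) → Fin m → List (Fin m) → Set
    Bad p v r = v ∈ p ++ r ⊎ Any (λ i → Any (λ j → i ≢ j × Rich (singles (c i) (c j)) (c v)) (p ++ r)) (p ++ r)

    richPair? : ∀ v i j → Dec (i ≢ j × Rich (singles (c i) (c j)) (c v))
    richPair? v i j = ¬? (i Fin.≟ j) ×-dec rich? (singles (c i) (c j)) (c v)

    bad? : ∀ p v r → Dec (Bad p v r)
    bad? p v r = (v ∈? (p ++ r)) ⊎-dec any? (λ i → any? (richPair? v i) (p ++ r)) (p ++ r)

    -- At most `k` values repeat another entry, and for each of the at most k² ordered pairs of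
    -- entries at most `M` vertices are rich for their common neighbours.
    bad-few : ∀ p r → length p + length r < k → ∑ᶠ (λ v → 𝟙 (bad? p v r)) ≤ k + k * (k * M)
    bad-few p r h = begin
      ∑ᶠ (λ v → 𝟙 (bad? p v r))
        ≤⟨ ∑-mono (allFin m) (λ v → ≤-trans (𝟙-⊎ (bad? p v r) (v ∈? xs) (any? (λ i → any? (richPair? v i) xs) xs) (λ z → z))
             (+-monoʳ-≤ (𝟙 (v ∈? xs)) (≤-trans (𝟙-any (λ i → any? (richPair? v i) xs) xs) (∑-mono xs λ i → 𝟙-any (richPair? v i) xs)))) ⟩
      ∑ᶠ (λ v → 𝟙 (v ∈? xs) + ∑ xs λ i → ∑ xs λ j → 𝟙 (richPair? v i j))
        ≡⟨ ∑-+ (allFin m) (λ v → 𝟙 (v ∈? xs)) (λ v → ∑ xs λ i → ∑ xs λ j → 𝟙 (richPair? v i j)) ⟩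
      ∑ᶠ (λ v → 𝟙 (v ∈? xs)) + ∑ᶠ (λ v → ∑ xs λ i → ∑ xs λ j → 𝟙 (richPair? v i j))
        ≡⟨ cong (∑ᶠ (λ v → 𝟙 (v ∈? xs)) +_) (trans (∑-swap (allFin m) xs (λ v i → ∑ xs λ j → 𝟙 (richPair? v i j)))
             (∑-cong xs λ i → ∑-swap (allFin m) xs (λ v j → 𝟙 (richPair? v i j)))) ⟩
      ∑ᶠ (λ v → 𝟙 (v ∈? xs)) + ∑ xs (λ i → ∑ xs λ j → ∑ᶠ λ v → 𝟙 (richPair? v i j))
        ≤⟨ +-mono-≤ (∑ᶠ-∈?-≤ xs) (∑-≤-const xs (length xs * M) λ i _ → ∑-≤-const xs M λ j _ → perPair i j) ⟩
      length xs + length xs * (length xs * M)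
        ≤⟨ +-mono-≤ lx (*-mono-≤ lx (*-monoˡ-≤ M lx)) ⟩
      k + k * (k * M) ∎
      where
      open ≤-Reasoning
      xs : List (Fin m)
      xs = p ++ r
      lx : length xs ≤ k
      lx = ≤-trans (≤-reflexive (length-++ p)) (<⇒≤ h)
      perPair : ∀ i j → ∑ᶠ (λ v → 𝟙 (richPair? v i j)) ≤ M
      perPair i j with i Fin.≟ j
      ... | yes _ = ≤-trans (≤-reflexive (∑-zero (allFin m))) z≤n
      ... | no ne = begin
        ∑ᶠ (λ v → 𝟙 (yes ne ×-dec rich? (singles (c i) (c j)) (c v)))
          ≤⟨ ∑-mono (allFin m) (λ v → 𝟙-mono (yes ne ×-dec rich? (singles (c i) (c j)) (c v)) (rich? (singles (c i) (c j)) (c v)) proj₂) ⟩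
        ∑ᶠ (λ v → 𝟙 (rich? (singles (c i) (c j)) (c v)))
          ≡⟨ sym (∑-map c (allFin m) (λ u → 𝟙 (rich? (singles (c i) (c j)) u))) ⟩
        ∑ (map c (allFin m)) (λ u → 𝟙 (rich? (singles (c i) (c j)) u))
          ≤⟨ rich-bounded (singles-family (popular ne)) (map c (allFin m)) (Unique.map⁺ c-injective (Unique.allFin⁺ m)) ⟩
        M ∎

    tuple : ∃ λ l → length l ≡ k × ¬ SomeSplit Bad l
    tuple with ∑ᴸ-<⇒∃ (allFin m) k (λ l → 𝟙 (someSplit? bad? l)) (λ _ → 1) few
      where
      lenU : length (allFin m) ≡ m
      lenU = length-tabulate (λ z → z)
      open ≤-Reasoning
      1≤m^k : 1 ≤ m ^ k
      1≤m^k = ≤-trans (≤-reflexive (sym (^-zeroˡ k))) (^-monoˡ-≤ k (≤-trans (s≤s z≤n) m>))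
      few : ∑ᴸ (allFin m) k (λ l → 𝟙 (someSplit? bad? l)) < ∑ᴸ (allFin m) k (λ _ → 1)
      few = *-cancelˡ-< m _ _ (begin-strict
        m * ∑ᴸ (allFin m) k (λ l → 𝟙 (someSplit? bad? l))
          ≤⟨ subst (λ z → z * ∑ᴸ (allFin m) k (λ l → 𝟙 (someSplit? bad? l)) ≤ k * (z ^ k * (k + k * (k * M)))) lenU
               (someSplit-few (allFin m) bad? (k + k * (k * M)) k bad-few) ⟩
        k * (m ^ k * (k + k * (k * M)))
          ≡⟨ ring k (m ^ k) (k + k * (k * M)) ⟩
        k * (k + k * (k * M)) * m ^ k
          <⟨ *-monoˡ-< (m ^ k) {{>-nonZero 1≤m^k}} m> ⟩
        m * m ^ k
          ≡⟨ cong (m *_) (sym (trans (∑ᴸ-const (allFin m) k 1) (trans (*-identityʳ _) (cong (_^ k) lenU)))) ⟩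
        m * ∑ᴸ (allFin m) k (λ _ → 1) ∎)
        where
        ring : ∀ k e c → k * (e * c) ≡ k * c * e
        ring = solve-∀
    ... | l , len , lt = l , len , λ s → <⇒≱ lt (𝟙≡1 (someSplit? bad? l) s)

    module Tuple (f j₀ : Fin m) (l₀ : List (Fin m)) (len : 2 + length l₀ ≡ k) (good : ¬ SomeSplit Bad (f ∷ j₀ ∷ l₀)) where

      l : List (Fin m)
      l = f ∷ j₀ ∷ l₀

      notBad : ∀ p v r → l ≡ p ++ v ∷ r → ¬ Bad p v r
      notBad p v r eq b = good (subst (SomeSplit Bad) (sym eq) (SomeSplit-++ p v r b))

      unique : Unique l
      unique = splits⇒Unique l (λ p v r eq v∈ → notBad p v r eq (inj₁ v∈))

      uniqueTail : Unique (j₀ ∷ l₀)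
      uniqueTail = AllPairs.tail unique

      f∉ : ¬ f ∈ j₀ ∷ l₀
      f∉ = Unique.Unique[x∷xs]⇒x∉xs unique

      free : ∀ {i j v} → i ∈ l → j ∈ l → v ∈ l → i ≢ j → v ≢ i → v ≢ j → ¬ Rich (singles (c i) (c j)) (c v)
      free {i} {j} {v} i∈ j∈ v∈ i≢j v≢i v≢j rich with ∈-∃++ v∈
      ... | p , r , eq = notBad p v r eq (inj₂ (any-∈ (avoid i∈ v≢i) (any-∈ (avoid j∈ v≢j) (i≢j , rich))))
        where
        avoid : ∀ {u} → u ∈ l → v ≢ u → u ∈ p ++ r
        avoid u∈ ne with ∈-++⁻ p (subst (_ ∈_) eq u∈)
        ... | inj₁ u∈p = ∈-++⁺ˡ u∈p
        ... | inj₂ (here e) = ⊥-elim (ne (sym e))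
        ... | inj₂ (there u∈r) = ∈-++⁺ʳ p u∈r

      other? : ∀ (ij : Fin m × Fin m) v → Dec (v ≢ proj₁ ij × v ≢ proj₂ ij)
      other? (i , j) v = ¬? (v Fin.≟ i) ×-dec ¬? (v Fin.≟ j)

      -- The vertex inserted between entries `i` and `j` is adjacent to both, so only the remaining
      -- entries are to be avoided.
      request : Fin m × Fin m → Request
      request ij = map c (filter (other? ij) l) , singles (c (proj₁ ij)) (c (proj₂ ij))

      prs : List (Fin m × Fin m)
      prs = cyclicPairs f l

      prs-∈ : ∀ {i j} → (i , j) ∈ prs → i ∈ l × j ∈ l × i ≢ j
      prs-∈ (here refl) = here refl , there (here refl) , All.head (AllPairs.head unique)
      prs-∈ (there p) with cyclicPairs-∈ f (j₀ ∷ l₀) uniqueTail f∉ p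
      ... | i∈ , inj₁ j∈ , ne = there i∈ , there j∈ , ne
      ... | i∈ , inj₂ refl , ne = there i∈ , here refl , ne

      Link : Fin m × Fin m → Fin n → Set
      Link (i , j) z = E (c i) z × E z (c j) × (∀ {v} → v ∈ l → v ≢ i → v ≢ j → ¬ R (c v) z)

      lenReq : length (map request prs) ≡ k
      lenReq = trans (length-map request prs) (trans (length-cyclicPairs f l) len)

      selected : ∃ λ Ps → Pointwise Answers (map request prs) Ps × All (NoConflict []) Ps × AllPairs NoConflict Ps
      selected = select k (map request prs) [] ok
        (subst (λ z → 2 * (k + 0 + w * z) ≤ q) (sym lenReq) q≥) (subst (λ z → 2 * (z * M) < T) (sym lenReq) T>)
        where
        ok : ∀ {r} → r ∈ map request prs →
             Family (proj₂ r) × length (proj₁ r) ≤ k × (∀ {φ} → φ ∈ proj₁ r ++ [] → ¬ Rich (proj₂ r) φ)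
        ok r∈ with ∈-map⁻ request r∈
        ... | (i , j) , ij∈ , refl = singles-family (popular (proj₂ (proj₂ (prs-∈ ij∈)))) ,
                ≤-trans (≤-reflexive (length-map c (filter (other? (i , j)) l))) (≤-trans (length-filter (other? (i , j)) l) (≤-reflexive len)) , poor
          where
          poor : ∀ {φ} → φ ∈ map c (filter (other? (i , j)) l) ++ [] → ¬ Rich (singles (c i) (c j)) φ
          poor φ∈ with ∈-++⁻ (map c (filter (other? (i , j)) l)) φ∈
          ... | inj₁ φ∈' with ∈-map⁻ c φ∈'
          ... | v , v∈ , refl = let v∈l , ne , ne' = ∈-filter⁻ (other? (i , j)) {xs = l} v∈
                                    i∈ , j∈ , i≢j = prs-∈ ij∈
                                in free i∈ j∈ v∈l i≢j ne ne'

      links : ∀ ps Ps → Pointwise Answers (map request ps) Ps → ∃ λ zs → Ps ≡ map [_] zs × Pointwise Link ps zs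
      links [] [] [] = [] , refl , []
      links ((i , j) ∷ ps) (P ∷ Ps) ((P∈ , noc) ∷ ans) with singles-∈ P∈ | links ps Ps ans
      ... | z , refl , e , e' | zs , refl , ls = z ∷ zs , refl , (e , e' ,
              (λ v∈ ne ne' → noc _ _ (∈-map⁺ c (∈-filter⁺ (other? (i , j)) v∈ (ne , ne'))) (here refl))) ∷ ls

      weave : List (Fin m) → List (Fin n) → List (Fin n)
      weave (j ∷ s) (z ∷ zs) = c j ∷ z ∷ weave s zs
      weave _ _ = []

      All-weave : ∀ {P : Fin n → Set} s zs → (∀ {j} → j ∈ s → P (c j)) → All P zs → All P (weave s zs)
      All-weave [] zs _ _ = []
      All-weave (j ∷ s) [] _ _ = []
      All-weave (j ∷ s) (z ∷ zs) h (pz ∷ pzs) = h (here refl) ∷ pz ∷ All-weave s zs (h ∘ there) pzs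

      outside : ∀ s zs {v} → Unique s → ¬ f ∈ s → Pointwise Link (cyclicPairs f s) zs → v ∈ l → ¬ v ∈ s → v ≢ f →
                All (λ z → ¬ R (c v) z) zs
      outside s zs {v} u f∉s lk v∈ v∉ v≢f = go (cyclicPairs f s) zs (λ p → p) lk
        where
        go : ∀ ps zs → (∀ {p} → p ∈ ps → p ∈ cyclicPairs f s) → Pointwise Link ps zs → All (λ z → ¬ R (c v) z) zs
        go [] [] _ [] = []
        go ((i , j) ∷ ps) (z ∷ zs) sub ((_ , _ , h) ∷ lk) = h v∈ (λ { refl → v∉ i∈ }) (v≢j j∈) ∷ go ps zs (sub ∘ there) lk
          where
          mem : i ∈ s × (j ∈ s ⊎ j ≡ f) × i ≢ j
          mem = cyclicPairs-∈ f s u f∉s (sub (here refl))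
          i∈ : i ∈ s
          i∈ = proj₁ mem
          j∈ : j ∈ s ⊎ j ≡ f
          j∈ = proj₁ (proj₂ mem)
          v≢j : j ∈ s ⊎ j ≡ f → v ≢ j
          v≢j (inj₁ j∈) refl = v∉ j∈
          v≢j (inj₂ refl) = v≢f

      -- Induction over the suffixes of x₂ ... x_k. The start x₁ stays outside the list, so the last
      -- connecting vertex, which leads back to x₁, is treated like the others.
      weave-path : ∀ s zs → Unique s → ¬ f ∈ s → (∀ {v} → v ∈ s → v ∈ l) → Pointwise Link (cyclicPairs f s) zs →
                   AllPairs (λ z z' → ¬ R z z') zs → IndPath (weave s zs)
      weave-path [] [] _ _ _ _ _ = tt
      weave-path (j ∷ []) (z ∷ []) _ _ _ ((e , _) ∷ []) _ = e , [] , tt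
      weave-path (j ∷ j' ∷ []) (z ∷ []) _ _ _ (_ ∷ ()) _
      weave-path (j ∷ j' ∷ _ ∷ _) (z ∷ []) _ _ _ (_ ∷ ()) _
      weave-path (j ∷ j' ∷ s) (z ∷ z' ∷ zs) ((j≢j' ∷ j≢s) ∷ u) f∉s sub ((e , e' , h) ∷ lk) (z≢ ∷ zz) =
        e ,
        All-weave (j' ∷ s) (z' ∷ zs) (λ v∈ → apart (All.lookup (j≢j' ∷ j≢s) v∈))
          (outside (j' ∷ s) (z' ∷ zs) u (f∉s ∘ there) lk (sub (here refl)) (λ j∈ → All.lookup (j≢j' ∷ j≢s) j∈ refl)
            (λ { refl → f∉s (here refl) })) ,
        e' , All.head z≢ ∷ All-weave s zs (λ v∈ r → h (sub (there (there v∈)))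
               (λ { refl → All.lookup j≢s v∈ refl }) (λ { refl → All.lookup (AllPairs.head u) v∈ refl }) (R-sym r)) (All.tail z≢) ,
        weave-path (j' ∷ s) (z' ∷ zs) u (f∉s ∘ there) (sub ∘ there) lk zz

      weave-last : ∀ j s zs → Unique (j ∷ s) → ¬ f ∈ j ∷ s → Pointwise Link (cyclicPairs f (j ∷ s)) zs →
                   ∃₂ λ mid b → weave (j ∷ s) zs ≡ c j ∷ mid ++ b ∷ [] × E (c f) b × All (λ u → ¬ R (c f) u) mid ×
                                length mid ≡ length s + length s
      weave-last j [] (z ∷ []) u f∉s ((_ , e , _) ∷ []) = [] , z , refl , E-sym e , [] , refl
      weave-last j (j' ∷ s) (z ∷ zs) (_ ∷ u) f∉s ((_ , _ , h) ∷ lk) with weave-last j' s zs u (f∉s ∘ there) lk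
      ... | mid , b , eq , e , am , lm = z ∷ c j' ∷ mid , b , cong (λ t → c j ∷ z ∷ t) eq , e ,
              h (here refl) (λ { refl → f∉s (here refl) }) (λ { refl → f∉s (there (here refl)) }) ∷
              apart (λ { refl → f∉s (there (here refl)) }) ∷ am ,
              trans (cong (2 +_) lm) (cong suc (sym (+-suc (length s) (length s))))

      contradiction : ⊥
      contradiction = derive selected
        where
        derive : (∃ λ Ps → Pointwise Answers (map request prs) Ps × All (NoConflict []) Ps × AllPairs NoConflict Ps) → ⊥
        derive (Ps , ans , _ , pw) with links prs Ps ans
        ... | z ∷ zs , refl , (e , e' , h) ∷ lk with weave-last j₀ l₀ zs uniqueTail f∉ lk
        ... | mid , b , eq , eb , am , lm = noCycle (c f) z (c j₀ ∷ mid) b total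
                (e , eb , apart (λ { refl → f∉ (here refl) }) ∷ am , subst (λ t → IndPath (z ∷ t)) eq path)
          where
          zz : AllPairs (λ z z' → ¬ R z z') (z ∷ zs)
          zz = AllPairs.map (λ h → h _ _ (here refl) (here refl)) (AllPairs.map⁻ pw)
          prepend : ∀ zs → All (λ z' → ¬ R z z') zs → IndPath (weave (j₀ ∷ l₀) zs) → IndPath (z ∷ weave (j₀ ∷ l₀) zs)
          prepend [] _ ip = tt
          prepend (z' ∷ zs) (nz ∷ nzs) ip = e' , nz ∷ All-weave l₀ zs (λ v∈ r → h (there (there v∈))
            (λ { refl → f∉ (there v∈) }) (λ { refl → All.lookup (AllPairs.head uniqueTail) v∈ refl }) (R-sym r)) nzs , ip
          path : IndPath (z ∷ weave (j₀ ∷ l₀) zs)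
          path = prepend zs (AllPairs.head zz) (weave-path (j₀ ∷ l₀) zs uniqueTail f∉ there lk (AllPairs.tail zz))
          total : 2 * k ≡ 3 + length (c j₀ ∷ mid)
          total = trans (cong (2 *_) (sym len)) (trans (ring (length l₀)) (cong (4 +_) (sym lm)))
            where
            ring : ∀ x → 2 * (2 + x) ≡ 4 + (x + x)
            ring = solve-∀

    star-⊥ : 2 ≤ k → ⊥
    star-⊥ 2≤k = derive (proj₁ tuple) (proj₁ (proj₂ tuple)) (proj₂ (proj₂ tuple))
      where
      derive : ∀ l → length l ≡ k → ¬ SomeSplit Bad l → ⊥
      derive [] len _ = <⇒≱ 2≤k (≤-trans (≤-reflexive (sym len)) z≤n)
      derive (_ ∷ []) len _ = <⇒≱ 2≤k (≤-reflexive (sym len))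
      derive (f ∷ j₀ ∷ l₀) len good = Tuple.contradiction f j₀ l₀ len good

-- Light walks

Prefix-weaken : {B : List A → Set} (l r : List A) → Prefix B l → Prefix B (l ++ r)
Prefix-weaken l r (stop b) = stop b
Prefix-weaken (x ∷ l) r (step p) = step (Prefix-weaken l r p)

Infix-weakenʳ : {B : List A → Set} (l r : List A) → Infix B l → Infix B (l ++ r)
Infix-weakenʳ l r (now p) = now (Prefix-weaken l r p)
Infix-weakenʳ (x ∷ l) r (later i) = later (Infix-weakenʳ l r i)

Infix-weakenˡ : {B : List A → Set} (p l : List A) → Infix B l → Infix B (p ++ l)
Infix-weakenˡ [] l i = i
Infix-weakenˡ (x ∷ p) l i = later (Infix-weakenˡ p l i)

Prefix-map : {B B' : List A → Set} → (∀ t → B t → B' t) → ∀ l → Prefix B l → Prefix B' l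
Prefix-map f l (stop b) = stop (f [] b)
Prefix-map f (x ∷ l) (step p) = step (Prefix-map (λ t → f (x ∷ t)) l p)

Infix-map : {B B' : List A → Set} → (∀ t → B t → B' t) → ∀ l → Infix B l → Infix B' l
Infix-map f l (now p) = now (Prefix-map f l p)
Infix-map f (x ∷ l) (later i) = later (Infix-map f l i)

bounded-if-positive : ∀ {m b} → (1 ≤ m → m ≤ b) → m ≤ b
bounded-if-positive {zero} h = z≤n
bounded-if-positive {suc m} h = h (s≤s z≤n)

∑-≤1 : (xs : List A) (f : A → ℕ) → Unique xs → (∀ x → f x ≤ 1) →
       (∀ {x y} → 1 ≤ f x → 1 ≤ f y → x ≡ y) → ∑ xs f ≤ 1
∑-≤1 [] f _ _ _ = z≤n
∑-≤1 (x ∷ xs) f (x∉ ∷ u) h same with f x in eq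
... | zero = ∑-≤1 xs f u h same
... | suc zero = ≤-reflexive (cong suc (vanish xs x∉))
  where
  vanish : ∀ ys → All (x ≢_) ys → ∑ ys f ≡ 0
  vanish [] [] = refl
  vanish (y ∷ ys) (x≢y ∷ ps) with f y in eqy
  ... | zero = vanish ys ps
  ... | suc _ = ⊥-elim (x≢y (same (≤-reflexive (sym eq)) (≤-trans (s≤s z≤n) (≤-reflexive (sym eqy)))))
... | suc (suc m) = ⊥-elim (<⇒≱ (s≤s (s≤s z≤n)) (≤-trans (≤-reflexive (sym eq)) (h x)))

snocView : (x : A) (l : List A) → ∃₂ λ p b → x ∷ l ≡ p ++ b ∷ [] × length p ≡ length l
snocView x [] = [] , x , refl , refl
snocView x (y ∷ l) with snocView y l
... | p , b , eq , len = x ∷ p , b , cong (x ∷_) eq , cong suc len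

Split : ℕ → ℕ → List A → Set
Split {A} a b l = ∃ λ (p : List A) → ∃₂ λ (v : A) (r : List A) → l ≡ p ++ v ∷ r × length p ≡ a × length r ≡ b

splitAt-length : ∀ a b (l : List A) → length l ≡ a + suc b → Split a b l
splitAt-length zero b (v ∷ r) e = [] , v , r , refl , refl , suc-injective e
splitAt-length (suc a) b (u ∷ l) e with splitAt-length a b l (suc-injective e)
... | p , v , r , refl , lp , lr = u ∷ p , v , r , refl , cong suc lp , lr

-- At most T i vertices lie on T disjoint routes with i interior vertices each, and each of them is
-- met in one of i positions by at most c(i)² walks. A pair joined by more than c(i + 1) walks
-- therefore has one that misses them all. Adding 1 to each factor keeps the sequence positive and
-- monotone.
pathBound : ℕ → ℕ → ℕ
pathBound T zero = 1
pathBound T (suc i) = suc T * (suc i * (suc i * (pathBound T i * pathBound T i)))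

pathBound-pos : ∀ T i → 1 ≤ pathBound T i
pathBound-pos T zero = ≤-refl
pathBound-pos T (suc i) = *-mono-≤ {1} {suc T} (s≤s z≤n) (*-mono-≤ {1} {suc i} (s≤s z≤n) (*-mono-≤ {1} {suc i} (s≤s z≤n) (*-mono-≤ (pathBound-pos T i) (pathBound-pos T i))))

pathBound-step : ∀ T i → pathBound T i ≤ pathBound T (suc i)
pathBound-step T i = begin
  b ≡⟨ sym (*-identityʳ b) ⟩
  b * 1 ≤⟨ *-monoʳ-≤ b (pathBound-pos T i) ⟩
  b * b ≤⟨ m≤n*m (b * b) (suc i) ⟩
  suc i * (b * b) ≤⟨ m≤n*m _ (suc i) ⟩
  suc i * (suc i * (b * b)) ≤⟨ m≤n*m _ (suc T) ⟩
  pathBound T (suc i) ∎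
  where
  open ≤-Reasoning
  b : ℕ
  b = pathBound T i

pathBound-mono : ∀ T {a i} → a ≤ i → pathBound T a ≤ pathBound T i
pathBound-mono T {a} {zero} z≤n = ≤-refl
pathBound-mono T {a} {suc i} h with m≤n⇒m<n∨m≡n h
... | inj₂ refl = ≤-refl
... | inj₁ (s≤s lt) = ≤-trans (pathBound-mono T lt) (pathBound-step T i)

module InCover {n : ℕ} {E : Fin n → Fin n → Set} {E? : ∀ u v → Dec (E u v)} {d : ℕ} (C : Cover E E? d) where

  open Cover C public
  open Walks Ê Ê? Ê-sym d degree public

  Walk-++ˡ : ∀ p r → Walk (p ++ r) → Walk p
  Walk-++ˡ [] r _ = tt
  Walk-++ˡ (x ∷ []) r _ = tt
  Walk-++ˡ (x ∷ y ∷ p) r (e , wk) = e , Walk-++ˡ (y ∷ p) r wk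

  Walk-++ʳ : ∀ p r → Walk (p ++ r) → Walk r
  Walk-++ʳ [] r wk = wk
  Walk-++ʳ (x ∷ p) r wk = Walk-++ʳ p r (Walk-tail x (p ++ r) wk)

  nbr-labels : Fin N → List (Fin n)
  nbr-labels a = map π (filter (Ê? a) U)

  -- Edges of the cover at `a` lie over different edges of the original graph. Hence bounds on
  -- conflicts between sets of at most `d` original vertices apply to neighbourhoods in the cover.
  nbr-labels-unique : ∀ a → Unique (nbr-labels a)
  nbr-labels-unique a = go (filter (Ê? a) U) (λ b∈ → proj₂ (∈-filter⁻ (Ê? a) {xs = U} b∈)) (Unique.filter⁺ (Ê? a) (Unique.allFin⁺ N))
    where
    go : ∀ bs → (∀ {b} → b ∈ bs → Ê a b) → Unique bs → Unique (map π bs)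
    go [] _ _ = []
    go (b ∷ bs) adj (b∉ ∷ u) = All.map⁺ (All.tabulate λ {b'} b'∈ eq →
        All.lookup b∉ b'∈ (proj₂ (injective (adj (here refl)) (adj (there b'∈)) refl eq))) ∷ go bs (adj ∘ there) u

  nbr-labels-length : ∀ a → length (nbr-labels a) ≤ d
  nbr-labels-length a = ≤-trans (≤-reflexive (trans (length-map π (filter (Ê? a) U)) (count-filter (Ê? a) U))) (degree a)

  ∑-nbr : ∀ a (f : Fin n → ℕ) → ∑ᶠ (λ b → 𝟙 (Ê? a b) * f (π b)) ≡ ∑ (nbr-labels a) f
  ∑-nbr a f = trans (go U) (sym (∑-map π (filter (Ê? a) U) f))
    where
    go : ∀ bs → ∑ bs (λ b → 𝟙 (Ê? a b) * f (π b)) ≡ ∑ (filter (Ê? a) bs) (f ∘ π)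
    go [] = refl
    go (b ∷ bs) with Ê? a b
    ... | yes _ = cong₂ _+_ (*-identityˡ (f (π b))) (go bs)
    ... | no _ = go bs

  module _ (Rel : Fin n → Fin n → Set) (rel? : ∀ u v → Dec (Rel u v)) where

    Relπ : Fin N → Fin N → Set
    Relπ a b = Rel (π a) (π b)

    relπ? : ∀ a b → Dec (Relπ a b)
    relπ? a b = rel? (π a) (π b)

    pairs-in-cover : ∀ c κ → (∀ X Y → Unique X → Unique Y → length X ≤ d → length Y ≤ d →
                              c * ∑ X (λ x → ∑ Y λ y → 𝟙 (rel? x y)) ≤ κ) →
      ∀ v v' → c * ∑ᶠ (λ u → ∑ᶠ λ w → 𝟙 (Ê? v u) * (𝟙 (Ê? v' w) * 𝟙 (relπ? u w))) ≤ κ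
    pairs-in-cover c κ h v v' = ≤-trans (≤-reflexive (cong (c *_) (begin
      ∑ᶠ (λ u → ∑ᶠ λ w → 𝟙 (Ê? v u) * (𝟙 (Ê? v' w) * 𝟙 (relπ? u w)))
        ≡⟨ ∑-cong U (λ u → ∑-*ˡ U (𝟙 (Ê? v u)) (λ w → 𝟙 (Ê? v' w) * 𝟙 (relπ? u w))) ⟩
      ∑ᶠ (λ u → 𝟙 (Ê? v u) * ∑ᶠ λ w → 𝟙 (Ê? v' w) * 𝟙 (relπ? u w))
        ≡⟨ ∑-cong U (λ u → cong (𝟙 (Ê? v u) *_) (∑-nbr v' (λ y → 𝟙 (rel? (π u) y)))) ⟩
      ∑ᶠ (λ u → 𝟙 (Ê? v u) * ∑ (nbr-labels v') λ y → 𝟙 (rel? (π u) y))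
        ≡⟨ ∑-nbr v (λ x → ∑ (nbr-labels v') λ y → 𝟙 (rel? x y)) ⟩
      ∑ (nbr-labels v) (λ x → ∑ (nbr-labels v') λ y → 𝟙 (rel? x y)) ∎)))
      (h (nbr-labels v) (nbr-labels v') (nbr-labels-unique v) (nbr-labels-unique v') (nbr-labels-length v) (nbr-labels-length v'))
      where open ≡-Reasoning

    module _ (E-sym : ∀ {u v} → E u v → E v u) (Rel-sym : ∀ {u v} → Rel u v → Rel v u) where

      open Paths E Rel E-sym Rel-sym

      chordless⇒IndPath : ∀ l → Walk l → ¬ Infix (Chord Relπ) l → IndPath (map π l)
      chordless⇒IndPath [] _ _ = tt
      chordless⇒IndPath (a ∷ []) _ _ = tt
      chordless⇒IndPath (a ∷ b ∷ l) (e , wk) ¬i = edge e , All.map⁺ (All.tabulate far) , chordless⇒IndPath (b ∷ l) wk (¬i ∘ later)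
        where
        far : ∀ {v} → v ∈ l → ¬ Rel (π a) (π v)
        far {v} v∈ r with ∈-∃++ v∈
        ... | p , s , refl = ¬i (now (subst (Prefix (Chord Relπ)) (cong (λ t → a ∷ b ∷ t) (++-assoc p (v ∷ []) s))
                (Prefix-++ (a ∷ b ∷ p ++ v ∷ []) s (Chord-snoc⁺ Relπ relπ? a b p v r))))

  Ends : Fin n → Fin n → List (Fin N) → Set
  Ends x y [] = ⊥
  Ends x y (a ∷ q) = π a ≡ x × π (last a q) ≡ y

  ends? : ∀ x y q → Dec (Ends x y q)
  ends? x y [] = no λ ()
  ends? x y (a ∷ q) = (π a Fin.≟ x) ×-dec (π (last a q) Fin.≟ y)

  Ends-split : ∀ {x y w} p v r → π v ≡ w → Ends x y (p ++ v ∷ r) → Ends x w (p ++ v ∷ []) × Ends w y (v ∷ r)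
  Ends-split [] v r refl (e , f) = (e , refl) , refl , f
  Ends-split (a ∷ p) v r refl (e , f) = (e , cong π (last-++ a p v)) , refl , trans (cong π (sym (last-split a p))) f
    where
    last-split : ∀ a p → last a (p ++ v ∷ r) ≡ last v r
    last-split a [] = refl
    last-split a (b ∷ p) = last-split b p

  LabelAt : ℕ → Fin n → List (Fin N) → Set
  LabelAt a w [] = ⊥
  LabelAt zero w (v ∷ q) = π v ≡ w
  LabelAt (suc a) w (v ∷ q) = LabelAt a w q

  labelAt? : ∀ a w q → Dec (LabelAt a w q)
  labelAt? a w [] = no λ ()
  labelAt? zero w (v ∷ q) = π v Fin.≟ w
  labelAt? (suc a) w (v ∷ q) = labelAt? a w q

  LabelAt-++ : ∀ p v r {w} → LabelAt (length p) w (p ++ v ∷ r) → π v ≡ w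
  LabelAt-++ [] v r e = e
  LabelAt-++ (x ∷ p) v r e = LabelAt-++ p v r e

  LabelAt-++⁺ : ∀ p v r → LabelAt (length p) (π v) (p ++ v ∷ r)
  LabelAt-++⁺ [] v r = refl
  LabelAt-++⁺ (x ∷ p) v r = LabelAt-++⁺ p v r

  -- LS i l: every subwalk of l with j edges, 2 ≤ j < i, has ends that do not conflict and that are joined by at most
  -- c j walks q with j edges and LS j q.
  module Light (R : Fin n → Fin n → Set) (R? : ∀ u v → Dec (R u v)) (c : ℕ → ℕ) (1≤c : ∀ i → 1 ≤ c i) where

    mutual
      LS : ℕ → List (Fin N) → Set
      LS zero l = Walk l
      LS (suc i) l = LS i l × ¬ Infix (Violates i) l

      ls? : ∀ i l → Dec (LS i l)
      ls? zero l = walk? l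
      ls? (suc i) l = ls? i l ×-dec ¬? (infix? (violates? i) l)

      Violates : ℕ → List (Fin N) → Set
      Violates i [] = ⊥
      Violates i (a ∷ q) = length q ≡ i × 2 ≤ i × (R (π a) (π (last a q)) ⊎ c i < cnt i (π a) (π (last a q)))

      violates? : ∀ i q → Dec (Violates i q)
      violates? i [] = no λ ()
      violates? i (a ∷ q) = (length q ≟ i) ×-dec (2 ≤? i) ×-dec (R? (π a) (π (last a q)) ⊎-dec (c i <? cnt i (π a) (π (last a q))))

      cnt : ℕ → Fin n → Fin n → ℕ
      cnt i x y = ∑ᴸ U (suc i) λ q → 𝟙 (ls? i q ×-dec ends? x y q)

    LS⇒Walk : ∀ i l → LS i l → Walk l
    LS⇒Walk zero l wk = wk
    LS⇒Walk (suc i) l (h , _) = LS⇒Walk i l h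

    LS-++ˡ : ∀ i p r → LS i (p ++ r) → LS i p
    LS-++ˡ zero p r wk = Walk-++ˡ p r wk
    LS-++ˡ (suc i) p r (h , ¬v) = LS-++ˡ i p r h , ¬v ∘ Infix-weakenʳ p r

    LS-++ʳ : ∀ i p r → LS i (p ++ r) → LS i r
    LS-++ʳ zero p r wk = Walk-++ʳ p r wk
    LS-++ʳ (suc i) p r (h , ¬v) = LS-++ʳ i p r h , ¬v ∘ Infix-weakenˡ p r

    LS-≤ : ∀ {j i} l → j ≤ i → LS i l → LS j l
    LS-≤ {j} {zero} l z≤n h = h
    LS-≤ {j} {suc i} l h ls with m≤n⇒m<n∨m≡n h
    ... | inj₂ refl = ls
    ... | inj₁ (s≤s lt) = LS-≤ l lt (proj₁ ls)

    -- An edge has at most one lift to the cover. This anchors the recursion, since the conditions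
    -- in `LS` start at two edges.
    cnt-1≤1 : ∀ x y → cnt 1 x y ≤ 1
    cnt-1≤1 x y = ∑-≤1 U (λ a → ∑ᶠ λ b → f a b) (Unique.allFin⁺ N)
      (λ a → ∑-≤1 U (f a) (Unique.allFin⁺ N) (λ b → 𝟙≤1 _) (λ {b} {b'} h h' → proj₂ (same h h')))
      (λ h h' → let b , hb = positive h ; b' , hb' = positive h' in proj₁ (same hb hb'))
      where
      f : Fin N → Fin N → ℕ
      f a b = 𝟙 (ls? 1 (a ∷ b ∷ []) ×-dec ends? x y (a ∷ b ∷ []))
      positive : ∀ {a} → 1 ≤ ∑ᶠ (f a) → ∃ λ b → 1 ≤ f a b
      positive {a} h with ∑-<⇒∃ U (λ _ → 0) (f a) (≤-trans (s≤s (≤-reflexive (∑-zero U))) h)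
      ... | b , _ , lt = b , lt
      same : ∀ {a b a' b'} → 1 ≤ f a b → 1 ≤ f a' b' → a ≡ a' × b ≡ b'
      same {a} {b} {a'} {b'} h h' with 𝟙-elim (ls? 1 (a ∷ b ∷ []) ×-dec ends? x y (a ∷ b ∷ [])) h
                                     | 𝟙-elim (ls? 1 (a' ∷ b' ∷ []) ×-dec ends? x y (a' ∷ b' ∷ [])) h'
      ... | ((e , _) , _) , ex , ey | ((e' , _) , _) , ex' , ey' = injective e e' (trans ex (sym ex')) (trans ey (sym ey'))

    through : ℕ → ℕ → Fin n → Fin n → Fin n → ℕ
    through a b x w y = ∑ᴸ U (a + suc b) λ q → 𝟙 ((ls? (a + b) q ×-dec ends? x y q) ×-dec labelAt? a w q)

    through-≤ : ∀ a b x w y → through a b x w y ≤ cnt a x w * cnt b w y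
    through-≤ a b x w y = begin
      through a b x w y
        ≡⟨ ∑ᴸ-++ U a (suc b) _ ⟩
      ∑ᴸ U a (λ p → ∑ᶠ λ v → ∑ᴸ U b λ r → 𝟙 ((ls? (a + b) (p ++ v ∷ r) ×-dec ends? x y (p ++ v ∷ r)) ×-dec labelAt? a w (p ++ v ∷ r)))
        ≤⟨ ∑ᴸ-mono U a (λ p lp → ∑-mono U λ v → ∑ᴸ-mono U b λ r _ → 𝟙-× _ (ls? a (p ++ v ∷ []) ×-dec ends? x w (p ++ v ∷ [])) (ls? b (v ∷ r) ×-dec ends? w y (v ∷ r)) (split p v r lp)) ⟩
      ∑ᴸ U a (λ p → ∑ᶠ λ v → ∑ᴸ U b λ r → left p v * right v r)
        ≡⟨ ∑ᴸ-cong U a (λ p → ∑-cong U λ v → ∑ᴸ-*ˡ U b (left p v) (right v)) ⟩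
      ∑ᴸ U a (λ p → ∑ᶠ λ v → left p v * ∑ᴸ U b (right v))
        ≤⟨ ∑ᴸ-mono U a (λ p _ → ∑-mono U λ v → *-monoʳ-≤ (left p v) (∑ᶠ-∈ (λ v → ∑ᴸ U b (right v)) v)) ⟩
      ∑ᴸ U a (λ p → ∑ᶠ λ v → left p v * cnt b w y)
        ≡⟨ ∑ᴸ-cong U a (λ p → ∑-*ʳ U (cnt b w y) (left p)) ⟩
      ∑ᴸ U a (λ p → ∑ᶠ (left p) * cnt b w y)
        ≡⟨ ∑ᴸ-*ʳ U a (cnt b w y) (λ p → ∑ᶠ (left p)) ⟩
      ∑ᴸ U a (λ p → ∑ᶠ (left p)) * cnt b w y
        ≡⟨ cong (_* cnt b w y) (sym (∑ᴸ-snoc U a (λ q → 𝟙 (ls? a q ×-dec ends? x w q)))) ⟩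
      cnt a x w * cnt b w y ∎
      where
      open ≤-Reasoning
      left : List (Fin N) → Fin N → ℕ
      left p v = 𝟙 (ls? a (p ++ v ∷ []) ×-dec ends? x w (p ++ v ∷ []))
      right : Fin N → List (Fin N) → ℕ
      right v r = 𝟙 (ls? b (v ∷ r) ×-dec ends? w y (v ∷ r))
      split : ∀ p v r → length p ≡ a → (LS (a + b) (p ++ v ∷ r) × Ends x y (p ++ v ∷ r)) × LabelAt a w (p ++ v ∷ r) →
              (LS a (p ++ v ∷ []) × Ends x w (p ++ v ∷ [])) × (LS b (v ∷ r) × Ends w y (v ∷ r))
      split p v r refl ((ls , en) , lab) =
        (LS-≤ (p ++ v ∷ []) (m≤m+n a b) (LS-++ˡ (a + b) (p ++ v ∷ []) r (subst (LS (a + b)) (sym (++-assoc p (v ∷ []) r)) ls)) , proj₁ es) ,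
        (LS-≤ (v ∷ r) (m≤n+m b a) (LS-++ʳ (a + b) p (v ∷ r) ls) , proj₂ es)
        where
        es : Ends x w (p ++ v ∷ []) × Ends w y (v ∷ r)
        es = Ends-split p v r (LabelAt-++ p v r lab) en

    light : ∀ {i} l → LS i l → ∀ j a q → length q ≡ j → 1 ≤ j → j < i → Infix (λ t → t ≡ a ∷ q) l →
            cnt j (π a) (π (last a q)) ≤ c j
    light l ls (suc zero) a q eq pos lt inf = ≤-trans (cnt-1≤1 (π a) (π (last a q))) (1≤c 1)
    light {i} l ls (suc (suc j)) a q eq pos lt inf = ≮⇒≥ λ h →
      proj₂ (LS-≤ {suc (2 + j)} {i} l lt ls) (Infix-map (λ t e → subst (Violates (2 + j)) (sym e) (eq , s≤s (s≤s z≤n) , inj₂ h)) l inf)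

    -- The factors in `through-≤` are small as soon as one such walk exists: its two pieces are
    -- proper subwalks of a walk in `LS (a + b)`, so the pairs of labels that they join are joined
    -- by few walks. If there is no such walk, the sum is zero.
    through-bounded : ∀ a b x w y → 1 ≤ a → 1 ≤ b → through a b x w y ≤ c a * c b
    through-bounded a b x w y 1≤a 1≤b = bounded-if-positive λ pos → fromWitness (∑ᴸ-<⇒∃ U (a + suc b) (λ _ → 0)
        (λ q → 𝟙 ((ls? (a + b) q ×-dec ends? x y q) ×-dec labelAt? a w q))
        (≤-trans (s≤s (≤-reflexive (trans (∑ᴸ-const U (a + suc b) 0) (*-zeroʳ (length U ^ (a + suc b)))))) pos))
      where
      bound : ∀ q → Split a b q →
              (LS (a + b) q × Ends x y q) × LabelAt a w q → cnt a x w * cnt b w y ≤ c a * c b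
      bound q ([] , v , r , refl , refl , refl) _ = ⊥-elim (<⇒≱ 1≤a z≤n)
      bound q (u ∷ p , v , r , refl , refl , refl) ((ls , en) , lab) = finish (LabelAt-++ (u ∷ p) v r lab) (proj₁ en) (proj₂ (proj₂ (Ends-split (u ∷ p) v r refl en)))
        where
        lenp : length (p ++ v ∷ []) ≡ suc (length p)
        lenp = trans (length-++ p) (+-comm (length p) 1)
        finish : ∀ {x y w} → π v ≡ w → π u ≡ x → π (last v r) ≡ y → cnt (suc (length p)) x w * cnt (length r) w y ≤ c (suc (length p)) * c (length r)
        finish refl refl refl = *-mono-≤
              (subst (λ z → cnt (suc (length p)) (π u) z ≤ c (suc (length p))) (cong π (last-++ u p v))
                (light (u ∷ p ++ v ∷ r) ls (suc (length p)) u (p ++ v ∷ []) lenp (s≤s z≤n) (m<m+n (suc (length p)) 1≤b)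
                  (now (subst (Prefix _) (cong (u ∷_) (++-assoc p (v ∷ []) r)) (Prefix-++ (u ∷ p ++ v ∷ []) r refl)))))
              (light (u ∷ p ++ v ∷ r) ls (length r) v r refl 1≤b (m<n+m (length r) {suc (length p)} (s≤s z≤n))
                (Infix-weakenˡ (u ∷ p) (v ∷ r) (now (subst (Prefix _) (++-identityʳ (v ∷ r)) (Prefix-++ (v ∷ r) [] refl)))))
      fromWitness : (∃ λ q → length q ≡ a + suc b × 0 < 𝟙 ((ls? (a + b) q ×-dec ends? x y q) ×-dec labelAt? a w q)) →
                    through a b x w y ≤ c a * c b
      fromWitness (q , lq , lt) = ≤-trans (through-≤ a b x w y)
        (bound q (splitAt-length a b q lq) (𝟙-elim ((ls? (a + b) q ×-dec ends? x y q) ×-dec labelAt? a w q) lt))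

-- Disjoint routes

Prefix⇒∃ : {B : List A → Set} → ∀ l → Prefix B l → ∃₂ λ q r → l ≡ q ++ r × B q
Prefix⇒∃ l (stop b) = [] , l , refl , b
Prefix⇒∃ (x ∷ l) (step p) with Prefix⇒∃ l p
... | q , r , refl , b = x ∷ q , r , refl , b

Infix⇒∃ : {B : List A → Set} → ∀ l → Infix B l → ∃ λ p → ∃₂ λ q r → l ≡ p ++ q ++ r × B q
Infix⇒∃ l (now pr) with Prefix⇒∃ l pr
... | q , r , refl , b = [] , q , r , refl , b
Infix⇒∃ (x ∷ l) (later i) with Infix⇒∃ l i
... | p , q , r , refl , b = x ∷ p , q , r , refl , b

module Routes {n : ℕ} {E : Fin n → Fin n → Set} {E? : ∀ u v → Dec (E u v)} {d : ℕ} (C : Cover E E? d)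
              (R : Fin n → Fin n → Set) (R? : ∀ u v → Dec (R u v))
              (E-sym : ∀ {u v} → E u v → E v u) (R-sym : ∀ {u v} → R u v → R v u) (R-refl : ∀ {v} → R v v)
              (E-irrefl : ∀ {u v} → E u v → u ≢ v)
              (c : ℕ → ℕ) (1≤c : ∀ i → 1 ≤ c i) (c-mono : ∀ {a i} → a ≤ i → c a ≤ c i) where

  open InCover C public
  open Light R R? c 1≤c public
  open Paths E R E-sym R-sym

  IndPath⇒Unique : ∀ l → IndPath l → Unique l
  IndPath⇒Unique [] _ = []
  IndPath⇒Unique (a ∷ []) _ = [] ∷ []
  IndPath⇒Unique (a ∷ b ∷ l) (e , n , ip) =
    (E-irrefl e ∷ All.map (λ { ¬r refl → ¬r R-refl }) n) ∷ IndPath⇒Unique (b ∷ l) ip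

  record Route (i : ℕ) (x y : Fin n) (P : List (Fin n)) : Set where
    constructor route
    field
      a b : Fin N
      p : List (Fin N)
      walk : LS i (a ∷ p ++ b ∷ [])
      start : π a ≡ x
      end : π b ≡ y
      labels : map π p ≡ P
      size : suc (length p) ≡ i

  -- Conflicting ends of a proper subwalk contradict `LS i`, which says nothing about the ends of
  -- the whole walk; for these the hypothesis `¬ R (π a) (π b)` is used. The subwalk is the whole
  -- walk exactly when `pre` and `post` are empty.
  chordless : ∀ i a p b → LS i (a ∷ p ++ b ∷ []) → suc (length p) ≡ i → ¬ R (π a) (π b) → ¬ Infix (Chord (Relπ R R?)) (a ∷ p ++ b ∷ [])
  chordless i a p b ls size ¬r inf with Infix⇒∃ (a ∷ p ++ b ∷ []) inf
  ... | pre , u ∷ v ∷ w ∷ l , post , eq , r = go pre post eq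
    where
    t : List (Fin N)
    t = v ∷ w ∷ l
    total : suc (suc (length p)) ≡ length pre + (suc (length t) + length post)
    total = trans (cong suc (trans (+-comm 1 (length p)) (sym (length-++ p)))) (trans (cong length eq)
      (trans (length-++ pre) (cong (length pre +_) (length-++ (u ∷ t)))))
    short : length t < i → ⊥
    short lt = proj₂ (LS-≤ {suc (length t)} {i} (a ∷ p ++ b ∷ []) lt ls)
      (subst (Infix (Violates (length t))) (sym eq) (Infix-++ pre (u ∷ t) post (refl , s≤s (s≤s z≤n) , inj₁ r)))
    go : ∀ pre' post' → a ∷ p ++ b ∷ [] ≡ pre' ++ (u ∷ t) ++ post' → ⊥
    go [] [] eq' = whole (trans eq' (++-identityʳ (u ∷ t)))
      where
      whole : a ∷ p ++ b ∷ [] ≡ u ∷ t → ⊥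
      whole e = ¬r (subst₂ (λ α β → R (π α) (π β)) (sym (∷-injectiveˡ e)) (last-≡ t (∷-injectiveʳ e)) r)
        where
        last-≡ : ∀ t → p ++ b ∷ [] ≡ t → last u t ≡ b
        last-≡ _ refl = last-++ u p b
    go (z ∷ pre') post' eq' = short (≤-trans (s≤s (≤-trans (m≤m+n (length t) (length post')) (m≤n+m _ (length pre'))))
      (≤-reflexive (trans (sym (suc-injective (trans lenEq (cong suc (+-suc (length pre') _))))) size)))
      where
      lenEq : suc (suc (length p)) ≡ suc (length pre' + (suc (length t + length post')))
      lenEq = trans (cong suc (trans (+-comm 1 (length p)) (sym (length-++ p)))) (trans (cong length eq')
        (cong suc (trans (length-++ pre') (cong (length pre' +_) (length-++ (u ∷ t))))))
    go [] (z ∷ post') eq' = short (≤-trans (≤-trans (s≤s (m≤m+n (length t) (length post'))) (≤-reflexive (sym (+-suc (length t) (length post')))))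
      (≤-reflexive (trans (sym (suc-injective lenEq)) size)))
      where
      lenEq : suc (suc (length p)) ≡ suc (length t + suc (length post'))
      lenEq = trans (cong suc (trans (+-comm 1 (length p)) (sym (length-++ p)))) (trans (cong length eq') (length-++ (u ∷ t)))

  Route⇒IndPath : ∀ {i x y P} → Route i x y P → ¬ R x y → IndPath (x ∷ P ++ y ∷ [])
  Route⇒IndPath {i} (route a b p ls refl refl refl size) ¬r = subst IndPath (cong (π a ∷_) (map-++ π p (b ∷ [])))
    (chordless⇒IndPath R R? E-sym R-sym (a ∷ p ++ b ∷ []) (LS⇒Walk i (a ∷ p ++ b ∷ []) ls) (chordless i a p b ls size ¬r))

  through' : ∀ i a b x w y → a + b ≡ i → 1 ≤ a → 1 ≤ b →
             ∑ᴸ U (suc i) (λ q → 𝟙 ((ls? i q ×-dec ends? x y q) ×-dec labelAt? a w q)) ≤ c a * c b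
  through' _ a b x w y refl 1≤a 1≤b = ≤-trans (≤-reflexive (cong (λ m → ∑ᴸ U m f) (sym (+-suc a b)))) (through-bounded a b x w y 1≤a 1≤b)
    where
    f : List (Fin N) → ℕ
    f q = 𝟙 ((ls? (a + b) q ×-dec ends? x y q) ×-dec labelAt? a w q)

  LabelAt-∈ : ∀ q {v} s → v ∈ q → ∃ λ a → a < length q × LabelAt a (π v) (q ++ s)
  LabelAt-∈ (v ∷ q) s (here refl) = 0 , s≤s z≤n , refl
  LabelAt-∈ (u ∷ q) s (there v∈) with LabelAt-∈ q s v∈
  ... | a , lt , h = suc a , s≤s lt , h

  -- Any family of fewer than T disjoint routes meets few walks from x to y, so it can be extended.
  disjointRoutes : ∀ i m x y T → suc m ≡ i → ¬ R x y → T * m * (m * (c m * c m)) < cnt i x y →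
    ∃ λ 𝓟 → length 𝓟 ≡ T × Unique (concat 𝓟) × (∀ {P} → P ∈ 𝓟 → Route i x y P)
  disjointRoutes i m x y T i≡ ¬r many = extend T ≤-refl
    where
    κ : ℕ
    κ = m * (c m * c m)
    Result : ℕ → Set
    Result t = ∃ λ 𝓟 → length 𝓟 ≡ t × Unique (concat 𝓟) × (∀ {P} → P ∈ 𝓟 → Route i x y P)

    route-length : ∀ {P} → Route i x y P → length P ≡ m
    route-length (route _ _ p _ _ _ refl size) = trans (length-map π p) (suc-injective (trans size (sym i≡)))

    concat-length : ∀ 𝓟 → (∀ {P} → P ∈ 𝓟 → Route i x y P) → length (concat 𝓟) ≡ length 𝓟 * m
    concat-length [] _ = refl
    concat-length (P ∷ 𝓟) h = trans (length-++ P) (cong₂ _+_ (route-length (h (here refl))) (concat-length 𝓟 (h ∘ there)))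

    module Next (W : List (Fin n)) (short : length W ≤ T * m) where

      base? : ∀ q → Dec (LS i q × Ends x y q)
      base? q = ls? i q ×-dec ends? x y q

      Hit : List (Fin N) → Set
      Hit q = Any (λ w → Any (λ a → LabelAt (suc a) w q) (upTo m)) W

      hit? : ∀ q → Dec (Hit q)
      hit? q = any? (λ w → any? (λ a → labelAt? (suc a) w q) (upTo m)) W

      hitting : ∑ᴸ U (suc i) (λ q → 𝟙 (base? q ×-dec hit? q)) ≤ length W * κ
      hitting = begin
        ∑ᴸ U (suc i) (λ q → 𝟙 (base? q ×-dec hit? q))
          ≤⟨ ∑ᴸ-mono U (suc i) (λ q _ → spread q) ⟩
        ∑ᴸ U (suc i) (λ q → ∑ W λ w → ∑ (upTo m) λ a → 𝟙 (base? q ×-dec labelAt? (suc a) w q))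
          ≡⟨ ∑ᴸ-∑ U (suc i) W (λ q w → ∑ (upTo m) λ a → 𝟙 (base? q ×-dec labelAt? (suc a) w q)) ⟩
        ∑ W (λ w → ∑ᴸ U (suc i) λ q → ∑ (upTo m) λ a → 𝟙 (base? q ×-dec labelAt? (suc a) w q))
          ≤⟨ ∑-≤-const W κ (λ w _ → ≤-trans (≤-reflexive (∑ᴸ-∑ U (suc i) (upTo m) (λ q a → 𝟙 (base? q ×-dec labelAt? (suc a) w q)))) (perLabel w)) ⟩
        length W * κ ∎
        where
        open ≤-Reasoning
        spread : ∀ q → 𝟙 (base? q ×-dec hit? q) ≤ ∑ W λ w → ∑ (upTo m) λ a → 𝟙 (base? q ×-dec labelAt? (suc a) w q)
        spread q = 𝟙-≤ (base? q ×-dec hit? q) λ { (bq , h) → go W bq h }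
          where
          goᵢ : ∀ as w → LS i q × Ends x y q → Any (λ a → LabelAt (suc a) w q) as → 1 ≤ ∑ as λ a → 𝟙 (base? q ×-dec labelAt? (suc a) w q)
          goᵢ (a ∷ as) w bq (here h) = ≤-trans (𝟙≡1 (base? q ×-dec labelAt? (suc a) w q) (bq , h)) (m≤m+n _ _)
          goᵢ (a ∷ as) w bq (there h) = ≤-trans (goᵢ as w bq h) (m≤n+m _ _)
          go : ∀ ws → LS i q × Ends x y q → Any (λ w → Any (λ a → LabelAt (suc a) w q) (upTo m)) ws →
               1 ≤ ∑ ws λ w → ∑ (upTo m) λ a → 𝟙 (base? q ×-dec labelAt? (suc a) w q)
          go (w ∷ ws) bq (here h) = ≤-trans (goᵢ (upTo m) w bq h) (m≤m+n _ _)
          go (w ∷ ws) bq (there h) = ≤-trans (go ws bq h) (m≤n+m _ _)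
        perLabel : ∀ w → ∑ (upTo m) (λ a → ∑ᴸ U (suc i) λ q → 𝟙 (base? q ×-dec labelAt? (suc a) w q)) ≤ κ
        perLabel w = ≤-trans (∑-≤-const (upTo m) (c m * c m) perPosition) (≤-reflexive (cong (_* (c m * c m)) (length-upTo m)))
          where
          perPosition : ∀ a → a ∈ upTo m → ∑ᴸ U (suc i) (λ q → 𝟙 (base? q ×-dec labelAt? (suc a) w q)) ≤ c m * c m
          perPosition a a∈ with ∈-upTo⁻ a∈
          -- The interior position a + 1 cuts the m + 1 edges into a + 1 and m - a edges, both
          -- between 1 and m.
          ... | lt = ≤-trans (through' i (suc a) (m ∸ a) x w y (trans (cong suc (m+[n∸m]≡n (<⇒≤ lt))) i≡) (s≤s z≤n) (m<n⇒0<n∸m lt))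
                       (*-mono-≤ (c-mono lt) (c-mono (m∸n≤m m a)))

      Found : Set
      Found = ∃ λ q → length q ≡ suc i × (LS i q × Ends x y q) × ¬ Hit q

      found : Found
      found = check (∑ᴸ-<⇒∃ U (suc i) (λ q → 𝟙 (base? q ×-dec hit? q)) (λ q → 𝟙 (base? q))
                (≤-<-trans (≤-trans hitting (*-monoˡ-≤ κ short)) many))
        where
        check : (∃ λ q → length q ≡ suc i × 𝟙 (base? q ×-dec hit? q) < 𝟙 (base? q)) → Found
        check (q , lq , lt) = q , lq , bq , λ h → <⇒≱ lt (≤-trans (𝟙≤1 (base? q)) (𝟙≡1 (base? q ×-dec hit? q) (bq , h)))
          where
          bq : LS i q × Ends x y q
          bq = 𝟙-elim (base? q) (≤-trans (s≤s z≤n) lt)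

      Fresh : Set
      Fresh = ∃ λ P → Route i x y P × (∀ {w} → w ∈ P → ¬ w ∈ W)

      fresh : ∀ a p b → suc (length p) ≡ i → LS i (a ∷ p ++ b ∷ []) × Ends x y (a ∷ p ++ b ∷ []) →
              ¬ Hit (a ∷ p ++ b ∷ []) → Fresh
      fresh a p b size (ls , (ea , eb)) ¬hit = map π p ,
          route a b p ls ea (trans (cong π (sym (last-++ a p b))) eb) refl size ,
          λ w∈ w∈W → let v , v∈ , w≡ = ∈-map⁻ π w∈
                         j , lt , h = LabelAt-∈ p (b ∷ []) v∈
                     in ¬hit (any-∈ w∈W (any-∈ (∈-upTo⁺ (≤-trans lt (≤-reflexive (suc-injective (trans size (sym i≡))))))
                               (subst (λ w → LabelAt j w (p ++ b ∷ [])) (sym w≡) h)))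

      next : Found → Fresh
      next ([] , () , _)
      next (_ ∷ [] , lq , _) = ⊥-elim (1+n≢0 (trans i≡ (sym (suc-injective lq))))
      next (a ∷ u ∷ q , lq , good , ¬hit) = peel (snocView u q)
        where
        peel : (∃₂ λ p b → u ∷ q ≡ p ++ b ∷ [] × length p ≡ length q) → Fresh
        peel (p , b , eq , lp) = fresh a p b (trans (cong suc lp) (suc-injective lq))
          (subst (λ t → LS i (a ∷ t) × Ends x y (a ∷ t)) eq good) (subst (λ t → ¬ Hit (a ∷ t)) eq ¬hit)

    extend : ∀ t → t ≤ T → Result t
    extend zero _ = [] , refl , [] , λ ()
    extend (suc t) t< = add (extend t (<⇒≤ t<))
      where
      add : Result t → Result (suc t)
      add (𝓟 , len , u , routes) = cons (N.next N.found)
        where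
        module N = Next (concat 𝓟) (≤-trans (≤-reflexive (trans (concat-length 𝓟 routes) (cong (_* m) len))) (*-monoˡ-≤ m (<⇒≤ t<)))
        cons : N.Fresh → Result (suc t)
        cons (P , r , new) = P ∷ 𝓟 , cong suc len ,
            Unique.++⁺ (Unique-++ˡ P (AllPairs.tail (IndPath⇒Unique _ (Route⇒IndPath r ¬r)))) u (λ { (w∈ , w∈') → new w∈ w∈' }) ,
            λ { (here refl) → r ; (there P∈) → routes P∈ }

-- Conflict-free walks in covers

^-distrib-* : ∀ a b k → (a * b) ^ k ≡ a ^ k * b ^ k
^-distrib-* a b zero = refl
^-distrib-* a b (suc k) = trans (cong (a * b *_) (^-distrib-* a b k)) (ring a b (a ^ k) (b ^ k))
  where
  ring : ∀ a b c d → a * b * (c * d) ≡ a * c * (b * d)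
  ring = solve-∀

-- With d = a θ, a proportion 1/q of conflicting pairs spoils at most (k + 1)² 2 N d^k / q walks.
-- Since d^k = a^k θ^k, this value of q brings the number down to half of N θ^k, as `numeric`
-- verifies.
densityConst : ℕ → ℕ → ℕ
densityConst k a = 4 * (suc k * suc k * a ^ k)

numeric : ∀ N d a θ k K inf Z → d ≡ a * θ → 1 ≤ d → K ≤ d →
          densityConst k a * (d * d) * inf ≤ suc k * suc k * (N * (d + K) * d ^ suc k) →
          N * θ ^ k ≤ inf + Z → N * θ ^ k ≤ 2 * Z
numeric N d a θ k K inf Z d≡ 1≤d K≤ few h = *-cancelˡ-≤ g {{>-nonZero 1≤g}} (+-cancelˡ-≤ (g * W) _ _ (begin
  g * W + g * W ≡⟨ ring₁ (suc k * suc k) (a ^ k) d W ⟩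
  densityConst k a * (d * d) * W ≤⟨ *-monoʳ-≤ (densityConst k a * (d * d)) h ⟩
  densityConst k a * (d * d) * (inf + Z) ≡⟨ *-distribˡ-+ (densityConst k a * (d * d)) inf Z ⟩
  densityConst k a * (d * d) * inf + densityConst k a * (d * d) * Z
                                                 ≤⟨ +-monoˡ-≤ _ few ⟩
  suc k * suc k * (N * (d + K) * d ^ suc k) + densityConst k a * (d * d) * Z
                                                 ≤⟨ +-monoˡ-≤ _ (*-monoʳ-≤ (suc k * suc k) (*-monoˡ-≤ (d ^ suc k) (*-monoʳ-≤ N (+-monoʳ-≤ d K≤)))) ⟩
  suc k * suc k * (N * (d + d) * d ^ suc k) + densityConst k a * (d * d) * Z
                                                 ≡⟨ cong (λ z → suc k * suc k * (N * (d + d) * (d * z)) + densityConst k a * (d * d) * Z)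
                                                         (trans (cong (_^ k) d≡) (^-distrib-* a θ k)) ⟩
  suc k * suc k * (N * (d + d) * (d * (a ^ k * θ ^ k))) + densityConst k a * (d * d) * Z
                                                 ≡⟨ ring₂ (suc k * suc k) (a ^ k) d N (θ ^ k) Z ⟩
  g * W + g * (2 * Z) ∎))
  where
  open ≤-Reasoning
  W g : ℕ
  W = N * θ ^ k
  g = 2 * (suc k * suc k * a ^ k) * (d * d)
  1≤a : 1 ≤ a
  1≤a = positive a d≡
    where
    positive : ∀ a → d ≡ a * θ → 1 ≤ a
    positive zero e = ⊥-elim (<⇒≱ 1≤d (≤-reflexive e))
    positive (suc a) e = s≤s z≤n
  1≤a^k : 1 ≤ a ^ k
  1≤a^k = ≤-trans (≤-reflexive (sym (^-zeroˡ k))) (^-monoˡ-≤ k 1≤a)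
  1≤g : 1 ≤ g
  1≤g = *-mono-≤ {1} {2 * (suc k * suc k * a ^ k)} (*-mono-≤ {1} {2} (s≤s z≤n) (*-mono-≤ {1} {suc k * suc k} (s≤s z≤n) 1≤a^k)) (*-mono-≤ 1≤d 1≤d)
  ring₁ : ∀ b A d W → 2 * (b * A) * (d * d) * W + 2 * (b * A) * (d * d) * W ≡ 4 * (b * A) * (d * d) * W
  ring₁ = solve-∀
  ring₂ : ∀ b A d N t Z → b * (N * (d + d) * (d * (A * t))) + 4 * (b * A) * (d * d) * Z ≡
          2 * (b * A) * (d * d) * (N * t) + 2 * (b * A) * (d * d) * (2 * Z)
  ring₂ = solve-∀

module FreeWalk {n : ℕ} {E : Fin n → Fin n → Set} {E? : ∀ u v → Dec (E u v)} {d : ℕ} (C : Cover E E? d)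
                (E-sym : ∀ {u v} → E u v → E v u)
                (Rel : Fin n → Fin n → Set) (rel? : ∀ u v → Dec (Rel u v)) (Rel-sym : ∀ {u v} → Rel u v → Rel v u) where

  open InCover C

  isChord? : ∀ l → Dec (Walk l × Chord (Relπ Rel rel?) l)
  isChord? l = walk? l ×-dec chord? (Relπ Rel rel?) (relπ? Rel rel?) l

  noChords : ∀ m → m ≤ 2 → ∑ᴸ U m (λ l → 𝟙 (isChord? l)) ≡ 0
  noChords m h = n≤0⇒n≡0 (≤-trans (∑ᴸ-mono U m {λ l → 𝟙 (isChord? l)} {λ _ → 0} (λ l len → 𝟙-≤ (isChord? l) (λ { (_ , ch) → ⊥-elim (tooShort l len ch) })))
    (≤-reflexive (trans (∑ᴸ-const U m 0) (*-zeroʳ (length U ^ m)))))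
    where
    tooShort : ∀ l → length l ≡ m → ¬ Chord (Relπ Rel rel?) l
    tooShort (a ∷ b ∷ c ∷ l) len _ = <⇒≱ (s≤s (s≤s (s≤s z≤n))) (≤-trans (≤-reflexive len) h)

  -- Among up to N d^(m-1) walks on `m` vertices, about a proportion 1/q may have conflicting ends.
  -- The term `q * κ` is of lower order and is absorbed once `d` exceeds it. Walks on fewer than
  -- three vertices have no chord.
  chordCount : ∀ q κ → (∀ X Y → Unique X → Unique Y → length X ≤ d → length Y ≤ d →
                      q * ∑ X (λ x → ∑ Y λ y → 𝟙 (rel? x y)) ≤ d * d + q * (κ * d)) →
             ∀ m → q * (d * d) * ∑ᴸ U m (λ l → 𝟙 (walk? l ×-dec chord? (Relπ Rel rel?) (relπ? Rel rel?) l)) ≤ N * (d + q * κ) * d ^ m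
  chordCount q κ pairs zero = ≤-trans (≤-reflexive (trans (cong (q * (d * d) *_) (noChords 0 z≤n)) (*-zeroʳ (q * (d * d))))) z≤n
  chordCount q κ pairs (suc zero) =
    ≤-trans (≤-reflexive (trans (cong (q * (d * d) *_) (noChords 1 (s≤s z≤n))) (*-zeroʳ (q * (d * d))))) z≤n
  chordCount q κ pairs (suc (suc zero)) =
    ≤-trans (≤-reflexive (trans (cong (q * (d * d) *_) (noChords 2 ≤-refl)) (*-zeroʳ (q * (d * d))))) z≤n
  chordCount q κ pairs (suc (suc (suc p))) = begin
    q * (d * d) * B ≡⟨ ring₁ q d B ⟩
    d * d * (q * B)
      ≤⟨ *-monoʳ-≤ (d * d) (chords-few (Relπ Rel rel?) (relπ? Rel rel?) q (d * d + q * (κ * d)) (pairs-in-cover Rel rel? q _ pairs) p) ⟩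
    d * d * (N * d ^ p * (d * d + q * (κ * d))) ≡⟨ ring₂ d N (d ^ p) q κ ⟩
    N * (d + q * κ) * d ^ (3 + p) ∎
    where
    open ≤-Reasoning
    B : ℕ
    B = ∑ᴸ U (3 + p) (λ l → 𝟙 (walk? l ×-dec chord? (Relπ Rel rel?) (relπ? Rel rel?) l))
    ring₁ : ∀ q d B → q * (d * d) * B ≡ d * d * (q * B)
    ring₁ = solve-∀
    ring₂ : ∀ d N e q κ → d * d * (N * e * (d * d + q * (κ * d))) ≡ N * (d + q * κ) * (d * (d * (d * e)))
    ring₂ = solve-∀

  N-positive : 1 ≤ ∑ᶠ (λ u → ∑ᶠ λ v → 𝟙 (E? u v)) → 1 ≤ N
  N-positive h = positive N (λ a → ∑ᶠ λ b → 𝟙 (Ê? a b)) (≤-trans h dense)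
    where
    positive : ∀ N (f : Fin N → ℕ) → 1 ≤ 2 * ∑ᶠ f → 1 ≤ N
    positive (suc N) f _ = s≤s z≤n

  open Paths E Rel E-sym Rel-sym

  -- Every step is allowed here, so even two neighbours form no forbidden set; hence the factor 2 in
  -- `d`. There are more walks than walks containing a conflict, and one of the others is the
  -- desired path.
  freeWalk : ∀ j θ κ → d ≡ 4 * (suc j * (2 * θ)) → 1 ≤ θ → 1 ≤ ∑ᶠ (λ u → ∑ᶠ λ v → 𝟙 (E? u v)) →
             (∀ X Y → Unique X → Unique Y → length X ≤ d → length Y ≤ d →
               densityConst (suc j) (8 * suc j) * ∑ X (λ x → ∑ Y λ y → 𝟙 (rel? x y)) ≤ d * d + densityConst (suc j) (8 * suc j) * (κ * d)) →
             densityConst (suc j) (8 * suc j) * κ ≤ d →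
             ∃ λ L → length L ≡ 2 + j × IndPath L
  freeWalk j θ κ d≡ 1≤θ edges pairs κ≤ = finish (∑ᴸ-<⇒∃ U (2 + j) (λ l → 𝟙 (walk? l ×-dec infix? chordπ? l)) (λ l → 𝟙 (aWalk? l)) more)
    where
    q : ℕ
    q = densityConst (suc j) (8 * suc j)
    chordπ? : ∀ l → Dec (Chord (Relπ Rel rel?) l)
    chordπ? = chord? (Relπ Rel rel?) (relπ? Rel rel?)
    Any³ : Fin N → Fin N → Fin N → Set
    Any³ _ _ _ = ⊤
    any³? : ∀ u v w → Dec (Any³ u v w)
    any³? _ _ _ = yes tt
    noPair : ∀ v X → length X ≡ 2 → Unique X → (∀ {u} → u ∈ X → Ê v u) → ¬ AllPairs (λ u w → ¬ Any³ u v w) X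
    noPair v (x ∷ y ∷ []) _ _ _ ((h ∷ _) ∷ _) = h tt
    nonempty : ¬ Chord (Relπ Rel rel?) []
    nonempty ()
    open Many Any³ any³? 2 θ noPair
    open Avoid (Chord (Relπ Rel rel?)) chordπ? nonempty (q * (d * d)) (N * (d + q * κ))
    d≡' : d ≡ 8 * suc j * θ
    d≡' = trans d≡ (ring (suc j) θ)
      where
      ring : ∀ k t → 4 * (k * (2 * t)) ≡ 8 * k * t
      ring = solve-∀
    1≤d : 1 ≤ d
    1≤d = ≤-trans (*-mono-≤ {1} {8 * suc j} (s≤s z≤n) 1≤θ) (≤-reflexive (sym d≡'))
    many : N * θ ^ suc j ≤ ∑ᴸ U (2 + j) (λ l → 𝟙 (aWalk? l))
    many = aWalks-many 1≤θ j (s≤s z≤n) d≡ average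
    more : ∑ᴸ U (2 + j) (λ l → 𝟙 (walk? l ×-dec infix? chordπ? l)) < ∑ᴸ U (2 + j) (λ l → 𝟙 (aWalk? l))
    more = ≰⇒> λ le → <⇒≱ (*-mono-≤ (N-positive edges) (≤-trans (≤-reflexive (sym (^-zeroˡ (suc j)))) (^-monoˡ-≤ (suc j) 1≤θ)))
      -- If all allowed walks had conflicts, `numeric` with `Z` = 0 would give N θ^(j+1) ≤ 0.
      (numeric N d (8 * suc j) θ (suc j) (q * κ) (#infix (2 + j)) 0 d≡' 1≤d κ≤
        (infix-few (2 + j) (λ m _ → chordCount q κ pairs m) (2 + j) ≤-refl)
        (≤-trans (≤-trans many le) (m≤m+n _ 0)))
    finish : (∃ λ l → length l ≡ 2 + j × 𝟙 (walk? l ×-dec infix? chordπ? l) < 𝟙 (aWalk? l)) → ∃ λ L → length L ≡ 2 + j × IndPath L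
    finish (l , len , lt) = map π l , trans (length-map π l) len ,
      chordless⇒IndPath Rel rel? E-sym Rel-sym l wk λ i → <⇒≱ lt (≤-trans (𝟙≤1 (aWalk? l)) (𝟙≡1 (walk? l ×-dec infix? chordπ? l) (wk , i)))
      where
      wk : Walk l
      wk = AWalk⇒Walk l (𝟙-elim (aWalk? l) (≤-trans (s≤s z≤n) lt))

-- Overfull pairs

alternate : ℕ → Bool → Bool
alternate zero b = b
alternate (suc a) b = not (alternate a b)

alternate-not : ∀ a b → alternate a (not b) ≡ not (alternate a b)
alternate-not zero b = refl
alternate-not (suc a) b = cong not (alternate-not a b)

snocView-last : ∀ {A : Set} (x : A) l → ∃ λ p → x ∷ l ≡ p ++ last x l ∷ []
snocView-last x [] = [] , refl
snocView-last x (y ∷ l) with snocView-last y l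
... | p , eq = x ∷ p , cong (x ∷_) eq

∑ᴸ-∈ : ∀ {N} (l : List (Fin N)) (f : List (Fin N) → ℕ) → f l ≤ ∑ᴸ (allFin N) (length l) f
∑ᴸ-∈ [] f = ≤-refl
∑ᴸ-∈ (a ∷ l) f = ≤-trans (∑ᴸ-∈ l (f ∘ (a ∷_))) (∑ᶠ-∈ (λ v → ∑ᴸ (allFin _) (length l) (f ∘ (v ∷_))) a)

Unique-++-disjoint : ∀ {A : Set} (xs : List A) {ys z} → Unique (xs ++ ys) → z ∈ xs → ¬ z ∈ ys
Unique-++-disjoint (x ∷ xs) (x∉ ∷ u) (here refl) z∈ = All.lookup x∉ (∈-++⁺ʳ xs z∈) refl
Unique-++-disjoint (x ∷ xs) (_ ∷ u) (there z∈) z∈' = Unique-++-disjoint xs u z∈ z∈'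

Unique-++ʳ : ∀ {A : Set} (xs : List A) {ys} → Unique (xs ++ ys) → Unique ys
Unique-++ʳ [] u = u
Unique-++ʳ (x ∷ xs) (_ ∷ u) = Unique-++ʳ xs u

representatives : ∀ {A : Set} (f : List A → A) (𝓟 : List (List A)) → (∀ {P} → P ∈ 𝓟 → f P ∈ P) →
                  Unique (concat 𝓟) → Unique (map f 𝓟)
representatives f [] _ _ = []
representatives f (P ∷ 𝓟) h u = All.map⁺ (All.tabulate λ {Q} Q∈ eq →
    Unique-++-disjoint P u (h (here refl)) (∈-concat⁺′ (subst (_∈ Q) (sym eq) (h (there Q∈))) Q∈)) ∷
  representatives f 𝓟 (h ∘ there) (Unique-++ʳ P u)

last-∈ : ∀ {A : Set} (a : A) l → last a l ∈ a ∷ l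
last-∈ a [] = here refl
last-∈ a (b ∷ l) = there (last-∈ b l)

module Heavy {n : ℕ} (E R : Fin n → Fin n → Set) (E? : ∀ u v → Dec (E u v)) (R? : ∀ u v → Dec (R u v))
             (E-sym : ∀ {u v} → E u v → E v u) (R-sym : ∀ {u v} → R u v → R v u) (R-refl : ∀ {v} → R v v)
             (side : Fin n → Bool) (E-side : ∀ {u v} → E u v → side u ≡ not (side v))
             {S : ℕ} (1≤S : 1 ≤ S) (kfree : KFree S R)
             (q w T : ℕ) (1≤q : 1 ≤ q) (1≤w : 1 ≤ w) (T-rich : richThreshold S q w < T) (k : ℕ)
             (noCycle : ∀ x a mid b → 2 * k ≡ 3 + length mid → ¬ Paths.Cycle E R E-sym R-sym x a mid b)
             (k≤w : k ≤ w) (q≥ : 2 * (2 * k + 0 + w * 2) ≤ q) (T> : 2 * (2 * (q * w * S)) < T)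
             (c : ℕ → ℕ) (1≤c : ∀ i → 1 ≤ c i) (c-mono : ∀ {a i} → a ≤ i → c a ≤ c i)
             (c-step : ∀ m → T * m * (m * (c m * c m)) ≤ c (suc m))
             {d : ℕ} (C : Cover E E? d) where

  E-irrefl : ∀ {u v} → E u v → u ≢ v
  E-irrefl {u} e refl = Bool.not-¬ refl (E-side e)

  open Closing E R E? R? E-sym R-sym R-refl 1≤S kfree q w T 1≤q 1≤w T-rich k noCycle public
  open Selection R R? 1≤S kfree q w T 1≤q T-rich public
  open Conflict R R? public
  open Routes C R R? E-sym R-sym R-refl E-irrefl c 1≤c c-mono public
  open Paths E R E-sym R-sym public

  Overfull : ℕ → Fin n → Fin n → Set
  Overfull i x y = ¬ R x y × c i < cnt i x y

  overfull? : ∀ i x y → Dec (Overfull i x y)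
  overfull? i x y = ¬? (R? x y) ×-dec (c i <? cnt i x y)

  RouteFamily : ℕ → ℕ → Fin n → Fin n → List (List (Fin n)) → Set
  RouteFamily i m x y 𝓕 = PathFamily m x y 𝓕 × (∀ {P} → P ∈ 𝓕 → Route i x y P)

  routeFamily : ∀ i m x y → suc m ≡ i → m ≤ w → Overfull i x y → ∃ (RouteFamily i m x y)
  routeFamily i m x y i≡ m≤w (¬r , many) = build (disjointRoutes i m x y T i≡ ¬r (≤-<-trans (≤-trans (c-step m) (≤-reflexive (cong c i≡))) many))
    where
    build : (∃ λ 𝓟 → length 𝓟 ≡ T × Unique (concat 𝓟) × (∀ {P} → P ∈ 𝓟 → Route i x y P)) → ∃ (RouteFamily i m x y)
    build (𝓟 , count , disj , routes) = 𝓟 , record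
      { family = record { size = count ; disjoint = disj ; short = λ P∈ → ≤-trans (≤-reflexive (len P∈)) m≤w }
      ; interior = len
      ; induced = λ P∈ → Route⇒IndPath (routes P∈) ¬r } , routes
      where
      len : ∀ {P} → P ∈ 𝓟 → length P ≡ m
      len P∈ = let open Route (routes P∈) in trans (cong length (sym labels)) (trans (length-map π p) (suc-injective (trans size (sym i≡))))

  -- The middle path is the single vertex `y`, and both connecting paths come from the same family.
  overfull-k-⊥ : ∀ i m x y → 2 + m ≡ i → i ≡ k → ¬ Overfull i x y
  overfull-k-⊥ i m x y i≡ refl h = use (routeFamily i (suc m) x y i≡ (≤-trans (≤-trans (n≤1+n (suc m)) (≤-reflexive i≡)) k≤w) h)
    where
    use : ∃ (RouteFamily i (suc m) x y) → ⊥
    use (𝓕 , F , _) = close (2 * k) m x y [] [] y 𝓕 𝓕 refl tt (λ { (here refl) → proj₁ h }) F F (λ ()) (λ ()) z≤n q≥ T>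
      (trans (cong (2 *_) (sym i≡)) (ring m))
      where
      ring : ∀ m → 2 * (2 + m) ≡ 1 + ((1 + m) + (1 + (1 + m)))
      ring = solve-∀

  side-last : ∀ a l → Walk (a ∷ l) → side (π (last a l)) ≡ alternate (length l) (side (π a))
  side-last a [] _ = refl
  side-last a (b ∷ l) (e , wk) = trans (side-last b l wk)
    (trans (cong (alternate (length l)) (trans (E-side (E-sym (edge e))) refl)) (alternate-not (length l) (side (π a))))

  -- F consists of the last edges of the walks with i edges from x to an overfull partner of x. If F were dense, it would
  -- contain a conflict-free path y₁ z₁ y₂ … with 2 (k − i) edges, which two routes from x close up to a cycle.
  module From (x : Fin n) (i m : ℕ) (i≡ : suc m ≡ i) (2≤m : 2 ≤ m) (m≤w : m ≤ w) (t : ℕ) (1≤t : 1 ≤ t) (i+t : i + t ≡ k)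
              (j : ℕ) (j≡ : suc j ≡ 2 * k) (θ : ℕ) (1≤θ : 1 ≤ θ) (D : ℕ) (D≡ : D ≡ 4 * (suc j * (2 * θ)))
              (κ≤ : densityConst (suc j) (8 * suc j) * (pairConst S (densityConst (suc j) (8 * suc j)) + 2 * M) ≤ D)
              (T≥ : 2 * (4 * D + M) ≤ T) where

    ending : Fin n → Fin n → ℕ
    ending z y = ∑ᴸ U (suc i) λ l → 𝟙 ((ls? i l ×-dec ends? x y l) ×-dec labelAt? m z l)

    ending-≤ : ∀ z y → ending z y ≤ c m * c 1
    ending-≤ z y = through' i m 1 x z y (trans (+-comm m 1) i≡) (≤-trans (s≤s z≤n) 2≤m) (s≤s z≤n)

    F : Fin n → Fin n → Set
    F z y = Overfull i x y × 1 ≤ ending z y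

    f? : ∀ z y → Dec (F z y)
    f? z y = overfull? i x y ×-dec (1 ≤? ending z y)

    record LastEdge (z y : Fin n) : Set where
      field
        isEdge : E z y
        apart : ¬ R x z
        sideᶻ : side z ≡ alternate m (side x)
        sideʸ : side y ≡ alternate i (side x)
        stub : ∃ λ l → length l ≡ i × (Walk l × LabelAt 0 x l) × LabelAt m z l

    lastEdge : ∀ {z y} → 1 ≤ ending z y → LastEdge z y
    lastEdge {z} {y} h = fromWalk (∑ᴸ-<⇒∃ U (suc i) (λ _ → 0) (λ l → 𝟙 ((ls? i l ×-dec ends? x y l) ×-dec labelAt? m z l))
        (≤-trans (s≤s (≤-reflexive (trans (∑ᴸ-const U (suc i) 0) (*-zeroʳ (length U ^ suc i))))) h))
      where
      peel : ∀ a p v b → length (a ∷ p) ≡ m → LS i (a ∷ p ++ v ∷ b ∷ []) → Ends x y (a ∷ p ++ v ∷ b ∷ []) →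
             LabelAt m z (a ∷ p ++ v ∷ b ∷ []) → LastEdge z y
      peel a p v b lp ls (refl , ey) lab = record
        { isEdge = subst₂ E ez eb (edge (proj₁ (Walk-++ʳ (a ∷ p) (v ∷ b ∷ []) wk)))
        -- The part from `x` to `z` is a proper subwalk with m ≥ 2 edges, so `LS` keeps its ends
        -- from conflicting.
        ; apart = λ r → proj₂ (LS-≤ {suc m} {i} (a ∷ p ++ v ∷ b ∷ []) (≤-reflexive i≡) ls)
            (now (subst (Prefix (Violates m)) (cong (a ∷_) (++-assoc p (v ∷ []) (b ∷ [])))
              (Prefix-++ (a ∷ p ++ v ∷ []) (b ∷ []) (lenpv , 2≤m , inj₁ (subst (R x) (trans (sym ez) (cong π (sym (last-++ a p v)))) r)))))
        ; sideᶻ = trans (cong side (trans (sym ez) (cong π (sym (last-++ a p v))))) (trans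
            (side-last a (p ++ v ∷ []) (Walk-++ˡ (a ∷ p ++ v ∷ []) (b ∷ []) (subst Walk (cong (a ∷_) (sym (++-assoc p (v ∷ []) (b ∷ [])))) wk)))
            (cong (λ r → alternate r (side x)) lenpv))
        ; sideʸ = trans (cong side (sym ey)) (trans (side-last a (p ++ v ∷ b ∷ []) wk) (cong (λ r → alternate r (side x)) lenpvb))
        ; stub = a ∷ p ++ v ∷ [] , trans (cong suc lenpv) i≡ ,
            (Walk-++ˡ (a ∷ p ++ v ∷ []) (b ∷ []) (subst Walk (cong (a ∷_) (sym (++-assoc p (v ∷ []) (b ∷ [])))) wk) , refl) ,
            subst₂ (λ r u → LabelAt r u (a ∷ p ++ v ∷ [])) lp ez (LabelAt-++⁺ (a ∷ p) v []) }
        where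
        wk : Walk (a ∷ p ++ v ∷ b ∷ [])
        wk = LS⇒Walk i _ ls
        ez : π v ≡ z
        ez = LabelAt-++ (a ∷ p) v (b ∷ []) (subst (λ r → LabelAt r z (a ∷ p ++ v ∷ b ∷ [])) (sym lp) lab)
        eb : π b ≡ y
        eb = trans (cong π (sym (last₂ a p))) ey
          where
          last₂ : ∀ a p → last a (p ++ v ∷ b ∷ []) ≡ b
          last₂ a [] = refl
          last₂ a (a' ∷ p) = last₂ a' p
        lenpv : length (p ++ v ∷ []) ≡ m
        lenpv = trans (length-++ p) (trans (+-comm (length p) 1) lp)
        lenpvb : length (p ++ v ∷ b ∷ []) ≡ i
        lenpvb = trans (length-++ p) (trans (+-comm (length p) 2) (trans (cong suc lp) i≡))
      fromWalk : (∃ λ l → length l ≡ suc i × 0 < 𝟙 ((ls? i l ×-dec ends? x y l) ×-dec labelAt? m z l)) → LastEdge z y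
      fromWalk (l , len , lt) = shape (splitAt-length m 1 l (trans len (trans (cong suc (sym i≡)) (+-comm 2 m))))
        (𝟙-elim ((ls? i l ×-dec ends? x y l) ×-dec labelAt? m z l) lt)
        where
        shape : Split m 1 l → (LS i l × Ends x y l) × LabelAt m z l → LastEdge z y
        shape ([] , _ , _ , _ , lp , _) _ = ⊥-elim (<⇒≱ 2≤m (≤-trans (≤-reflexive (sym lp)) z≤n))
        shape (a ∷ p , v , b ∷ [] , refl , lp , _) ((ls , en) , lab) = peel a p v b lp ls en lab

    -- The default is the empty family. As `T` is positive, no vertex is rich for it, so richness
    -- can enter `R'` for all pairs of vertices.
    famDec : ∀ {y} → Dec (Overfull i x y) → List (List (Fin n))
    famDec {y} (yes h) = proj₁ (routeFamily i m x y i≡ m≤w h)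
    famDec (no _) = []

    fam : Fin n → List (List (Fin n))
    fam y = famDec (overfull? i x y)

    fam-routes : ∀ {y} → Overfull i x y → RouteFamily i m x y (fam y)
    fam-routes {y} h = go (overfull? i x y)
      where
      go : ∀ o? → RouteFamily i m x y (famDec o?)
      go (yes h') = proj₂ (routeFamily i m x y i≡ m≤w h')
      go (no ¬h) = ⊥-elim (¬h h)

    1≤T : 1 ≤ T
    1≤T = ≤-trans (s≤s z≤n) T>

    rich-≤ : ∀ y X → Unique X → ∑ X (λ v → 𝟙 (rich? (fam y) v)) ≤ M * 𝟙 (overfull? i x y)
    rich-≤ y X uX = go (overfull? i x y)
      where
      go : ∀ o? → ∑ X (λ v → 𝟙 (rich? (famDec o?) v)) ≤ M * 𝟙 o?
      go (yes h) = ≤-trans (rich-bounded (PathFamily.family (proj₁ (proj₂ (routeFamily i m x y i≡ m≤w h)))) X uX) (≤-reflexive (sym (*-identityʳ M)))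
      go (no _) = ≤-trans (∑-mono X (λ v → 𝟙-≤ (rich? [] v) {0} (λ r → ⊥-elim (<⇒≱ 1≤T (≤-trans r (≤-reflexive (*-zeroʳ q)))))))
                    (≤-trans (≤-reflexive (∑-zero X)) z≤n)

    -- The routes that close a path in F must be able to avoid its vertices. For vertices not next
    -- to the end `y` this is ensured by treating richness as a conflict in `R'`; for the one next
    -- to `y`, by deleting the edge.
    F' : Fin n → Fin n → Set
    F' z y = F z y × ¬ Rich (fam y) z

    f'? : ∀ z y → Dec (F' z y)
    f'? z y = f? z y ×-dec ¬? (rich? (fam y) z)

    Ê' : Fin n → Fin n → Set
    Ê' u v = F' u v ⊎ F' v u

    ê'? : ∀ u v → Dec (Ê' u v)
    ê'? u v = f'? u v ⊎-dec f'? v u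

    Ê'-sym : ∀ {u v} → Ê' u v → Ê' v u
    Ê'-sym (inj₁ h) = inj₂ h
    Ê'-sym (inj₂ h) = inj₁ h

    R' : Fin n → Fin n → Set
    R' u v = R u v ⊎ (Rich (fam v) u ⊎ Rich (fam u) v)

    r'? : ∀ u v → Dec (R' u v)
    r'? u v = R? u v ⊎-dec (rich? (fam v) u ⊎-dec rich? (fam u) v)

    R'-sym : ∀ {u v} → R' u v → R' v u
    R'-sym (inj₁ r) = inj₁ (R-sym r)
    R'-sym (inj₂ (inj₁ r)) = inj₂ (inj₂ r)
    R'-sym (inj₂ (inj₂ r)) = inj₂ (inj₁ r)

    module P' = Paths Ê' R' Ê'-sym R'-sym

    IndPath'-++ˡ : ∀ p r → P'.IndPath (p ++ r) → P'.IndPath p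
    IndPath'-++ˡ [] r _ = tt
    IndPath'-++ˡ (a ∷ []) r _ = tt
    IndPath'-++ˡ (a ∷ b ∷ p) r (e , h , ip) = e , All.++⁻ˡ p h , IndPath'-++ˡ (b ∷ p) r ip

    weaken : ∀ l → P'.IndPath l → IndPath l
    weaken [] _ = tt
    weaken (a ∷ []) _ = tt
    weaken (a ∷ b ∷ l) (e , h , ip) = toE e , All.map (_∘ inj₁) h , weaken (b ∷ l) ip
      where
      toE : ∀ {u v} → Ê' u v → E u v
      toE (inj₁ ((_ , h) , _)) = LastEdge.isEdge (lastEdge h)
      toE (inj₂ ((_ , h) , _)) = E-sym (LastEdge.isEdge (lastEdge h))

    -- Walks from `x` change sides at every edge, and the positions `m` and `m + 1` have different
    -- parity.
    notBoth : ∀ {u y z} → 1 ≤ ending z u → 1 ≤ ending u y → ⊥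
    notBoth h h' = Bool.not-¬ {alternate m (side x)} refl (trans (sym (LastEdge.sideᶻ (lastEdge h')))
      (trans (LastEdge.sideʸ (lastEdge h)) (cong (λ r → alternate r (side x)) (sym i≡))))

    -- A walk in Ê' alternates between ends of overfull walks and their penultimate vertices.
    Last : Fin n → Set
    Last y = ∃ λ z → F z y

    orient : ∀ {y z} → Last y → Ê' y z → F' z y
    orient (_ , _ , h) (inj₁ ((_ , h') , _)) = ⊥-elim (notBoth h h')
    orient _ (inj₂ h) = h

    orient₂ : ∀ {y z y'} → F' z y → Ê' z y' → Last y'
    orient₂ _ (inj₁ (h , _)) = _ , h
    orient₂ ((_ , h) , _) (inj₂ ((_ , h') , _)) = ⊥-elim (notBoth h' h)

    last-Last : ∀ t y ys → P'.IndPath (y ∷ ys) → Last y → length ys ≡ t + t → Last (last y ys)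
    last-Last zero y [] _ h _ = h
    last-Last (suc t) y (z ∷ []) _ _ e = ⊥-elim (0≢1+n (suc-injective (trans e (cong suc (+-suc t t)))))
    last-Last (suc t) y (z ∷ y' ∷ ys) (e , _ , ip@(e' , _ , ip')) h len =
      last-Last t y' ys ip' (orient₂ (orient h e) e') (suc-injective (suc-injective (trans len (cong suc (+-suc t t)))))

    poor : ∀ y ys → P'.IndPath (y ∷ ys) → Last y → ∀ {u} → u ∈ ys → ¬ Rich (fam y) u
    poor y (z ∷ ys) (e , h , _) ly (here refl) = proj₂ (orient ly e)
    poor y (z ∷ ys) (e , h , _) ly (there u∈) r = All.lookup h u∈ (inj₂ (inj₂ r))

    apart-all : ∀ y z ys → P'.IndPath (y ∷ z ∷ ys) → ∀ {u} → u ∈ y ∷ z ∷ ys → ¬ R x u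
    apart-all y z ys (e , _ , ip) (here refl) = proj₁ (far e)
      where
      far : ∀ {u v} → Ê' u v → ¬ R x u × ¬ R x v
      far (inj₁ (((¬r , _) , h) , _)) = LastEdge.apart (lastEdge h) , ¬r
      far (inj₂ (((¬r , _) , h) , _)) = ¬r , LastEdge.apart (lastEdge h)
    apart-all y z [] (inj₁ (((¬r , _) , h) , _) , _ , ip) (there (here refl)) = ¬r
    apart-all y z [] (inj₂ ((_ , h) , _) , _ , ip) (there (here refl)) = LastEdge.apart (lastEdge h)
    apart-all y z (v ∷ ys) (e , _ , ip) (there u∈) = apart-all z v ys ip u∈

    -- Two routes with `i` edges each and a path with 2 t edges close up to a cycle of length 2 (i +
    -- t) = 2 k.
    closeUp : ∀ y ys → P'.IndPath (y ∷ ys) → Last y → length ys ≡ t + t → ⊥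
    closeUp y [] ip ly len = <⇒≱ 1≤t (≤-trans (m≤m+n t t) (≤-reflexive (sym len)))
    closeUp y (z ∷ ys) ip ly len = joined (snocView-last y (z ∷ ys))
      where
      y' : Fin n
      y' = last y (z ∷ ys)
      ly' : Last y'
      ly' = last-Last t y (z ∷ ys) ip ly len
      m≡ : ∃ λ m' → m ≡ suc m'
      m≡ = go m 2≤m
        where
        go : ∀ m → 2 ≤ m → ∃ λ m' → m ≡ suc m'
        go (suc m') _ = m' , refl
      2k : 2 * k ≡ 1 + (m + (suc (length (z ∷ ys)) + m))
      2k = trans (cong (2 *_) (trans (sym i+t) (cong (_+ t) (sym i≡)))) (trans (ring m t) (cong (λ r → 1 + (m + (suc r + m))) (sym len)))
        where
        ring : ∀ m t → 2 * (1 + m + t) ≡ 1 + (m + (1 + (t + t) + m))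
        ring = solve-∀
      len≤ : length (z ∷ ys) ≤ 2 * k
      len≤ = ≤-trans (≤-reflexive (trans len (cong (t +_) (sym (+-identityʳ t))))) (*-monoʳ-≤ 2 (≤-trans (m≤n+m t i) (≤-reflexive i+t)))
      joined : (∃ λ ms → y ∷ z ∷ ys ≡ ms ++ y' ∷ []) → ⊥
      joined (ms , eq) = close (2 * k) (proj₁ m≡) x y (z ∷ ys) ms y' (fam y) (fam y') eq (weaken (y ∷ z ∷ ys) ip) (apart-all y z ys ip)
        (subst (λ r → PathFamily r x y (fam y)) (proj₂ m≡) (proj₁ (fam-routes (proj₁ (proj₂ ly)))))
        (subst (λ r → PathFamily r x y' (fam y')) (proj₂ m≡) (proj₁ (fam-routes (proj₁ (proj₂ ly')))))
        (poor y (z ∷ ys) ip ly)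
        (λ u∈ → poor y' (reverse ms) (subst P'.IndPath (trans (cong reverse eq) (reverse-++ ms (y' ∷ []))) (P'.IndPath-reverse (y ∷ z ∷ ys) ip)) ly' (reverse⁺ u∈))
        len≤ q≥ T> (trans 2k (cong (λ r → 1 + (r + (suc (length (z ∷ ys)) + r))) (proj₂ m≡)))

    -- One of the first two vertices is an overfull partner of `x`. At least 2 k - 1 edges follow
    -- it, and 2 t ≤ 2 k - 1 because i ≥ 1.
    closeWalk : ∀ L → length L ≡ suc (2 * k) → P'.IndPath L → ⊥
    closeWalk (u ∷ []) len _ = <⇒≱ (≤-trans 1≤t (≤-trans (m≤n+m t i) (≤-reflexive i+t))) (≤-trans (m≤m+n k (k + 0)) (≤-reflexive (sym (suc-injective len))))
    closeWalk (u ∷ v ∷ L) len ip@(e , _ , ip') = start e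
      where
      tt≤ : suc (t + t) ≤ 2 * k
      tt≤ = ≤-trans (≤-trans (s≤s (m≤n+m (t + t) (i + i ∸ 1))) (≤-reflexive eq)) (≤-reflexive (cong (2 *_) i+t))
        where
        eq : suc (i + i ∸ 1 + (t + t)) ≡ 2 * (i + t)
        eq = subst (λ i → suc (i + i ∸ 1 + (t + t)) ≡ 2 * (i + t)) i≡ (ring m t)
          where
          ring : ∀ m t → 1 + (m + (1 + m) + (t + t)) ≡ 2 * (1 + m + t)
          ring = solve-∀
      cutAt : ∀ y l → P'.IndPath (y ∷ l) → Last y → t + t ≤ length l → ⊥
      cutAt y l ip ly le = closeUp y (take (t + t) l) (IndPath'-++ˡ (y ∷ take (t + t) l) (drop (t + t) l)
        (subst P'.IndPath (cong (y ∷_) (sym (take++drop≡id (t + t) l))) ip)) ly (length-take-≤ (t + t) le)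
      start : Ê' u v → ⊥
      start (inj₁ (h , _)) = cutAt v L ip' (_ , h) (≤-pred (≤-trans tt≤ (≤-reflexive (sym (suc-injective len)))))
      start (inj₂ (h , _)) = cutAt u (v ∷ L) ip (_ , h) (≤-trans (n≤1+n (t + t)) (≤-trans tt≤ (≤-reflexive (sym (suc-injective len)))))

    V : List (Fin n)
    V = allFin n

    Penultimate : Fin n → Set
    Penultimate z = Any (λ y → F z y) V

    penultimate? : ∀ z → Dec (Penultimate z)
    penultimate? z = any? (λ y → f? z y) V

    #F #Z #Y : ℕ
    #F = ∑ᶠ λ y → ∑ᶠ λ z → 𝟙 (f? z y)
    #Z = ∑ᶠ λ z → 𝟙 (penultimate? z)
    #Y = ∑ᶠ λ y → 𝟙 (overfull? i x y)

    zOf : List (Fin n) → Fin n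
    zOf [] = x
    zOf (a ∷ P) = last a P

    route-ending : ∀ {y P} → Route i x y P → zOf P ∈ P × 1 ≤ ending (zOf P) y
    route-ending {y} (route a b [] walk start end refl len) = ⊥-elim (<⇒≱ 2≤m (≤-trans (≤-reflexive (suc-injective (trans i≡ (sym len)))) z≤n))
    route-ending {y} (route a b (u ∷ p) walk start end refl len) = last-∈ (π u) (map π p) ,
      subst (λ r → 1 ≤ ∑ᴸ U r count) lenl (≤-trans (𝟙≡1 ((ls? i l ×-dec ends? x y l) ×-dec labelAt? m z l) ((walk , start , trans (cong π (last-++ a (u ∷ p) b)) end) , lab)) (∑ᴸ-∈ l count))
      where
      z : Fin n
      z = last (π u) (map π p)
      l : List (Fin N)
      l = a ∷ (u ∷ p) ++ b ∷ []
      count : List (Fin N) → ℕ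
      count l = 𝟙 ((ls? i l ×-dec ends? x y l) ×-dec labelAt? m z l)
      lenl : length l ≡ suc i
      lenl = cong suc (trans (length-++ (u ∷ p)) (trans (+-comm (length (u ∷ p)) 1) len))
      last-map : ∀ u p → π (last u p) ≡ last (π u) (map π p)
      last-map u [] = refl
      last-map u (v ∷ p) = last-map v p
      labelLast : ∀ u p s → LabelAt (length p) (π (last u p)) (u ∷ p ++ s)
      labelLast u [] s = refl
      labelLast u (v ∷ p) s = labelLast v p s
      lab : LabelAt m z l
      lab = subst₂ (λ r w → LabelAt r w l) (suc-injective (trans len (sym i≡))) (last-map u p) (labelLast u p (b ∷ []))

    -- The `T` disjoint routes to an overfull partner have `T` different penultimate vertices.
    Y-degrees : ∀ y → T * 𝟙 (overfull? i x y) ≤ ∑ᶠ λ z → 𝟙 (f? z y)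
    Y-degrees y = go (overfull? i x y)
      where
      open ≤-Reasoning
      go : (o? : Dec (Overfull i x y)) → T * 𝟙 o? ≤ ∑ᶠ λ z → 𝟙 (f? z y)
      go (no _) = ≤-trans (≤-reflexive (*-zeroʳ T)) z≤n
      go (yes h) = begin
        T * 1 ≡⟨ cong (_* 1) (trans (sym (Family.size (PathFamily.family (proj₁ F₀)))) (sym (length-map zOf 𝓟))) ⟩
        length (map zOf 𝓟) * 1 ≡⟨ sym (∑-const (map zOf 𝓟) 1) ⟩
        ∑ (map zOf 𝓟) (λ _ → 1) ≤⟨ ∑-mono∈ (map zOf 𝓟) (λ z z∈ → isF z z∈) ⟩
        ∑ (map zOf 𝓟) (λ z → 𝟙 (f? z y))
          ≤⟨ ∑-unique-≤ (map zOf 𝓟) (representatives zOf 𝓟 (λ P∈ → proj₁ (route-ending (proj₂ F₀ P∈)))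
                                                    (Family.disjoint (PathFamily.family (proj₁ F₀)))) (λ z → 𝟙 (f? z y)) ⟩
        ∑ᶠ (λ z → 𝟙 (f? z y)) ∎
        where
        𝓟 : List (List (Fin n))
        𝓟 = fam y
        F₀ : RouteFamily i m x y 𝓟
        F₀ = fam-routes h
        isF : ∀ z → z ∈ map zOf 𝓟 → 1 ≤ 𝟙 (f? z y)
        isF z z∈ = let P , P∈ , eq = ∈-map⁻ zOf z∈ in
          𝟙≡1 (f? z y) (h , subst (λ z → 1 ≤ ending z y) (sym eq) (proj₂ (route-ending (proj₂ F₀ P∈))))

    Active : Fin n → Set
    Active u = Penultimate u ⊎ Overfull i x u

    active? : ∀ u → Dec (Active u)
    active? u = penultimate? u ⊎-dec overfull? i x u

    Ê'⇒active : ∀ {u v} → Ê' u v → Active u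
    Ê'⇒active {v = v} (inj₁ (h , _)) = inj₁ (any-∈ (∈-allFin v) h)
    Ê'⇒active (inj₂ ((h , _) , _)) = inj₂ h

    e' #A : ℕ
    e' = ∑ᶠ λ u → ∑ᶠ λ v → 𝟙 (ê'? u v)
    #A = ∑ᶠ λ u → 𝟙 (active? u)

    D-pos : 1 ≤ D
    D-pos = ≤-trans (*-mono-≤ {1} {4} (s≤s z≤n) (*-mono-≤ {1} {suc j} (s≤s z≤n) (*-mono-≤ {1} {2} (s≤s z≤n) 1≤θ))) (≤-reflexive (sym D≡))

    -- On top of `pairs-≤`, each vertex has at most `M` vertices rich for its family; the two
    -- directions together add at most 2 M D pairs.
    r'-pairs : ∀ qq X Y → Unique X → Unique Y → length X ≤ D → length Y ≤ D →
               qq * ∑ X (λ u → ∑ Y λ v → 𝟙 (r'? u v)) ≤ D * D + qq * ((pairConst S qq + 2 * M) * D)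
    r'-pairs qq X Y uX uY lX lY = begin
      qq * ∑ X (λ u → ∑ Y λ v → 𝟙 (r'? u v))
        ≤⟨ *-monoʳ-≤ qq split ⟩
      qq * (∑ X (λ u → ∑ Y λ v → 𝟙 (R? u v)) + (M * D + M * D))
        ≡⟨ *-distribˡ-+ qq _ _ ⟩
      qq * ∑ X (λ u → ∑ Y λ v → 𝟙 (R? u v)) + qq * (M * D + M * D)
        ≤⟨ +-monoˡ-≤ _ (pairs-≤ 1≤S kfree qq D X Y uX uY lX lY) ⟩
      D * D + qq * (pairConst S qq * D) + qq * (M * D + M * D)
        ≡⟨ ring (D * D) qq (pairConst S qq) D M ⟩
      D * D + qq * ((pairConst S qq + 2 * M) * D) ∎
      where
      open ≤-Reasoning
      ring : ∀ a q p d m → a + q * (p * d) + q * (m * d + m * d) ≡ a + q * ((p + 2 * m) * d)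
      ring = solve-∀
      rows : ∀ Z W → Unique W → length Z ≤ D → ∑ Z (λ y → ∑ W λ v → 𝟙 (rich? (fam y) v)) ≤ M * D
      rows Z W uW lZ = ≤-trans (∑-≤-const Z M (λ y _ → ≤-trans (rich-≤ y W uW) (≤-trans (*-monoʳ-≤ M (𝟙≤1 (overfull? i x y))) (≤-reflexive (*-identityʳ M)))))
        (≤-trans (*-monoˡ-≤ M lZ) (≤-reflexive (*-comm D M)))
      split : ∑ X (λ u → ∑ Y λ v → 𝟙 (r'? u v)) ≤ ∑ X (λ u → ∑ Y λ v → 𝟙 (R? u v)) + (M * D + M * D)
      split = begin
        ∑ X (λ u → ∑ Y λ v → 𝟙 (r'? u v))
          ≤⟨ ∑-mono X (λ u → ∑-mono Y λ v → ≤-trans (𝟙-⊎ (r'? u v) (R? u v) (rich? (fam v) u ⊎-dec rich? (fam u) v) (λ r → r))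
               (+-monoʳ-≤ (𝟙 (R? u v)) (𝟙-⊎ (rich? (fam v) u ⊎-dec rich? (fam u) v) (rich? (fam v) u) (rich? (fam u) v) (λ r → r)))) ⟩
        ∑ X (λ u → ∑ Y λ v → 𝟙 (R? u v) + (𝟙 (rich? (fam v) u) + 𝟙 (rich? (fam u) v)))
          ≡⟨ trans (∑-cong X λ u → ∑-+ Y (λ v → 𝟙 (R? u v)) (λ v → 𝟙 (rich? (fam v) u) + 𝟙 (rich? (fam u) v)))
                   (∑-+ X (λ u → ∑ Y λ v → 𝟙 (R? u v)) (λ u → ∑ Y λ v → 𝟙 (rich? (fam v) u) + 𝟙 (rich? (fam u) v))) ⟩
        ∑ X (λ u → ∑ Y λ v → 𝟙 (R? u v)) + ∑ X (λ u → ∑ Y λ v → 𝟙 (rich? (fam v) u) + 𝟙 (rich? (fam u) v))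
          ≡⟨ cong (∑ X (λ u → ∑ Y λ v → 𝟙 (R? u v)) +_) (trans (∑-cong X λ u → ∑-+ Y (λ v → 𝟙 (rich? (fam v) u)) (λ v → 𝟙 (rich? (fam u) v)))
                   (∑-+ X (λ u → ∑ Y λ v → 𝟙 (rich? (fam v) u)) (λ u → ∑ Y λ v → 𝟙 (rich? (fam u) v)))) ⟩
        ∑ X (λ u → ∑ Y λ v → 𝟙 (R? u v)) + (∑ X (λ u → ∑ Y λ v → 𝟙 (rich? (fam v) u)) + ∑ X (λ u → ∑ Y λ v → 𝟙 (rich? (fam u) v)))
          ≤⟨ +-monoʳ-≤ (∑ X (λ u → ∑ Y λ v → 𝟙 (R? u v))) (+-mono-≤
               (≤-trans (≤-reflexive (∑-swap X Y (λ u v → 𝟙 (rich? (fam v) u)))) (rows Y X uX lY)) (rows X Y uY lX)) ⟩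
        ∑ X (λ u → ∑ Y λ v → 𝟙 (R? u v)) + (M * D + M * D) ∎

    -- With more edges than this, `Build` yields a cover of degree `D`, and `freeWalk` finds a
    -- conflict-free path on 2 k + 1 vertices, which `closeWalk` excludes.
    e'-few : e' ≤ 4 * (D * #A)
    e'-few = ≮⇒≥ λ lt → dense⇒⊥ (<⇒≤ lt) (≤-trans (s≤s z≤n) lt)
      where
      dense⇒⊥ : 4 * (D * #A) ≤ e' → 1 ≤ e' → ⊥
      dense⇒⊥ h 1≤e' = done (FreeWalk.freeWalk cov Ê'-sym R' r'? R'-sym j θ (pairConst S qq + 2 * M) D≡ 1≤θ 1≤e' (r'-pairs qq) κ≤)
        where
        qq : ℕ
        qq = densityConst (suc j) (8 * suc j)
        cov : Cover Ê' ê'? D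
        cov = Build.cover Ê' ê'? Ê'-sym Active active? Ê'⇒active D D-pos h
        done : (∃ λ L → length L ≡ 2 + j × P'.IndPath L) → ⊥
        done (L , len , ip) = closeWalk L (trans len (cong suc j≡)) ip

    -- Each partner has degree at least `T` in F, which is at least twice its share 4 D + M in the
    -- upper bound. Partners thus account for at most half of F, and penultimate vertices alone
    -- bound the other half.
    F-few : #F ≤ 8 * D * #Z
    F-few = +-cancelʳ-≤ #F #F (8 * D * #Z) (begin
      #F + #F ≡⟨ cong (#F +_) (sym (+-identityʳ #F)) ⟩
      2 * #F ≤⟨ *-monoʳ-≤ 2 edges ⟩
      2 * (4 * (D * (#Z + #Y)) + M * #Y) ≡⟨ ring D #Z #Y M ⟩
      8 * D * #Z + 2 * (4 * D + M) * #Y ≤⟨ +-monoʳ-≤ (8 * D * #Z) (*-monoˡ-≤ #Y T≥) ⟩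
      8 * D * #Z + T * #Y
        ≤⟨ +-monoʳ-≤ (8 * D * #Z) (≤-trans (≤-reflexive (sym (∑-*ˡ V T (λ y → 𝟙 (overfull? i x y))))) (∑-mono V Y-degrees)) ⟩
      8 * D * #Z + #F ∎)
      where
      open ≤-Reasoning
      ring : ∀ D Z Y M → 2 * (4 * (D * (Z + Y)) + M * Y) ≡ 8 * D * Z + 2 * (4 * D + M) * Y
      ring = solve-∀
      notRich : #F ≤ ∑ᶠ (λ y → ∑ᶠ λ z → 𝟙 (f'? z y)) + M * #Y
      notRich = begin
        #F
          ≤⟨ ∑-mono V (λ y → ≤-trans (∑-mono V (λ z → 𝟙-⊎ (f? z y) (f'? z y) (rich? (fam y) z) (decide y z)))
               (≤-trans (≤-reflexive (∑-+ V (λ z → 𝟙 (f'? z y)) (λ z → 𝟙 (rich? (fam y) z)))) (+-monoʳ-≤ (∑ᶠ λ z → 𝟙 (f'? z y)) (rich-≤ y V (Unique.allFin⁺ n))))) ⟩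
        ∑ᶠ (λ y → ∑ᶠ (λ z → 𝟙 (f'? z y)) + M * 𝟙 (overfull? i x y))
          ≡⟨ ∑-+ V (λ y → ∑ᶠ (λ z → 𝟙 (f'? z y))) (λ y → M * 𝟙 (overfull? i x y)) ⟩
        ∑ᶠ (λ y → ∑ᶠ λ z → 𝟙 (f'? z y)) + ∑ᶠ (λ y → M * 𝟙 (overfull? i x y))
          ≡⟨ cong (∑ᶠ (λ y → ∑ᶠ λ z → 𝟙 (f'? z y)) +_) (∑-*ˡ V M (λ y → 𝟙 (overfull? i x y))) ⟩
        ∑ᶠ (λ y → ∑ᶠ λ z → 𝟙 (f'? z y)) + M * #Y ∎
        where
        decide : ∀ y z → F z y → F' z y ⊎ Rich (fam y) z
        decide y z h = go (rich? (fam y) z)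
          where
          go : Dec (Rich (fam y) z) → F' z y ⊎ Rich (fam y) z
          go (yes r) = inj₂ r
          go (no ¬r) = inj₁ (h , ¬r)
      active-≤ : #A ≤ #Z + #Y
      active-≤ = ≤-trans (∑-mono V (λ u → 𝟙-⊎ (active? u) (penultimate? u) (overfull? i x u) (λ a → a)))
        (≤-reflexive (∑-+ V (λ u → 𝟙 (penultimate? u)) (λ u → 𝟙 (overfull? i x u))))
      edges : #F ≤ 4 * (D * (#Z + #Y)) + M * #Y
      edges = ≤-trans notRich (+-monoˡ-≤ (M * #Y) (≤-trans (∑-mono V (λ y → ∑-mono V λ z → 𝟙-mono (f'? z y) (ê'? y z) inj₂))
        (≤-trans e'-few (*-monoʳ-≤ 4 (*-monoʳ-≤ D active-≤)))))

    starting : ℕ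
    starting = ∑ᴸ U i λ l → 𝟙 (walk? l ×-dec labelAt? 0 x l)

    LabelAt-unique : ∀ a {w w'} l → LabelAt a w l → LabelAt a w' l → w ≡ w'
    LabelAt-unique zero (v ∷ l) e e' = trans (sym e) e'
    LabelAt-unique (suc a) (v ∷ l) h h' = LabelAt-unique a l h h'

    Z-few : #Z ≤ starting
    Z-few = begin
      #Z
        ≤⟨ ∑-mono V (λ z → 𝟙-≤ (penultimate? z) (one z)) ⟩
      ∑ᶠ (λ z → ∑ᴸ U i λ l → 𝟙 ((walk? l ×-dec labelAt? 0 x l) ×-dec labelAt? m z l))
        ≡⟨ sym (∑ᴸ-∑ U i V (λ l z → 𝟙 ((walk? l ×-dec labelAt? 0 x l) ×-dec labelAt? m z l))) ⟩
      ∑ᴸ U i (λ l → ∑ᶠ λ z → 𝟙 ((walk? l ×-dec labelAt? 0 x l) ×-dec labelAt? m z l))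
        ≤⟨ ∑ᴸ-mono U i (λ l _ → perList l) ⟩
      starting ∎
      where
      open ≤-Reasoning
      one : ∀ z → Penultimate z → 1 ≤ ∑ᴸ U i λ l → 𝟙 ((walk? l ×-dec labelAt? 0 x l) ×-dec labelAt? m z l)
      one z pz = go (LastEdge.stub (lastEdge (proj₂ (proj₂ (satisfied pz)))))
        where
        f : List (Fin N) → ℕ
        f l = 𝟙 ((walk? l ×-dec labelAt? 0 x l) ×-dec labelAt? m z l)
        go : (∃ λ l → length l ≡ i × (Walk l × LabelAt 0 x l) × LabelAt m z l) → 1 ≤ ∑ᴸ U i f
        go (l , len , h) = subst (λ r → 1 ≤ ∑ᴸ U r f) len (≤-trans (𝟙≡1 ((walk? l ×-dec labelAt? 0 x l) ×-dec labelAt? m z l) h) (∑ᴸ-∈ l f))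
      perList : ∀ l → ∑ᶠ (λ z → 𝟙 ((walk? l ×-dec labelAt? 0 x l) ×-dec labelAt? m z l)) ≤ 𝟙 (walk? l ×-dec labelAt? 0 x l)
      perList l = ≤-trans (≤-reflexive (trans (∑-cong V (λ z → 𝟙-×-dec (walk? l ×-dec labelAt? 0 x l) (labelAt? m z l)))
          (∑-*ˡ V (𝟙 (walk? l ×-dec labelAt? 0 x l)) (λ z → 𝟙 (labelAt? m z l)))))
        (≤-trans (*-monoʳ-≤ (𝟙 (walk? l ×-dec labelAt? 0 x l)) (∑-≤1 V (λ z → 𝟙 (labelAt? m z l)) (Unique.allFin⁺ n) (λ z → 𝟙≤1 (labelAt? m z l))
          (λ {z} {z'} h h' → LabelAt-unique m l (𝟙-elim (labelAt? m z l) h) (𝟙-elim (labelAt? m z' l) h')))) (≤-reflexive (*-identityʳ _)))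

    -- Each edge of F is the last edge of at most c(m) c(1) of the walks, and by `F-few` and `Z-few`
    -- the number of edges is a bounded multiple of `starting`. The trivial bound would have a
    -- factor `d` in place of this constant.
    overfull-few : ∑ᶠ (λ y → 𝟙 (overfull? i x y) * cnt i x y) ≤ 8 * D * (c m * c 1) * starting
    overfull-few = begin
      ∑ᶠ (λ y → 𝟙 (overfull? i x y) * cnt i x y)
        ≤⟨ ∑-mono V (λ y → *-monoʳ-≤ (𝟙 (overfull? i x y)) (byEnding y)) ⟩
      ∑ᶠ (λ y → 𝟙 (overfull? i x y) * ∑ᶠ λ z → ending z y)
        ≡⟨ ∑-cong V (λ y → sym (∑-*ˡ V (𝟙 (overfull? i x y)) (λ z → ending z y))) ⟩
      ∑ᶠ (λ y → ∑ᶠ λ z → 𝟙 (overfull? i x y) * ending z y)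
        ≤⟨ ∑-mono V (λ y → ∑-mono V λ z → perPair y z) ⟩
      ∑ᶠ (λ y → ∑ᶠ λ z → 𝟙 (f? z y) * (c m * c 1))
        ≡⟨ trans (∑-cong V (λ y → ∑-*ʳ V (c m * c 1) (λ z → 𝟙 (f? z y)))) (∑-*ʳ V (c m * c 1) (λ y → ∑ᶠ λ z → 𝟙 (f? z y))) ⟩
      #F * (c m * c 1)
        ≤⟨ *-monoˡ-≤ (c m * c 1) (≤-trans F-few (*-monoʳ-≤ (8 * D) Z-few)) ⟩
      8 * D * starting * (c m * c 1)
        ≡⟨ ring (8 * D) starting (c m * c 1) ⟩
      8 * D * (c m * c 1) * starting ∎
      where
      open ≤-Reasoning
      ring : ∀ a b c → a * b * c ≡ a * c * b
      ring = solve-∀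
      labelled : ∀ l r → r < length l → ∃ λ z → LabelAt r z l
      labelled (v ∷ l) zero _ = π v , refl
      labelled (v ∷ l) (suc r) (s≤s h) = labelled l r h
      byEnding : ∀ y → cnt i x y ≤ ∑ᶠ λ z → ending z y
      byEnding y = ≤-trans (∑ᴸ-mono U (suc i) perList)
        (≤-reflexive (∑ᴸ-∑ U (suc i) V (λ l z → 𝟙 ((ls? i l ×-dec ends? x y l) ×-dec labelAt? m z l))))
        where
        perList : ∀ l → length l ≡ suc i → 𝟙 (ls? i l ×-dec ends? x y l) ≤ ∑ᶠ λ z → 𝟙 ((ls? i l ×-dec ends? x y l) ×-dec labelAt? m z l)
        perList l len = 𝟙-≤ (ls? i l ×-dec ends? x y l) λ h →
          let z , lab = labelled l m (≤-trans (≤-trans (≤-reflexive i≡) (n≤1+n i)) (≤-reflexive (sym len))) in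
          ≤-trans (𝟙≡1 ((ls? i l ×-dec ends? x y l) ×-dec labelAt? m z l) (h , lab))
            (∑ᶠ-∈ (λ z → 𝟙 ((ls? i l ×-dec ends? x y l) ×-dec labelAt? m z l)) z)
      perPair : ∀ y z → 𝟙 (overfull? i x y) * ending z y ≤ 𝟙 (f? z y) * (c m * c 1)
      perPair y z = go (overfull? i x y) (1 ≤? ending z y)
        where
        go : (o? : Dec (Overfull i x y)) (p? : Dec (1 ≤ ending z y)) → 𝟙 o? * ending z y ≤ 𝟙 (o? ×-dec p?) * (c m * c 1)
        go (no _) _ = z≤n
        go (yes _) (yes _) = *-monoʳ-≤ 1 (ending-≤ z y)
        go (yes _) (no ¬p) = ≤-trans (≤-reflexive (*-identityˡ _)) (≤-trans (≤-pred (≰⇒> ¬p)) z≤n)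

-- The main count

AllPairs-lookup : ∀ {A : Set} {P : A → A → Set} {l : List A} → AllPairs P l → ∀ {i j} → i ≢ j →
                  P (lookup l i) (lookup l j) ⊎ P (lookup l j) (lookup l i)
AllPairs-lookup (h ∷ hs) {zero} {zero} ne = ⊥-elim (ne refl)
AllPairs-lookup (h ∷ hs) {zero} {suc j} ne = inj₁ (All.lookup h (∈-lookup j))
AllPairs-lookup (h ∷ hs) {suc i} {zero} ne = inj₂ (All.lookup h (∈-lookup i))
AllPairs-lookup (h ∷ hs) {suc i} {suc j} ne = AllPairs-lookup hs (ne ∘ cong suc)

module Final {n : ℕ} (E R : Fin n → Fin n → Set) (E? : ∀ u v → Dec (E u v)) (R? : ∀ u v → Dec (R u v))
             (E-sym : ∀ {u v} → E u v → E v u) (R-sym : ∀ {u v} → R u v → R v u) (R-refl : ∀ {v} → R v v)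
             (side : Fin n → Bool) (E-side : ∀ {u v} → E u v → side u ≡ not (side v))
             {S : ℕ} (1≤S : 1 ≤ S) (kfree : KFree S R)
             (q w T : ℕ) (1≤q : 1 ≤ q) (1≤w : 1 ≤ w) (T-rich : richThreshold S q w < T) (k : ℕ)
             (noCycle : ∀ x a mid b → 2 * k ≡ 3 + length mid → ¬ Paths.Cycle E R E-sym R-sym x a mid b)
             (k≤w : k ≤ w) (q≥ : 2 * (2 * k + 0 + w * 2) ≤ q) (T> : 2 * (2 * (q * w * S)) < T)
             (c : ℕ → ℕ) (1≤c : ∀ i → 1 ≤ c i) (c-mono : ∀ {a i} → a ≤ i → c a ≤ c i)
             (c-step : ∀ m → T * m * (m * (c m * c m)) ≤ c (suc m))
             {d : ℕ} (C : Cover E E? d)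
             (j : ℕ) (j≡ : suc j ≡ 2 * k) (φ : ℕ) (1≤φ : 1 ≤ φ) (D : ℕ) (D≡ : D ≡ 4 * (suc j * (2 * φ)))
             (κ≤ : densityConst (suc j) (8 * suc j) * (pairConst S (densityConst (suc j) (8 * suc j)) + 2 * (q * w * S)) ≤ D)
             (T≥ : 2 * (4 * D + q * w * S) ≤ T)
             (k₀ : ℕ) (k≡ : k ≡ suc k₀) (1≤k₀ : 1 ≤ k₀)
             (star : ℕ) (star> : k * (k + k * (k * (q * w * S))) < star)
             (q≥' : 2 * (k + 0 + w * k) ≤ q) (T>' : 2 * (k * (q * w * S)) < T)
             (two : ℕ) (two≡ : 2 ≡ two)
             (θ : ℕ) (1≤θ : 1 ≤ θ) (d≡ : d ≡ 4 * (suc k₀ * (star * θ)))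
             (K≤ : densityConst (suc k₀) (4 * (suc k₀ * star)) * (pairConst S (densityConst (suc k₀) (4 * (suc k₀ * star))) + 8 * D * (c k * c k)) ≤ d) where

  open Heavy E R E? R? E-sym R-sym R-refl side E-side 1≤S kfree q w T 1≤q 1≤w T-rich k noCycle k≤w q≥ T> c 1≤c c-mono c-step C

  V : List (Fin n)
  V = allFin n

  cnt-two : ∀ i x y → 2 ≡ i → cnt i x y ≤ length (common x y) * (c 1 * c 1)
  cnt-two i x y i≡ = begin
    cnt i x y
      ≤⟨ ∑ᴸ-mono U (suc i) perList ⟩
    ∑ᴸ U (suc i) (λ l → ∑ᶠ λ z → 𝟙 ((ls? i l ×-dec ends? x y l) ×-dec labelAt? 1 z l))
      ≡⟨ ∑ᴸ-∑ U (suc i) V (λ l z → 𝟙 ((ls? i l ×-dec ends? x y l) ×-dec labelAt? 1 z l)) ⟩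
    ∑ᶠ (λ z → via z)
      ≤⟨ ∑-mono V perLabel ⟩
    ∑ᶠ (λ z → 𝟙 (E? x z ×-dec E? z y) * (c 1 * c 1))
      ≡⟨ ∑-*ʳ V (c 1 * c 1) (λ z → 𝟙 (E? x z ×-dec E? z y)) ⟩
    ∑ᶠ (λ z → 𝟙 (E? x z ×-dec E? z y)) * (c 1 * c 1)
      ≡⟨ cong (_* (c 1 * c 1)) (sym (count-filter (λ z → E? x z ×-dec E? z y) V)) ⟩
    length (common x y) * (c 1 * c 1) ∎
    where
    open ≤-Reasoning
    via : Fin n → ℕ
    via z = ∑ᴸ U (suc i) λ l → 𝟙 ((ls? i l ×-dec ends? x y l) ×-dec labelAt? 1 z l)
    second : ∀ l → length l ≡ suc i → ∃ λ z → LabelAt 1 z l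
    second (a ∷ []) e = ⊥-elim (0≢1+n (trans (suc-injective e) (sym i≡)))
    second (a ∷ b ∷ l) _ = π b , refl
    perList : ∀ l → length l ≡ suc i → 𝟙 (ls? i l ×-dec ends? x y l) ≤ ∑ᶠ λ z → 𝟙 ((ls? i l ×-dec ends? x y l) ×-dec labelAt? 1 z l)
    perList l e = 𝟙-≤ (ls? i l ×-dec ends? x y l) λ h →
      let z , lab = second l e in ≤-trans (𝟙≡1 ((ls? i l ×-dec ends? x y l) ×-dec labelAt? 1 z l) (h , lab))
        (∑ᶠ-∈ (λ z → 𝟙 ((ls? i l ×-dec ends? x y l) ×-dec labelAt? 1 z l)) z)
    edges : ∀ z → (∃ λ l → length l ≡ suc i × 0 < 𝟙 ((ls? i l ×-dec ends? x y l) ×-dec labelAt? 1 z l)) → E x z × E z y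
    edges z (l , len , lt) = shape l len (𝟙-elim ((ls? i l ×-dec ends? x y l) ×-dec labelAt? 1 z l) lt)
      where
      fromWalk : ∀ a b e → Walk (a ∷ b ∷ e ∷ []) → π a ≡ x → π e ≡ y → π b ≡ z → E x z × E z y
      fromWalk a b e (h , h' , _) refl refl refl = edge h , edge h'
      shape : ∀ l → length l ≡ suc i → (LS i l × Ends x y l) × LabelAt 1 z l → E x z × E z y
      shape (a ∷ []) len _ = ⊥-elim (0≢1+n (trans (suc-injective len) (sym i≡)))
      shape (a ∷ b ∷ []) len _ = ⊥-elim (0≢1+n (suc-injective (trans (suc-injective len) (sym i≡))))
      shape (a ∷ b ∷ e ∷ []) len ((ls , (ea , ee)) , lab) = fromWalk a b e (LS⇒Walk i (a ∷ b ∷ e ∷ []) ls) ea ee lab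
      shape (a ∷ b ∷ e ∷ f ∷ l) len _ = ⊥-elim (1+n≢0 (suc-injective (suc-injective (trans (suc-injective len) (sym i≡)))))
    perLabel : ∀ z → via z ≤ 𝟙 (E? x z ×-dec E? z y) * (c 1 * c 1)
    perLabel z = bounded-if-positive λ pos → ≤-trans (through' i 1 1 x z y i≡ (s≤s z≤n) (s≤s z≤n))
      (≤-trans (≤-reflexive (sym (*-identityˡ _))) (*-monoˡ-≤ (c 1 * c 1) (𝟙≡1 (E? x z ×-dec E? z y)
        (edges z (∑ᴸ-<⇒∃ U (suc i) (λ _ → 0) (λ l → 𝟙 ((ls? i l ×-dec ends? x y l) ×-dec labelAt? 1 z l))
          (≤-trans (s≤s (≤-reflexive (trans (∑ᴸ-const U (suc i) 0) (*-zeroʳ (length U ^ suc i))))) pos))))))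

  -- By `cnt-two`, each common neighbour accounts for at most c(1)² walks, and c(2) ≥ T c(1)² by
  -- `c-step`.
  popular : ∀ {x y} → Overfull two x y → T ≤ length (common x y)
  popular {x} {y} (_ , h) = <⇒≤ (*-cancelʳ-< (c 1 * c 1) T (length (common x y)) (≤-<-trans
    (≤-trans (≤-reflexive (ring T (c 1))) (≤-trans (c-step 1) (≤-reflexive (cong c two≡))))
    (<-≤-trans h (cnt-two two x y two≡))))
    where
    ring : ∀ T a → T * (a * a) ≡ T * 1 * (1 * (a * a))
    ring = solve-∀

  common-sym : ∀ x y → length (common x y) ≤ length (common y x)
  common-sym x y = ≤-trans (≤-reflexive (count-filter (λ z → E? x z ×-dec E? z y) V))
    (≤-trans (∑-mono V (λ z → 𝟙-mono (E? x z ×-dec E? z y) (E? y z ×-dec E? z x) λ { (e , e') → E-sym e' , E-sym e }))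
      (≤-reflexive (sym (count-filter (λ z → E? y z ×-dec E? z x) V))))

  -- Overfull pairs at length 2 are avoided while the walks are built. Nothing makes them a small
  -- proportion, so they cannot be discarded by counting as the faults below are.
  Allowed : Fin N → Fin N → Fin N → Set
  Allowed u v w = ¬ Overfull two (π u) (π w)

  allowed? : ∀ u v w → Dec (Allowed u v w)
  allowed? u v w = ¬? (overfull? two (π u) (π w))

  noLargeForbidden : ∀ v X → length X ≡ star → Unique X → (∀ {u} → u ∈ X → Ê v u) → ¬ AllPairs (λ u w → ¬ Allowed u v w) X
  noLargeForbidden v X len _ _ forb = Star.star-⊥ (λ i → π (lookup X i)) apart popular' (≤-trans star> (≤-reflexive (sym len))) q≥' T>'
      (≤-trans (s≤s 1≤k₀) (≤-reflexive (sym k≡)))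
    where
    stable : ∀ {x y} → ¬ ¬ Overfull two x y → Overfull two x y
    stable {x} {y} = decidable-stable (overfull? two x y)
    apart : ∀ {i i'} → i ≢ i' → ¬ R (π (lookup X i)) (π (lookup X i'))
    apart ne = go (AllPairs-lookup forb ne)
      where
      go : ∀ {x y} → ¬ ¬ Overfull two x y ⊎ ¬ ¬ Overfull two y x → ¬ R x y
      go (inj₁ h) = proj₁ (stable h)
      go (inj₂ h) r = proj₁ (stable h) (R-sym r)
    popular' : ∀ {i i'} → i ≢ i' → T ≤ length (common (π (lookup X i)) (π (lookup X i')))
    popular' ne = go (AllPairs-lookup forb ne)
      where
      go : ∀ {x y} → ¬ ¬ Overfull two x y ⊎ ¬ ¬ Overfull two y x → T ≤ length (common x y)
      go (inj₁ h) = popular (stable h)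
      go {x} {y} (inj₂ h) = ≤-trans (popular (stable h)) (common-sym y x)

  open Many Allowed allowed? star θ noLargeForbidden
  open FreeWalk C E-sym R R? R-sym using (chordCount)

  qq Bc : ℕ
  qq = densityConst (suc k₀) (4 * (suc k₀ * star))
  Bc = 8 * D * (c k * c k)

  -- Only shortest offenders are listed: the walk itself must satisfy `LS`, since `overfull-few`
  -- counts such walks.
  Over : List (Fin N) → Set
  Over [] = ⊥
  Over (a ∷ l) = (3 ≤ length l × length l < k) × (LS (length l) (a ∷ l) × Overfull (length l) (π a) (π (last a l)))

  over? : ∀ l → Dec (Over l)
  over? [] = no λ ()
  over? (a ∷ l) = ((3 ≤? length l) ×-dec (length l <? k)) ×-dec (ls? (length l) (a ∷ l) ×-dec overfull? (length l) (π a) (π (last a l)))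

  over-intro : ∀ i a l → length l ≡ i → 3 ≤ i → i < k → LS i (a ∷ l) → Overfull i (π a) (π (last a l)) → Over (a ∷ l)
  over-intro _ a l refl h h' ls of = (h , h') , ls , of

  Chordπ : List (Fin N) → Set
  Chordπ = Chord (Relπ R R?)

  chordπ? : ∀ l → Dec (Chordπ l)
  chordπ? = chord? (Relπ R R?) (relπ? R R?)

  Faulty : List (Fin N) → Set
  Faulty l = Chordπ l ⊎ Over l

  faulty? : ∀ l → Dec (Faulty l)
  faulty? l = chordπ? l ⊎-dec over? l

  starting-total : ∀ m → ∑ᶠ (λ x → ∑ᴸ U (suc m) λ l → 𝟙 (walk? l ×-dec labelAt? 0 x l)) ≤ N * d ^ m
  starting-total m = ≤-trans (≤-reflexive (sym (∑ᴸ-∑ U (suc m) V (λ l x → 𝟙 (walk? l ×-dec labelAt? 0 x l)))))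
    (≤-trans (∑ᴸ-mono U (suc m) (λ l _ → perList l)) (walks-total m))
    where
    perList : ∀ l → ∑ᶠ (λ x → 𝟙 (walk? l ×-dec labelAt? 0 x l)) ≤ 𝟙 (walk? l)
    perList [] = ≤-trans (∑-mono V (λ x → 𝟙-≤ (walk? [] ×-dec labelAt? 0 x []) {0} λ { (_ , ()) })) (≤-trans (≤-reflexive (∑-zero V)) z≤n)
    perList (a ∷ l) = ≤-trans (≤-reflexive (trans (∑-cong V (λ x → 𝟙-×-dec (walk? (a ∷ l)) (π a Fin.≟ x)))
        (∑-*ˡ V (𝟙 (walk? (a ∷ l))) (λ x → 𝟙 (π a Fin.≟ x)))))
      (≤-trans (*-monoʳ-≤ (𝟙 (walk? (a ∷ l))) (∑-≤1 V (λ x → 𝟙 (π a Fin.≟ x)) (Unique.allFin⁺ n) (λ x → 𝟙≤1 (π a Fin.≟ x))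
        (λ {x} {y} h h' → trans (sym (𝟙-elim (π a Fin.≟ x) h)) (𝟙-elim (π a Fin.≟ y) h')))) (≤-reflexive (*-identityʳ _)))

  -- Summing `overfull-few` over `x` gives one power of `d` less than the general bound N d^i for
  -- walks of this length, so these faults become negligible for large `d`.
  over-count : ∀ i m → suc m ≡ i → 3 ≤ i → i < k → ∑ᴸ U (suc i) (λ l → 𝟙 (walk? l ×-dec over? l)) ≤ Bc * (N * d ^ m)
  over-count i m i≡ 3≤i i<k = begin
    ∑ᴸ U (suc i) (λ l → 𝟙 (walk? l ×-dec over? l))
      ≤⟨ ∑ᴸ-mono U (suc i) perList ⟩
    ∑ᴸ U (suc i) (λ l → ∑ᶠ λ x → ∑ᶠ λ y → 𝟙 (overfull? i x y) * 𝟙 (ls? i l ×-dec ends? x y l))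
      ≡⟨ ∑ᴸ-∑ U (suc i) V (λ l x → ∑ᶠ λ y → 𝟙 (overfull? i x y) * 𝟙 (ls? i l ×-dec ends? x y l)) ⟩
    ∑ᶠ (λ x → ∑ᴸ U (suc i) λ l → ∑ᶠ λ y → 𝟙 (overfull? i x y) * 𝟙 (ls? i l ×-dec ends? x y l))
      ≡⟨ ∑-cong V (λ x → trans (∑ᴸ-∑ U (suc i) V (λ l y → 𝟙 (overfull? i x y) * 𝟙 (ls? i l ×-dec ends? x y l)))
           (∑-cong V λ y → ∑ᴸ-*ˡ U (suc i) (𝟙 (overfull? i x y)) (λ l → 𝟙 (ls? i l ×-dec ends? x y l)))) ⟩
    ∑ᶠ (λ x → ∑ᶠ λ y → 𝟙 (overfull? i x y) * cnt i x y)
      ≤⟨ ∑-mono V (λ x → From.overfull-few x i m i≡ 2≤m m≤w (k ∸ i) (m<n⇒0<n∸m i<k) (m+[n∸m]≡n (<⇒≤ i<k)) j j≡ φ 1≤φ D D≡ κ≤ T≥) ⟩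
    ∑ᶠ (λ x → 8 * D * (c m * c 1) * ∑ᴸ U i λ l → 𝟙 (walk? l ×-dec labelAt? 0 x l))
      ≡⟨ ∑-*ˡ V (8 * D * (c m * c 1)) (λ x → ∑ᴸ U i λ l → 𝟙 (walk? l ×-dec labelAt? 0 x l)) ⟩
    8 * D * (c m * c 1) * ∑ᶠ (λ x → ∑ᴸ U i λ l → 𝟙 (walk? l ×-dec labelAt? 0 x l))
      ≤⟨ *-mono-≤ (*-monoʳ-≤ (8 * D) (*-mono-≤ (c-mono m≤k) (c-mono 1≤k))) starts ⟩
    Bc * (N * d ^ m) ∎
    where
    open ≤-Reasoning
    2≤m : 2 ≤ m
    2≤m = ≤-pred (≤-trans 3≤i (≤-reflexive (sym i≡)))
    m≤k : m ≤ k
    m≤k = ≤-trans (n≤1+n m) (≤-trans (≤-reflexive i≡) (<⇒≤ i<k))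
    1≤k : 1 ≤ k
    1≤k = ≤-trans (s≤s z≤n) i<k
    m≤w : m ≤ w
    m≤w = ≤-trans m≤k k≤w
    starts : ∑ᶠ (λ x → ∑ᴸ U i λ l → 𝟙 (walk? l ×-dec labelAt? 0 x l)) ≤ N * d ^ m
    starts = subst (λ r → ∑ᶠ (λ x → ∑ᴸ U r λ l → 𝟙 (walk? l ×-dec labelAt? 0 x l)) ≤ N * d ^ m) i≡ (starting-total m)
    perList : ∀ l → length l ≡ suc i → 𝟙 (walk? l ×-dec over? l) ≤ ∑ᶠ λ x → ∑ᶠ λ y → 𝟙 (overfull? i x y) * 𝟙 (ls? i l ×-dec ends? x y l)
    perList (a ∷ l) e = 𝟙-≤ (walk? (a ∷ l) ×-dec over? (a ∷ l)) λ h → found (subst (λ r → LS r (a ∷ l) × Overfull r (π a) (π (last a l))) (suc-injective e) (proj₂ (proj₂ h)))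
      where
      f : Fin n → Fin n → ℕ
      f x y = 𝟙 (overfull? i x y) * 𝟙 (ls? i (a ∷ l) ×-dec ends? x y (a ∷ l))
      found : LS i (a ∷ l) × Overfull i (π a) (π (last a l)) → 1 ≤ ∑ᶠ λ x → ∑ᶠ λ y → f x y
      found (ls , of) = ≤-trans (*-mono-≤ (𝟙≡1 (overfull? i (π a) (π (last a l))) of) (𝟙≡1 (ls? i (a ∷ l) ×-dec ends? (π a) (π (last a l)) (a ∷ l)) (ls , refl , refl)))
        (≤-trans (∑ᶠ-∈ (f (π a)) (π (last a l))) (∑ᶠ-∈ (λ x → ∑ᶠ λ y → f x y) (π a)))

  over-none : ∀ i → ¬ (3 ≤ i × i < k) → ∑ᴸ U (suc i) (λ l → 𝟙 (walk? l ×-dec over? l)) ≤ 0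
  over-none i ¬h = ≤-trans (∑ᴸ-mono U (suc i) {λ l → 𝟙 (walk? l ×-dec over? l)} {λ _ → 0} perList) (≤-reflexive (trans (∑ᴸ-const U (suc i) 0) (*-zeroʳ (length U ^ suc i))))
    where
    perList : ∀ l → length l ≡ suc i → 𝟙 (walk? l ×-dec over? l) ≤ 0
    perList (a ∷ l) e = 𝟙-≤ (walk? (a ∷ l) ×-dec over? (a ∷ l)) λ { (_ , (h , _)) → ⊥-elim (¬h (subst (λ r → 3 ≤ r × r < k) (suc-injective e) h)) }

  over-bound : ∀ m → qq * (d * d) * ∑ᴸ U m (λ l → 𝟙 (walk? l ×-dec over? l)) ≤ N * (qq * Bc) * d ^ m
  over-bound zero = ≤-trans (≤-reflexive (*-zeroʳ (qq * (d * d)))) z≤n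
  over-bound (suc zero) = ≤-trans (*-monoʳ-≤ (qq * (d * d)) (over-none 0 (λ { (() , _) }))) (≤-trans (≤-reflexive (*-zeroʳ (qq * (d * d)))) z≤n)
  over-bound (suc (suc m)) = go ((3 ≤? suc m) ×-dec (suc m <? k))
    where
    open ≤-Reasoning
    ring : ∀ q d b N e → q * (d * d) * (b * (N * e)) ≡ N * (q * b) * (d * (d * e))
    ring = solve-∀
    go : Dec (3 ≤ suc m × suc m < k) → qq * (d * d) * ∑ᴸ U (2 + m) (λ l → 𝟙 (walk? l ×-dec over? l)) ≤ N * (qq * Bc) * d ^ (2 + m)
    go (yes (h , h')) = ≤-trans (*-monoʳ-≤ (qq * (d * d)) (over-count (suc m) m refl h h')) (≤-reflexive (ring qq d Bc N (d ^ m)))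
    go (no ¬h) = ≤-trans (*-monoʳ-≤ (qq * (d * d)) (over-none (suc m) ¬h)) (≤-trans (≤-reflexive (*-zeroʳ (qq * (d * d)))) z≤n)

  K : ℕ
  K = qq * (pairConst S qq + Bc)

  ¬Faulty[] : ¬ Faulty []
  ¬Faulty[] (inj₁ ())
  ¬Faulty[] (inj₂ ())

  open Avoid Faulty faulty? ¬Faulty[] (qq * (d * d)) (N * (d + K))

  faulty-few : ∀ m → qq * (d * d) * #B m ≤ N * (d + K) * d ^ m
  faulty-few m = begin
    qq * (d * d) * #B m
      ≤⟨ *-monoʳ-≤ (qq * (d * d)) (≤-trans (∑ᴸ-mono U m (λ l _ → 𝟙-⊎ (walk? l ×-dec faulty? l) (walk? l ×-dec chordπ? l) (walk? l ×-dec over? l)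
           (λ { (wk , inj₁ h) → inj₁ (wk , h) ; (wk , inj₂ h) → inj₂ (wk , h) })))
         (≤-reflexive (∑ᴸ-+ U m (λ l → 𝟙 (walk? l ×-dec chordπ? l)) (λ l → 𝟙 (walk? l ×-dec over? l))))) ⟩
    qq * (d * d) * (∑ᴸ U m (λ l → 𝟙 (walk? l ×-dec chordπ? l)) + ∑ᴸ U m (λ l → 𝟙 (walk? l ×-dec over? l)))
      ≡⟨ *-distribˡ-+ (qq * (d * d)) _ _ ⟩
    qq * (d * d) * ∑ᴸ U m (λ l → 𝟙 (walk? l ×-dec chordπ? l)) + qq * (d * d) * ∑ᴸ U m (λ l → 𝟙 (walk? l ×-dec over? l))
      ≤⟨ +-mono-≤ (chordCount qq (pairConst S qq) (λ X Y uX uY lX lY → pairs-≤ 1≤S kfree qq d X Y uX uY lX lY) m) (over-bound m) ⟩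
    N * (d + qq * pairConst S qq) * d ^ m + N * (qq * Bc) * d ^ m
      ≡⟨ ring N d qq (pairConst S qq) Bc (d ^ m) ⟩
    N * (d + K) * d ^ m ∎
    where
    open ≤-Reasoning
    ring : ∀ N d q p b e → N * (d + q * p) * e + N * (q * b) * e ≡ N * (d + q * (p + b)) * e
    ring = solve-∀

  -- By induction, a subwalk violating level `i` itself satisfies `LS i`. It has conflicting ends,
  -- which is a fault; or it is overfull at length 2, which allowed walks exclude; or it is overfull
  -- at a length between 3 and k - 1, again a fault.
  faultless⇒LS : ∀ l → AWalk l → ¬ Infix Faulty l → ∀ i → i ≤ k → LS i l
  faultless⇒LS l aw ¬f zero _ = AWalk⇒Walk l aw
  faultless⇒LS l aw ¬f (suc i) i<k = ls , λ inf → violated (Infix⇒∃ l inf)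
    where
    ls : LS i l
    ls = faultless⇒LS l aw ¬f i (<⇒≤ i<k)
    violated : (∃ λ p → ∃₂ λ q r → l ≡ p ++ q ++ r × Violates i q) → ⊥
    violated (p , a ∷ [] , r , eq , (len , 2≤i , _)) = <⇒≱ 2≤i (≤-trans (≤-reflexive (sym len)) z≤n)
    violated (p , a ∷ b ∷ [] , r , eq , (len , 2≤i , _)) = <⇒≱ 2≤i (≤-reflexive (sym len))
    violated (p , a ∷ b ∷ e ∷ s , r , eq , (len , 2≤i , inj₁ rel)) = ¬f (subst (Infix Faulty) (sym eq) (Infix-++ p (a ∷ b ∷ e ∷ s) r (inj₁ rel)))
    violated (p , a ∷ b ∷ e ∷ s , r , eq , (len , 2≤i , inj₂ many)) = crowded s eq len many (R? (π a) (π (last e s)))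
      where
      crowded : ∀ s → l ≡ p ++ (a ∷ b ∷ e ∷ s) ++ r → 2 + length s ≡ i → c i < cnt i (π a) (π (last e s)) → Dec (R (π a) (π (last e s))) → ⊥
      crowded s eq len many (yes rel) = ¬f (subst (Infix Faulty) (sym eq) (Infix-++ p (a ∷ b ∷ e ∷ s) r (inj₁ rel)))
      crowded [] eq len many (no ¬rel) = AWalk-allowed p a b e r (subst AWalk eq aw)
        (subst (λ i → Overfull i (π a) (π e)) (trans (sym len) two≡) (¬rel , many))
      crowded (x ∷ s) eq len many (no ¬rel) = ¬f (subst (Infix Faulty) (sym eq) (Infix-++ p (a ∷ b ∷ e ∷ x ∷ s) r (inj₂
        (over-intro i a (b ∷ e ∷ x ∷ s) len (≤-trans (s≤s (s≤s (s≤s z≤n))) (≤-reflexive len)) i<k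
          (LS-++ˡ i (a ∷ b ∷ e ∷ x ∷ s) r (LS-++ʳ i p ((a ∷ b ∷ e ∷ x ∷ s) ++ r) (subst (LS i) eq ls))) (¬rel , many)))))

  endsFree : ∀ a b e s → ¬ Infix Faulty (a ∷ b ∷ e ∷ s) → ¬ R (π a) (π (last e s))
  endsFree a b e s ¬f rel = ¬f (now (subst (Prefix Faulty) (++-identityʳ (a ∷ b ∷ e ∷ s)) (Prefix-++ (a ∷ b ∷ e ∷ s) [] (inj₁ rel))))

  cnt-k≤ : ∀ x y → ¬ R x y → cnt k x y ≤ c k
  cnt-k≤ x y ¬r = ≮⇒≥ λ h → overfull-k-⊥ k (k₀ ∸ 1) x y (trans (cong suc (m+[n∸m]≡n 1≤k₀)) (sym k≡)) refl (¬r , h)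

  -- Faultless allowed walks are counted by the labels of their ends: n² pairs, each with at most
  -- c(k) walks, since an overfull pair at length k would close a cycle.
  faultless-few : ∑ᴸ U (suc k) (λ l → 𝟙 (aWalk? l)) ≤ #infix (suc k) + n * n * c k
  faultless-few = begin
    ∑ᴸ U (suc k) (λ l → 𝟙 (aWalk? l))
      ≤⟨ ∑ᴸ-mono U (suc k) perList ⟩
    ∑ᴸ U (suc k) (λ l → 𝟙 (walk? l ×-dec infix? faulty? l) + ∑ᶠ λ x → ∑ᶠ λ y → 𝟙 (¬? (R? x y)) * 𝟙 (ls? k l ×-dec ends? x y l))
      ≡⟨ ∑ᴸ-+ U (suc k) (λ l → 𝟙 (walk? l ×-dec infix? faulty? l)) (λ l → ∑ᶠ λ x → ∑ᶠ λ y → 𝟙 (¬? (R? x y)) * 𝟙 (ls? k l ×-dec ends? x y l)) ⟩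
    #infix (suc k) + ∑ᴸ U (suc k) (λ l → ∑ᶠ λ x → ∑ᶠ λ y → 𝟙 (¬? (R? x y)) * 𝟙 (ls? k l ×-dec ends? x y l))
      ≡⟨ cong (#infix (suc k) +_) (trans (∑ᴸ-∑ U (suc k) V (λ l x → ∑ᶠ λ y → 𝟙 (¬? (R? x y)) * 𝟙 (ls? k l ×-dec ends? x y l)))
           (∑-cong V λ x → trans (∑ᴸ-∑ U (suc k) V (λ l y → 𝟙 (¬? (R? x y)) * 𝟙 (ls? k l ×-dec ends? x y l)))
             (∑-cong V λ y → ∑ᴸ-*ˡ U (suc k) (𝟙 (¬? (R? x y))) (λ l → 𝟙 (ls? k l ×-dec ends? x y l))))) ⟩
    #infix (suc k) + ∑ᶠ (λ x → ∑ᶠ λ y → 𝟙 (¬? (R? x y)) * cnt k x y)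
      ≤⟨ +-monoʳ-≤ (#infix (suc k)) (∑-≤-const V (length V * c k) λ x _ → ∑-≤-const V (c k) λ y _ → perPair x y (R? x y)) ⟩
    #infix (suc k) + length V * (length V * c k)
      ≡⟨ cong (#infix (suc k) +_) (trans (cong (λ r → r * (r * c k)) (length-tabulate {n = n} (λ z → z))) (sym (*-assoc n n (c k)))) ⟩
    #infix (suc k) + n * n * c k ∎
    where
    open ≤-Reasoning
    perPair : ∀ x y (r? : Dec (R x y)) → 𝟙 (¬? r?) * cnt k x y ≤ c k
    perPair x y (yes _) = z≤n
    perPair x y (no ¬r) = ≤-trans (≤-reflexive (*-identityˡ (cnt k x y))) (cnt-k≤ x y ¬r)
    f : List (Fin N) → Fin n → Fin n → ℕ
    f l x y = 𝟙 (¬? (R? x y)) * 𝟙 (ls? k l ×-dec ends? x y l)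
    faultless : ∀ l → length l ≡ suc k → AWalk l → ¬ Infix Faulty l → 1 ≤ ∑ᶠ λ x → ∑ᶠ λ y → f l x y
    faultless (a ∷ []) len _ _ = ⊥-elim (0≢1+n (trans (suc-injective len) k≡))
    faultless (a ∷ b ∷ []) len _ _ = ⊥-elim (<⇒≱ 1≤k₀ (≤-reflexive (suc-injective (trans (sym k≡) (sym (suc-injective len))))))
    faultless (a ∷ b ∷ e ∷ s) len aw ¬f = ≤-trans (*-mono-≤ (𝟙≡1 (¬? (R? (π a) (π (last e s)))) (endsFree a b e s ¬f))
        (𝟙≡1 (ls? k (a ∷ b ∷ e ∷ s) ×-dec ends? (π a) (π (last e s)) (a ∷ b ∷ e ∷ s)) (faultless⇒LS (a ∷ b ∷ e ∷ s) aw ¬f k ≤-refl , refl , refl)))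
      (≤-trans (∑ᶠ-∈ (f (a ∷ b ∷ e ∷ s) (π a)) (π (last e s))) (∑ᶠ-∈ (λ x → ∑ᶠ λ y → f (a ∷ b ∷ e ∷ s) x y) (π a)))
    perList : ∀ l → length l ≡ suc k → 𝟙 (aWalk? l) ≤ 𝟙 (walk? l ×-dec infix? faulty? l) + ∑ᶠ λ x → ∑ᶠ λ y → f l x y
    perList l len = 𝟙-≤ (aWalk? l) λ aw → go aw (infix? faulty? l)
      where
      go : AWalk l → Dec (Infix Faulty l) → 1 ≤ 𝟙 (walk? l ×-dec infix? faulty? l) + ∑ᶠ λ x → ∑ᶠ λ y → f l x y
      go aw (yes h) = ≤-trans (𝟙≡1 (walk? l ×-dec infix? faulty? l) (AWalk⇒Walk l aw , h)) (m≤m+n _ _)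
      go aw (no ¬h) = ≤-trans (faultless l len aw ¬h) (m≤n+m _ _)

  main-bound : N * θ ^ suc k₀ ≤ 2 * (n * n * c k)
  main-bound = numeric N d (4 * (suc k₀ * star)) θ (suc k₀) K (#infix (suc (suc k₀))) (n * n * c k) d≡' 1≤d K≤
    (infix-few (suc (suc k₀)) (λ m _ → faulty-few m) (suc (suc k₀)) ≤-refl)
    (≤-trans (aWalks-many 1≤θ k₀ 1≤star d≡ average) (subst (λ r → ∑ᴸ U (suc r) (λ l → 𝟙 (aWalk? l)) ≤ #infix (suc r) + n * n * c k) k≡ faultless-few))
    where
    1≤star : 1 ≤ star
    1≤star = ≤-trans (s≤s z≤n) star>
    d≡' : d ≡ 4 * (suc k₀ * star) * θ
    d≡' = trans d≡ (ring (suc k₀) star θ)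
      where
      ring : ∀ k s t → 4 * (k * (s * t)) ≡ 4 * (k * s) * t
      ring = solve-∀
    1≤d : 1 ≤ d
    1≤d = ≤-trans (*-mono-≤ {1} {4} (s≤s z≤n) (*-mono-≤ {1} {suc k₀} (s≤s z≤n) (*-mono-≤ 1≤star 1≤θ))) (≤-reflexive (sym d≡))

-- Choice of constants

anyList? : ∀ {n} m {P : List (Fin n) → Set} → (∀ l → Dec (P l)) → Dec (∃ λ l → length l ≡ m × P l)
anyList? zero P? = map′ (λ p → [] , refl , p) (λ { ([] , _ , p) → p }) (P? [])
anyList? (suc m) P? = map′ (λ { (v , l , e , p) → v ∷ l , cong suc e , p }) (λ { (v ∷ l , e , p) → v , l , suc-injective e , p })
  (Fin.any? λ v → anyList? m (P? ∘ (v ∷_)))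

lookup-unique : ∀ {A : Set} {l : List A} → Unique l → ∀ {i j} → lookup l i ≡ lookup l j → i ≡ j
lookup-unique {l = l} u {i} {j} e = decidable-stable (i Fin.≟ j) λ ne → go (AllPairs-lookup u ne)
  where
  go : lookup l i ≢ lookup l j ⊎ lookup l j ≢ lookup l i → ⊥
  go (inj₁ h) = h e
  go (inj₂ h) = h (sym e)

module _ {n : ℕ} (G : Graph n) (inA : Fin n → Bool) where

  -- At most `s` of the 2 s vertices of `Y` are among the `s` vertices taken from `X`. The others
  -- differ from these, so their conflicts are edges.
  Kss-free⇒KFree : ∀ s → ¬ ContainsKss G s → KFree (s + s) (Conf G inA)
  Kss-free⇒KFree s free X Y uX uY lX lY conf = free (f , g , f-injective , g-injective , disjoint , adjacent)
    where
    X' Y' : List (Fin n)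
    X' = take s X
    new? : ∀ y → Dec (¬ y ∈ X')
    new? y = ¬? (y ∈? X')
    Y' = take s (filter new? Y)
    lenX' : s ≡ length X'
    lenX' = sym (length-take-≤ s {X} (≤-trans (m≤m+n s s) (≤-reflexive (sym lX))))
    enough : s ≤ length (filter new? Y)
    enough = +-cancelˡ-≤ s _ _ (begin
      s + s ≤⟨ lY ⟩
      length Y ≡⟨ sym (filter-split (_∈? X') Y) ⟩
      length (filter (_∈? X') Y) + length (filter new? Y) ≤⟨ +-monoˡ-≤ _ old ⟩
      s + length (filter new? Y) ∎)
      where
      open ≤-Reasoning
      old : length (filter (_∈? X') Y) ≤ s
      old = ≤-trans (≤-reflexive (count-filter (_∈? X') Y)) (≤-trans (∑-unique-≤ Y uY (λ v → 𝟙 (v ∈? X')))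
        (≤-trans (∑ᶠ-∈?-≤ X') (≤-reflexive (sym lenX'))))
    lenY' : s ≡ length Y'
    lenY' = sym (length-take-≤ s {filter new? Y} enough)
    f g : Fin s → Fin n
    f i = lookup X' (cast lenX' i)
    g i = lookup Y' (cast lenY' i)
    cast-injective : ∀ {a b} (e : a ≡ b) {i j : Fin a} → cast e i ≡ cast e j → i ≡ j
    cast-injective e {i} {j} h = Fin.toℕ-injective (trans (sym (Fin.toℕ-cast e i)) (trans (cong toℕ h) (Fin.toℕ-cast e j)))
    f-injective : Injective _≡_ _≡_ f
    f-injective h = cast-injective lenX' (lookup-unique (Unique.take⁺ s uX) h)
    g-injective : Injective _≡_ _≡_ g
    g-injective h = cast-injective lenY' (lookup-unique (Unique.take⁺ s (Unique.filter⁺ new? uY)) h)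
    f∈ : ∀ i → f i ∈ X'
    f∈ i = ∈-lookup (cast lenX' i)
    g∈ : ∀ i → g i ∈ Y × ¬ g i ∈ X'
    g∈ i = ∈-filter⁻ new? {xs = Y} (take-⊆ s (∈-lookup {xs = Y'} (cast lenY' i)))
    disjoint : ∀ i j → ¬ (f i ≡ g j)
    disjoint i j e = proj₂ (g∈ j) (subst (_∈ X') e (f∈ i))
    adjacent : ∀ i j → Adj G (f i) (g j)
    adjacent i j = go (conf (take-⊆ s (f∈ i)) (proj₁ (g∈ j)))
      where
      go : Conf G inA (f i) (g j) → Adj G (f i) (g j)
      go (inj₁ e) = ⊥-elim (disjoint i j e)
      go (inj₂ a) = a

  sum-map : ∀ {A : Set} (xs : List A) (f : A → ℕ) → sum (map f xs) ≡ ∑ xs f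
  sum-map [] f = refl
  sum-map (x ∷ xs) f = cong (f x +_) (sum-map xs f)

  -- The summand of eAB is local to the definition of eAB; it is recovered here by unification.
  eAB-summand : ∃ λ (f : Fin n → Fin n → ℕ) → eAB G inA ≡ sum (map (λ a → sum (map (λ b → f a b) (allFin n))) (allFin n))
  eAB-summand = _ , refl

  summand : Fin n → Fin n → ℕ
  summand = proj₁ eAB-summand

  summand≤edge : ∀ a b → summand a b ≤ 𝟙 (edge? G inA a b)
  summand≤edge a b with inA a | inA b
  ... | true | true = z≤n
  ... | false | _ = z≤n
  ... | true | false with adj? G a b
  ... | yes _ = ≤-refl
  ... | no _ = z≤n

  eAB≤edges : eAB G inA ≤ ∑ᶠ λ u → ∑ᶠ λ v → 𝟙 (edge? G inA u v)
  eAB≤edges = ≤-trans (≤-reflexive (trans (proj₂ eAB-summand) (sum-map (allFin n) (λ a → sum (map (λ b → summand a b) (allFin n))))))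
    (∑-mono (allFin n) λ a → ≤-trans (≤-reflexive (sum-map (allFin n) (summand a))) (∑-mono (allFin n) (summand≤edge a)))

^-cancel-≤ : ∀ k {a b} → 1 ≤ k → a ^ k ≤ b ^ k → a ≤ b
^-cancel-≤ k 1≤k h = ≮⇒≥ λ lt → <⇒≱ (^-monoˡ-< k {{>-nonZero 1≤k}} lt) h

m≤m^k : ∀ m k → 1 ≤ m → 1 ≤ k → m ≤ m ^ k
m≤m^k m (suc k) 1≤m _ = ≤-trans (≤-reflexive (sym (*-identityʳ m)))
  (*-monoʳ-≤ m (≤-trans (≤-reflexive (sym (^-zeroˡ k))) (^-monoˡ-≤ k 1≤m)))

record Constants (k s : ℕ) : Set where
  field
    k₀ q w T j φ D star two K : ℕ
    c : ℕ → ℕ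
    k≡ : k ≡ suc k₀
    1≤k₀ : 1 ≤ k₀
    1≤q : 1 ≤ q
    1≤w : 1 ≤ w
    T-rich : richThreshold (s + s) q w < T
    k≤w : k ≤ w
    q≥ : 2 * (2 * k + 0 + w * 2) ≤ q
    T> : 2 * (2 * (q * w * (s + s))) < T
    1≤c : ∀ i → 1 ≤ c i
    c-mono : ∀ {a i} → a ≤ i → c a ≤ c i
    c-step : ∀ m → T * m * (m * (c m * c m)) ≤ c (suc m)
    j≡ : suc j ≡ 2 * k
    1≤φ : 1 ≤ φ
    D≡ : D ≡ 4 * (suc j * (2 * φ))
    κ≤ : densityConst (suc j) (8 * suc j) * (pairConst (s + s) (densityConst (suc j) (8 * suc j)) + 2 * (q * w * (s + s))) ≤ D
    T≥ : 2 * (4 * D + q * w * (s + s)) ≤ T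
    star> : k * (k + k * (k * (q * w * (s + s)))) < star
    q≥' : 2 * (k + 0 + w * k) ≤ q
    T>' : 2 * (k * (q * w * (s + s))) < T
    two≡ : 2 ≡ two
    K≥ : densityConst (suc k₀) (4 * (suc k₀ * star)) *
         (pairConst (s + s) (densityConst (suc k₀) (4 * (suc k₀ * star))) + 8 * D * (c k * c k)) ≤ K

-- The choice is not circular: `q` depends on `k`, then `M` on `q` and `s`, then `φ`, `D` and `star`
-- on `M`, then `T` on these, then `c` on `T`, and `K` comes last. `q` and `T` are sums of the lower
-- bounds that they have to meet.
constants : ∀ k s → 2 ≤ k → Constants k s
constants (suc k₀) s (s≤s 1≤k₀) = record
  { k₀ = k₀ ; q = q ; w = k ; T = T ; j = j ; φ = φ ; D = D ; star = suc (k * (k + k * (k * M))) ; two = 2 ; K = _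
  ; c = pathBound T ; k≡ = refl ; 1≤k₀ = 1≤k₀ ; 1≤q = s≤s z≤n ; 1≤w = s≤s z≤n
  ; T-rich = s≤s (≤-trans (m≤m+n _ _) (≤-trans (m≤m+n _ _) (m≤m+n _ (2 * (4 * D + M)))))
  ; k≤w = ≤-refl ; q≥ = ≤-trans (m≤m+n _ (2 * (k + 0 + k * k))) (n≤1+n _)
  ; T> = s≤s (≤-trans (m≤n+m _ (richThreshold (s + s) q k)) (≤-trans (m≤m+n _ _) (m≤m+n _ (2 * (4 * D + M)))))
  ; 1≤c = pathBound-pos T ; c-mono = pathBound-mono T
  ; c-step = λ m → ≤-trans (≤-reflexive (*-assoc T m _)) (*-mono-≤ (n≤1+n T) (*-mono-≤ (n≤1+n m) (*-monoˡ-≤ _ (n≤1+n m))))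
  ; j≡ = refl ; 1≤φ = s≤s z≤n ; D≡ = refl
  ; κ≤ = ≤-trans (n≤1+n _) (≤-trans (m≤m+n φ _) (≤-trans (m≤n*m (2 * φ) (suc j)) (m≤n*m (suc j * (2 * φ)) 4)))
  ; T≥ = ≤-trans (m≤n+m _ (richThreshold (s + s) q k + 2 * (2 * M) + 2 * (k * M))) (n≤1+n _)
  ; star> = ≤-refl ; q≥' = ≤-trans (m≤n+m _ (2 * (2 * k + 0 + k * 2))) (n≤1+n _)
  ; T>' = s≤s (≤-trans (m≤n+m _ (richThreshold (s + s) q k + 2 * (2 * M))) (m≤m+n _ (2 * (4 * D + M))))
  ; two≡ = refl ; K≥ = ≤-refl }
  where
  k q M j φ D T : ℕ
  k = suc k₀
  q = suc (2 * (2 * k + 0 + k * 2) + 2 * (k + 0 + k * k))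
  M = q * k * (s + s)
  j = k₀ + (k + 0)
  φ = suc (densityConst (suc j) (8 * suc j) * (pairConst (s + s) (densityConst (suc j) (8 * suc j)) + 2 * M))
  D = 4 * (suc j * (2 * φ))
  T = suc (richThreshold (s + s) q k + 2 * (2 * M) + 2 * (k * M) + 2 * (4 * D + M))

module Threshold (k s : ℕ) (1≤s : 1 ≤ s) (P : Constants k s) where

  open Constants P

  -- For θ = x / (h n) and d = 4 k star θ, the value of `h` gives 4 d n ≤ x, as the cover requires.
  -- `B` exceeds both `c k`, for the final contradiction, and the lower-order terms `K`. The factor
  -- 2 in `C` makes up for rounding θ down.
  h B C : ℕ
  h = 16 * (k * star)
  B = suc (c k + K)
  C = 2 * h * B

  1≤k : 1 ≤ k
  1≤k = ≤-trans (s≤s z≤n) (≤-reflexive (sym k≡))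

  1≤h : 1 ≤ h
  1≤h = *-mono-≤ {1} {16} (s≤s z≤n) (*-mono-≤ 1≤k (≤-trans (s≤s z≤n) star>))

  1≤C : 1 ≤ C
  1≤C = *-mono-≤ {1} {2 * h} (*-mono-≤ {1} {2} (s≤s z≤n) 1≤h) (s≤s z≤n)

  module _ (n x : ℕ) (1≤n : 1 ≤ n) (large : C ^ k * n ^ (k + 1) ≤ x ^ k) where

    private instance
      hn-nonZero : NonZero (h * n)
      hn-nonZero = >-nonZero (*-mono-≤ 1≤h 1≤n)

    θ : ℕ
    θ = x / (h * n)

    θ-lower : θ * (h * n) ≤ x
    θ-lower = m/n*n≤m x (h * n)

    θ-upper : x < suc θ * (h * n)
    θ-upper = ≤-trans (s≤s (≤-reflexive (m≡m%n+[m/n]*n x (h * n)))) (+-monoˡ-< (θ * (h * n)) (m%n<n x (h * n)))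

    large' : (C * n) ^ k * n ≤ x ^ k
    large' = ≤-trans (≤-reflexive (trans (cong (_* n) (^-distrib-* C n k)) (trans (*-assoc (C ^ k) (n ^ k) n)
      (cong (C ^ k *_) (trans (*-comm (n ^ k) n) (cong (n ^_) (+-comm 1 k))))))) large

    C*n≤x : C * n ≤ x
    C*n≤x = ^-cancel-≤ k 1≤k (≤-trans (≤-trans (≤-reflexive (sym (*-identityʳ _))) (*-monoʳ-≤ ((C * n) ^ k) 1≤n)) large')

    B≤θ : B ≤ θ
    B≤θ = ≤-trans (m≤m+n B (B + 0)) (≤-pred (*-cancelʳ-< (h * n) (2 * B) (suc θ)
      (≤-<-trans (≤-trans (≤-reflexive (ring h B n)) C*n≤x) θ-upper)))
      where
      ring : ∀ h B n → 2 * B * (h * n) ≡ 2 * h * B * n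
      ring = solve-∀

    1≤θ : 1 ≤ θ
    1≤θ = ≤-trans (s≤s z≤n) B≤θ

    -- Since θ ≥ 1, x < (θ + 1) h n ≤ 2 h n θ. Taking k-th powers, (2 h n)^k cancels against (C n)^k
    -- n ≤ x^k, which leaves B^k n ≤ θ^k.
    B*n≤θ^k : B * n ≤ θ ^ k
    B*n≤θ^k = ≤-trans (*-monoˡ-≤ n (m≤m^k B k (s≤s z≤n) 1≤k)) (*-cancelˡ-≤ (g ^ k) {{>-nonZero 1≤g^k}} (begin
      g ^ k * (B ^ k * n) ≡⟨ sym (*-assoc (g ^ k) (B ^ k) n) ⟩
      g ^ k * B ^ k * n ≡⟨ cong (_* n) (sym (^-distrib-* g B k)) ⟩
      (g * B) ^ k * n ≡⟨ cong (λ r → r ^ k * n) (ring₁ h B n) ⟩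
      (C * n) ^ k * n ≤⟨ large' ⟩
      x ^ k ≤⟨ ^-monoˡ-≤ k (≤-trans (<⇒≤ θ-upper) (≤-trans (*-monoˡ-≤ (h * n) (+-monoˡ-≤ θ 1≤θ)) (≤-reflexive (ring₂ θ h n)))) ⟩
      (g * θ) ^ k ≡⟨ ^-distrib-* g θ k ⟩
      g ^ k * θ ^ k ∎))
      where
      open ≤-Reasoning
      g : ℕ
      g = 2 * (h * n)
      1≤g^k : 1 ≤ g ^ k
      1≤g^k = ≤-trans (*-mono-≤ {1} {2} (s≤s z≤n) (*-mono-≤ 1≤h 1≤n)) (m≤m^k g k (*-mono-≤ {1} {2} (s≤s z≤n) (*-mono-≤ 1≤h 1≤n)) 1≤k)
      ring₁ : ∀ h B n → 2 * (h * n) * B ≡ 2 * h * B * n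
      ring₁ = solve-∀
      ring₂ : ∀ t h n → (t + t) * (h * n) ≡ 2 * (h * n) * t
      ring₂ = solve-∀

  module _ (n : ℕ) (G : Graph n) (inA : Fin n → Bool) (1≤n : 1 ≤ n) (free : ¬ ContainsKss G s)
           (large : C ^ k * n ^ (k + 1) ≤ eAB G inA ^ k) where

    E R : Fin n → Fin n → Set
    E = Edge G inA
    R = Conf G inA

    module PG = Paths E R (Edge-sym G inA) (Conf-sym G inA)

    NoCycle : Set
    NoCycle = ∀ x a mid b → 2 * k ≡ 3 + length mid → ¬ PG.Cycle x a mid b

    t d : ℕ
    t = θ n (eAB G inA) 1≤n large
    d = 4 * (suc k₀ * (star * t))

    1≤t : 1 ≤ t
    1≤t = 1≤θ n (eAB G inA) 1≤n large

    t≤d : t ≤ d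
    t≤d = ≤-trans (m≤n*m t star {{>-nonZero (≤-trans (s≤s z≤n) star>)}}) (≤-trans (m≤n*m (star * t) (suc k₀)) (m≤n*m (suc k₀ * (star * t)) 4))

    edges : ℕ
    edges = ∑ᶠ λ u → ∑ᶠ λ v → 𝟙 (edge? G inA u v)

    ring : ∀ k s t n → 4 * (4 * (k * (s * t)) * n) ≡ t * (16 * (k * s) * n)
    ring = solve-∀

    dense-edges : 4 * (d * n) ≤ edges
    dense-edges = ≤-trans (≤-reflexive (trans (ring (suc k₀) star t n) (cong (λ r → t * (16 * (r * star) * n)) (sym k≡))))
      (≤-trans (θ-lower n (eAB G inA) 1≤n large) (eAB≤edges G inA))

    cover : Cover E (edge? G inA) d
    cover = Build.cover E (edge? G inA) (Edge-sym G inA) (λ _ → ⊤) (λ _ → yes tt) (λ _ → tt) d (≤-trans 1≤t t≤d)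
      (≤-trans (≤-reflexive (cong (λ r → 4 * (d * r)) (trans (∑-const (allFin n) 1) (trans (*-identityʳ _) (length-tabulate (λ z → z)))))) dense-edges)

    -- `main-bound` has N on one side and n² on the other, so the cover must not be smaller than the
    -- graph. It is not, because it keeps half of at least 4 d n edges at maximum degree `d`.
    cover-size : 2 * n ≤ Cover.N cover
    cover-size = *-cancelʳ-≤ (2 * n) (Cover.N cover) d {{>-nonZero (≤-trans 1≤t t≤d)}} (*-cancelˡ-≤ 2 (begin
      2 * (2 * n * d) ≡⟨ ring' n d ⟩
      4 * (d * n) ≤⟨ ≤-trans dense-edges (Cover.dense cover) ⟩
      2 * ∑ᶠ (λ a → ∑ᶠ λ b → 𝟙 (Cover.Ê? cover a b))
                                       ≤⟨ *-monoʳ-≤ 2 (∑-≤-const (allFin (Cover.N cover)) d (λ a _ → Cover.degree cover a)) ⟩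
      2 * (length (allFin (Cover.N cover)) * d)
                                       ≡⟨ cong (λ r → 2 * (r * d)) (length-tabulate {n = Cover.N cover} (λ z → z)) ⟩
      2 * (Cover.N cover * d) ∎))
      where
      open ≤-Reasoning
      ring' : ∀ n d → 2 * (2 * n * d) ≡ 4 * (d * n)
      ring' = solve-∀

    ¬NoCycle : ¬ NoCycle
    ¬NoCycle noCycle = <⇒≱ tooMany bounded
      where
      open ≤-Reasoning
      bounded : 2 * n * t ^ k ≤ 2 * (n * n * c k)
      bounded = ≤-trans (*-monoˡ-≤ (t ^ k) cover-size) (subst (λ r → Cover.N cover * t ^ r ≤ 2 * (n * n * c k)) (sym k≡)
        (Final.main-bound E R (edge? G inA) (conf? G inA) (Edge-sym G inA) (Conf-sym G inA) (inj₁ refl) inA proj₂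
          {s + s} (≤-trans 1≤s (m≤m+n s s)) (Kss-free⇒KFree G inA s free) q w T 1≤q 1≤w T-rich k noCycle k≤w q≥ T> c 1≤c c-mono c-step
          cover j j≡ φ 1≤φ D D≡ κ≤ T≥ k₀ k≡ 1≤k₀ star star> q≥' T>' two two≡ t 1≤t refl
          (≤-trans K≥ (≤-trans (≤-trans (m≤n+m K (c k)) (n≤1+n (c k + K))) (≤-trans (B≤θ n (eAB G inA) 1≤n large) t≤d)))))
      tooMany : 2 * (n * n * c k) < 2 * n * t ^ k
      tooMany = begin-strict
        2 * (n * n * c k) ≡⟨ ring″ n (c k) ⟩
        2 * n * (c k * n)
          <⟨ *-monoʳ-< (2 * n) {{>-nonZero (*-mono-≤ {1} {2} (s≤s z≤n) 1≤n)}} (*-monoˡ-< n {{>-nonZero 1≤n}} (s≤s (m≤m+n (c k) K))) ⟩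
        2 * n * (B * n) ≤⟨ *-monoʳ-≤ (2 * n) (B*n≤θ^k n (eAB G inA) 1≤n large) ⟩
        2 * n * t ^ k ∎
        where
        ring″ : ∀ n c → 2 * (n * n * c) ≡ 2 * n * (c * n)
        ring″ = solve-∀

    cycle? : ∀ x a b → Dec (∃ λ mid → length mid ≡ 2 * k ∸ 3 × PG.Cycle x a mid b)
    cycle? x a b = anyList? (2 * k ∸ 3) (λ mid → PG.cycle? (edge? G inA) (conf? G inA) x a mid b)

    SomeCycle : Set
    SomeCycle = ∃ λ x → ∃ λ a → ∃ λ b → ∃ λ mid → length mid ≡ 2 * k ∸ 3 × PG.Cycle x a mid b

    someCycle : SomeCycle
    -- The counting argument only refutes the absence of a cycle; as existence is decided by a
    -- finite search, a cycle is obtained from that.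
    someCycle = decidable-stable (Fin.any? λ x → Fin.any? λ a → Fin.any? λ b → cycle? x a b)
      λ none → ¬NoCycle λ x a mid b len cyc → none (x , a , b , mid , cong (_∸ 3) (sym len) , cyc)

    hasCycle : HasInducedBipartiteC2k G inA k
    hasCycle = convert someCycle
      where
      4≤2k : 4 ≤ 2 * k
      4≤2k = *-monoʳ-≤ 2 (≤-trans (s≤s 1≤k₀) (≤-reflexive (sym k≡)))
      convert : SomeCycle → HasInducedBipartiteC2k G inA k
      convert (x , a , b , [] , len , cyc) = ⊥-elim (<⇒≱ 4≤2k (m∸n≡0⇒m≤n (sym len)))
      convert (x , a , b , v ∷ mid , len , cyc) = cycle⇒induced G inA k x a v mid b
        (trans (sym (m+[n∸m]≡n (≤-trans (n≤1+n 3) 4≤2k))) (cong (3 +_) (sym len))) cyc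

theorem4p1 : (k s : ℕ) → 2 ≤ k → 2 ≤ s →
    Σ ℕ λ C → 1 ≤ C ×
    (∀ (n : ℕ) (G : Graph n) (inA : Fin n → Bool) →
    1 ≤ n → ¬ ContainsKss G s →
    C ^ k * n ^ (k + 1) ≤ eAB G inA ^ k →
    HasInducedBipartiteC2k G inA k)
theorem4p1 k s 2≤k 2≤s = T.C , T.1≤C , T.hasCycle
  where
  module T = Threshold k s (≤-trans (s≤s z≤n) 2≤s) (constants k s 2≤k)
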